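{- (a) For $n\ge4$, the matroid ${\mathcal M}_{g_{1,1,0}}(K_n)$ (the even cycle matroid) is the unique maximal $C_4$-matroid on $K_n$ and its rank function is ${\rm val}_{C_4}$. (b) For $n\ge7$, ${\mathcal M}_{g_{2,1,2}}(K_n)$ is the unique maximal $\{K_5^-,K_{3,4}\}$-matroid on $K_n$ and its rank function is ${\rm val}_{\{K_5^-,K_{3,4}\}}$.
   Context: For $F\subseteq E(K_n)$, $V(F)$ is the set of vertices incident to $F$ and $\beta(F)$ is the number of bipartite connected components of the graph $(V(F),F)$. For integers $a\ge b\ge0$ and $c$, $g_{a,b,c}(F)=a|V(F)|-b\beta(F)-c$, and ${\mathcal M}_{g_{a,b,c}}(K_n)$ is the matroid on $E(K_n)$ whose independent sets are those $F$ with $|I|\le g_{a,b,c}(I)$ for every nonempty $I\subseteq F$. $K_5^-$ is $K_5$ minus an edge, $C_4$ the 4-cycle. For a family ${\mathcal H}$ of graphs, an ${\mathcal H}$-matroid on $K_n$ is a matroid on $E(K_n)$ in which the edge set of every subgraph isomorphic to a member of ${\mathcal H}$ is a circuit; maximality is in the weak order (${\mathcal M}_1\preceq{\mathcal M}_2$ if every independent set of ${\mathcal M}_1$ is independent in ${\mathcal M}_2$). With ${\mathcal X}$ the family of these edge sets: a proper ${\mathcal X}$-sequence is $(X_1,\dots,X_k)$ in ${\mathcal X}$ with $X_i\not\subseteq\bigcup_{j<i}X_j$ for $i\ge2$; ${\rm val}(F,{\mathcal S})=|F\cup\bigcup_iX_i|-k$; ${\rm val}_{\mathcal H}(F)=\min_{\mathcal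 S}{\rm val}(F,{\mathcal S})$. -}

module Defs where

open import Data.Bool using (Bool; true; false; T; _∨_; _∧_; not; if_then_else_)
open import Data.Nat as ℕ using (ℕ; zero; suc)
open import Data.Integer as ℤ using (ℤ; +_)
open import Data.Fin using (Fin; toℕ) renaming (zero to f0; suc to fs)
open import Data.Fin.Properties using (_≟_; _<?_)
open import Data.List using (List; []; _∷_; length; filterᵇ; concatMap; foldr; allFin)
open import Data.Bool.ListAction using (any)
open import Data.List.Relation.Unary.All using (All)
open import Data.List.Relation.Unary.Any using (Any)
open import Data.List.Relation.Unary.AllPairs using (AllPairs)
open import Data.List.Membership.Propositional using (_∈_)
open import Data.Product using (Σ; ∃; ∃-syntax; _×_; _,_; proj₁; proj₂)
open import Data.Unit using (⊤)
open import Data.Empty using (⊥)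
open import Relation.Nullary using (¬_; yes; no; does)
open import Relation.Binary.PropositionalEquality using (_≡_; _≢_)
open import Relation.Binary.Construct.Closure.ReflexiveTransitive using (Star)
open import Function.Definitions using (Injective)
import Data.Fin as F

Edge : ℕ → Set
Edge n = Σ (Fin n × Fin n) (λ p → proj₁ p F.< proj₂ p)

allEdges : (n : ℕ) → List (Edge n)
allEdges n = concatMap (λ i → concatMap (λ j → mk i j) (allFin n)) (allFin n)
  where
  mk : Fin n → Fin n → List (Edge n)
  mk i j with i <? j
  ... | yes p = ((i , j) , p) ∷ []
  ... | no _ = []

joins : {n : ℕ} → Edge n → Fin n → Fin n → Bool
joins ((i , j) , _) u v =
  (does (i ≟ u) ∧ does (j ≟ v)) ∨ (does (i ≟ v) ∧ does (j ≟ u))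

sameEdge : {n : ℕ} → Edge n → Edge n → Bool
sameEdge ((i , j) , _) f = joins f i j

EdgeSet : ℕ → Set
EdgeSet n = Edge n → Bool

∅ : {n : ℕ} → EdgeSet n
∅ _ = false

_⊆_ : {n : ℕ} → EdgeSet n → EdgeSet n → Set
A ⊆ B = ∀ e → T (A e) → T (B e)

_∪_ : {n : ℕ} → EdgeSet n → EdgeSet n → EdgeSet n
(A ∪ B) e = A e ∨ B e

insert : {n : ℕ} → Edge n → EdgeSet n → EdgeSet n
insert x A e = sameEdge x e ∨ A e

∣_∣ : {n : ℕ} → EdgeSet n → ℕ
∣_∣ {n} A = length (filterᵇ A (allEdges n))

Nonempty : {n : ℕ} → EdgeSet n → Set
Nonempty A = ∃[ e ] T (A e)

record IsMatroid {n : ℕ} (Ind : EdgeSet n → Set) : Set where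
  field
    ind-∅   : Ind ∅
    ind-sub : ∀ I J → J ⊆ I → Ind I → Ind J
    ind-aug : ∀ I J → Ind I → Ind J → ∣ I ∣ ℕ.< ∣ J ∣ →
              ∃[ e ] (T (J e) × ¬ T (I e) × Ind (insert e I))

record Matroid (n : ℕ) : Set₁ where
  field
    Ind       : EdgeSet n → Set
    isMatroid : IsMatroid Ind
open Matroid public

_⪯_ : {n : ℕ} → Matroid n → Matroid n → Set
M₁ ⪯ M₂ = ∀ I → Ind M₁ I → Ind M₂ I

Circuit : {n : ℕ} → Matroid n → EdgeSet n → Set
Circuit M X = ¬ Ind M X × (∀ Y → Y ⊆ X → (∃[ e ] (T (X e) × ¬ T (Y e))) → Ind M Y)

Rank : {n : ℕ} → Matroid n → EdgeSet n → ℕ → Set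
Rank M F k =
  (∃[ I ] (I ⊆ F × Ind M I × ∣ I ∣ ≡ k)) ×
  (∀ I → I ⊆ F → Ind M I → ∣ I ∣ ℕ.≤ k)

inV : {n : ℕ} → EdgeSet n → Fin n → Bool
inV {n} F v = any (λ e → F e ∧ incident e) (allEdges n)
  where
  incident : Edge n → Bool
  incident ((i , j) , _) = does (i ≟ v) ∨ does (j ≟ v)

∣V_∣ : {n : ℕ} → EdgeSet n → ℕ
∣V_∣ {n} F = length (filterᵇ (inV F) (allFin n))

Adj : {n : ℕ} → EdgeSet n → Fin n → Fin n → Set
Adj F u v = ∃[ e ] (T (F e) × T (joins e u v))

Connected : {n : ℕ} → EdgeSet n → Fin n → Fin n → Set
Connected F = Star (Adj F)

BipartiteComp : {n : ℕ} → EdgeSet n → Fin n → Set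
BipartiteComp {n} F v =
  Σ (Fin n → Bool) (λ c → ∀ (u w : Fin n) → Connected F v u → Adj F u w → c u ≢ c w)

-- β(F) = b : there is a list of representatives, one for each bipartite
-- connected component of (V(F), F)
Beta : {n : ℕ} → EdgeSet n → ℕ → Set
Beta {n} F b = ∃[ reps ]
  ( length reps ≡ b
  × All (λ r → T (inV F r) × BipartiteComp F r) reps
  × AllPairs (λ r s → ¬ Connected F r s) reps
  × (∀ v → T (inV F v) → BipartiteComp F v → Any (Connected F v) reps) )

g : ℕ → ℕ → ℤ → {n : ℕ} → EdgeSet n → ℕ → ℤ
g a b c F β = (+ a ℤ.* + ∣V F ∣ ℤ.- + b ℤ.* + β) ℤ.- c

IndG : ℕ → ℕ → ℤ → {n : ℕ} → EdgeSet n → Set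
IndG a b c F = ∀ I → I ⊆ F → Nonempty I → ∀ β → Beta I β → + ∣ I ∣ ℤ.≤ g a b c I β

record Pattern : Set where
  field
    k     : ℕ
    pedges : List (Fin k × Fin k)
open Pattern public

copyEdges : {n : ℕ} (G : Pattern) → (Fin (k G) → Fin n) → EdgeSet n
copyEdges G φ e = any (λ p → joins e (φ (proj₁ p)) (φ (proj₂ p))) (pedges G)

InX : {n : ℕ} → List Pattern → EdgeSet n → Set
InX {n} H X = Any (λ G → ∃[ φ ] (Injective _≡_ _≡_ φ × (∀ e → X e ≡ copyEdges {n} G φ e))) H

HMatroid : {n : ℕ} → List Pattern → Matroid n → Set
HMatroid H M = ∀ X → InX H X → Circuit M X

ProperFrom : {n : ℕ} → EdgeSet n → List (EdgeSet n) → Set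
ProperFrom acc [] = ⊤
ProperFrom acc (X ∷ Xs) = ¬ (X ⊆ acc) × ProperFrom (acc ∪ X) Xs

Proper : {n : ℕ} → List (EdgeSet n) → Set
Proper [] = ⊤
Proper (X ∷ Xs) = ProperFrom X Xs

ProperSeq : {n : ℕ} → List Pattern → List (EdgeSet n) → Set
ProperSeq H S = All (InX H) S × Proper S

⋃ : {n : ℕ} → List (EdgeSet n) → EdgeSet n
⋃ = foldr _∪_ ∅

val : {n : ℕ} → EdgeSet n → List (EdgeSet n) → ℤ
val F S = + ∣ F ∪ ⋃ S ∣ ℤ.- + length S

ValH : {n : ℕ} → List Pattern → EdgeSet n → ℕ → Set
ValH H F k =
  (∃[ S ] (ProperSeq H S × val F S ≡ + k)) ×
  (∀ S → ProperSeq H S → + k ℤ.≤ val F S)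

IsUniqueMaximalWithRankVal : {n : ℕ} → List Pattern → Matroid n → Set₁
IsUniqueMaximalWithRankVal {n} H M =
  HMatroid H M ×
  (∀ (M′ : Matroid n) → HMatroid H M′ → M′ ⪯ M) ×
  (∀ F → ∃[ r ] (Rank M F r × ValH H F r))

pat : (m : ℕ) → List (ℕ × ℕ) → Pattern
pat m es = record { k = m ; pedges = conv es }
  where
  conv : List (ℕ × ℕ) → List (Fin m × Fin m)
  conv [] = []
  conv ((x , y) ∷ r) with x ℕ.<? m | y ℕ.<? m
  ... | yes p | yes q = (F.fromℕ< p , F.fromℕ< q) ∷ conv r
  ... | _ | _ = conv r

C₄ : Pattern
C₄ = pat 4 ((0 , 1) ∷ (1 , 2) ∷ (2 , 3) ∷ (3 , 0) ∷ [])

K₅⁻ : Pattern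
K₅⁻ = pat 5 ((0 , 1) ∷ (0 , 2) ∷ (0 , 3) ∷ (0 , 4) ∷ (1 , 2) ∷ (1 , 3) ∷ (1 , 4)
           ∷ (2 , 3) ∷ (2 , 4) ∷ [])

K₃₄ : Pattern
K₃₄ = pat 7 ((0 , 3) ∷ (0 , 4) ∷ (0 , 5) ∷ (0 , 6) ∷ (1 , 3) ∷ (1 , 4) ∷ (1 , 5) ∷ (1 , 6)
           ∷ (2 , 3) ∷ (2 , 4) ∷ (2 , 5) ∷ (2 , 6) ∷ [])

GMatroidIsUniqueMaximal : ℕ → ℕ → ℤ → (n : ℕ) → List Pattern → Set₁
GMatroidIsUniqueMaximal a b c n H =
  Σ (IsMatroid (IndG a b c {n})) λ isM →
    IsUniqueMaximalWithRankVal H (record { Ind = IndG a b c ; isMatroid = isM })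

{-# OPTIONS --safe #-}
module Submission where

-- For a nondecreasing submodular f, the sets F with |I| + c ≤ f(I) for all nonempty I ⊆ F
-- are the independent sets of a matroid.  An edge that cannot be added to an independent set I
-- lies in the f-closure of a tight subset of I; tight sets that meet may be united, so a basis I
-- of F is partitioned into tight sets A whose closures cover F.  Each closure is a union of one
-- complete graph and complete bipartite graphs, and these are built vertex by vertex: a new vertex
-- brings one edge (two for g₂₁₂) that raises the rank, and every further edge closes a copy of C₄
-- (of K₅⁻ or K₃₄) whose other edges are already present.  These copies form a proper sequence
-- whose value is |I|.  Conversely, in every matroid in which the members of a proper sequence are
-- circuits, its value bounds the size of an independent subset of F.  Hence val is the rank
-- function, and the matroid lies above every other one.
--
-- Here f = ρ and f = |V| + ρ with ρ = |V| − β.  Inserting an edge uv leaves ρ unchanged exactly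
-- when there is an odd walk from u to v or odd closed walks at both ends, a condition that is
-- preserved when F grows, and otherwise raises ρ by one; so ρ is submodular.

open import Defs
open import Data.Bool using (Bool; true; false; T; _∨_; _∧_; _xor_; not; if_then_else_)
open import Data.Bool.ListAction using (any; all)
open import Data.Bool.Properties as Boolₚ using (T?; T-∨; T-∧; not-involutive; ¬-not; not-¬)
open import Data.Empty using (⊥-elim)
open import Data.Fin as Fin using (Fin)
open import Data.Fin.Properties using (_≟_; _<?_; <-irrelevant; <-cmp)
import Data.Integer as ℤ
import Data.Integer.Properties as ℤₚ
import Data.Integer.Tactic.RingSolver as ℤ-Solver
open import Data.List using (List; []; _∷_; _++_; _∷ʳ_; length; filterᵇ; concatMap; foldr; allFin; map)
open import Data.List.Membership.Propositional using (_∈_; lose; find)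
open import Data.List.Membership.Propositional.Properties
  using ( ∈-filter⁺; ∈-filter⁻; ∈-allFin; ∈-concatMap⁺; ∈-concatMap⁻; ∈-map⁺; ∈-map⁻
        ; ∈-++⁺ˡ; ∈-++⁺ʳ; ∈-++⁻ )
open import Data.List.Properties using (length-map; length-++; length-tabulate)
open import Data.List.Relation.Binary.Disjoint.Propositional using (Disjoint)
open import Data.List.Relation.Unary.All as All using (All; []; _∷_)
import Data.List.Relation.Unary.All.Properties as Allₚ
open import Data.List.Relation.Unary.AllPairs as AllPairs using (AllPairs; []; _∷_)
import Data.List.Relation.Unary.AllPairs.Properties as AllPairsₚ
open import Data.List.Relation.Unary.Any using (Any; here; there)
import Data.List.Relation.Unary.Any.Properties as Anyₚ
open import Data.List.Relation.Unary.Unique.Propositional using (Unique)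
import Data.List.Relation.Unary.Unique.Propositional.Properties as Uniqueₚ
open import Data.Maybe using (Maybe; just; nothing)
open import Data.Nat using (ℕ; zero; suc; _+_; _*_; _∸_; _≤_; _<_; _≤ᵇ_; z≤n; s≤s)
open import Data.Nat.ListAction using (sum)
open import Data.Nat.Properties hiding (_≟_; _<?_; <-irrelevant; <-cmp)
open import Data.Nat.Tactic.RingSolver using (solve-∀)
open import Data.Product using (Σ; ∃-syntax; _×_; _,_; proj₁; proj₂)
open import Data.Sum using (_⊎_; inj₁; inj₂; [_,_]′)
open import Data.Unit using (tt)
open import Data.Vec as Vec using (Vec; []; _∷_)
open import Data.Vec.Relation.Unary.All as VAll using ([]; _∷_)
open import Data.Vec.Relation.Unary.AllPairs using ([]; _∷_)
import Data.Vec.Relation.Unary.Unique.Propositional as VUnique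
import Data.Vec.Relation.Unary.Unique.Propositional.Properties as VUniqueₚ
open import Function using (_∘_; id; Equivalence)
open import Function.Definitions using (Injective)
open import Relation.Binary.Construct.Closure.ReflexiveTransitive as Star using (ε)
open import Relation.Binary.Definitions using (tri<; tri≈; tri>)
open import Relation.Binary.PropositionalEquality
  using (_≡_; _≢_; refl; sym; trans; cong; cong₂; subst; module ≡-Reasoning)
open import Relation.Nullary using (¬_; Dec; yes; no; does; contradiction)

-- A set `F` need not contain any copy of a pattern: a cycle of length 6 is a circuit of the even
-- cycle matroid and contains no `C₄`. A sequence that attains the minimum must then leave `F`, and
-- the closures of tight sets are the room in which it is built. Every edge of the final set is
-- either paid for or the last edge of its own copy, so the size of the set minus the length of the
-- sequence is at most the number of paid edges. A complete graph on d vertices may cost d (for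
-- `g 2 1 2`: 2d - 2), a complete bipartite graph on m vertices m - 1 (2m - 3): these are the values
-- of f - c on connected nonbipartite and connected bipartite graphs. The triangle, K₄ and K₃,₃,
-- from which the growth starts, have exactly that many edges. `Beta` is a relation, and
-- bipartiteness is asserted by an arbitrary colouring. Labellings with walks as evidence make β
-- computable and comparable between `F` and a larger set. That copies of the patterns are circuits
-- must hold for all n and all embeddings; it is reduced to a Boolean computation on the pattern
-- alone.

∨⁺ : ∀ {a b} → T a ⊎ T b → T (a ∨ b)
∨⁺ = Equivalence.from T-∨

∨⁻ : ∀ {a b} → T (a ∨ b) → T a ⊎ T b
∨⁻ = Equivalence.to T-∨

∧⁺ : ∀ {a b} → T a → T b → T (a ∧ b)
∧⁺ p q = Equivalence.from T-∧ (p , q)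

∧⁻ : ∀ {a b} → T (a ∧ b) → T a × T b
∧⁻ = Equivalence.to T-∧

not⁺ : ∀ {a} → ¬ T a → T (not a)
not⁺ {true}  ¬a = ¬a tt
not⁺ {false} _  = tt

not⁻ : ∀ {a} → T (not a) → ¬ T a
not⁻ {true} ()
not⁻ {false} _ ()

does⁺ : ∀ {P : Set} (d : Dec P) → P → T (does d)
does⁺ (yes _) _ = tt
does⁺ (no ¬p) p = ¬p p

does⁻ : ∀ {P : Set} (d : Dec P) → T (does d) → P
does⁻ (yes p) _ = p

-- Counting

count : {A : Set} → (A → Bool) → List A → ℕ
count p xs = length (filterᵇ p xs)

𝟙 : Bool → ℕ
𝟙 true  = 1
𝟙 false = 0

module _ {A : Set} where

  count-∷ : ∀ (p : A → Bool) x xs → count p (x ∷ xs) ≡ 𝟙 (p x) + count p xs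
  count-∷ p x xs with p x
  ... | true  = refl
  ... | false = refl

  -- The form with two terms on each side yields monotonicity, by padding with the empty predicate,
  -- and inclusion-exclusion, by using it in both directions.
  count-mono₂ : ∀ {p q r s : A → Bool} →
                (∀ x → 𝟙 (p x) + 𝟙 (q x) ≤ 𝟙 (r x) + 𝟙 (s x)) →
                ∀ xs → count p xs + count q xs ≤ count r xs + count s xs
  count-mono₂ h [] = z≤n
  count-mono₂ {p} {q} {r} {s} h (x ∷ xs) = begin
    count p (x ∷ xs) + count q (x ∷ xs)
      ≡⟨ cong₂ _+_ (count-∷ p x xs) (count-∷ q x xs) ⟩
    (𝟙 (p x) + count p xs) + (𝟙 (q x) + count q xs)
      ≡⟨ interchange (𝟙 (p x)) (count p xs) (𝟙 (q x)) (count q xs) ⟩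
    (𝟙 (p x) + 𝟙 (q x)) + (count p xs + count q xs)
      ≤⟨ +-mono-≤ (h x) (count-mono₂ h xs) ⟩
    (𝟙 (r x) + 𝟙 (s x)) + (count r xs + count s xs)
      ≡⟨ interchange (𝟙 (r x)) (count r xs) (𝟙 (s x)) (count s xs) ⟨
    (𝟙 (r x) + count r xs) + (𝟙 (s x) + count s xs)
      ≡⟨ cong₂ _+_ (count-∷ r x xs) (count-∷ s x xs) ⟨
    count r (x ∷ xs) + count s (x ∷ xs) ∎
    where
    open ≤-Reasoning
    interchange : ∀ a b c d → (a + b) + (c + d) ≡ (a + c) + (b + d)
    interchange a b c d = begin-equality
      (a + b) + (c + d) ≡⟨ +-assoc a b (c + d) ⟩
      a + (b + (c + d)) ≡⟨ cong (a +_) (sym (+-assoc b c d)) ⟩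
      a + (b + c + d)   ≡⟨ cong (λ t → a + (t + d)) (+-comm b c) ⟩
      a + (c + b + d)   ≡⟨ cong (a +_) (+-assoc c b d) ⟩
      a + (c + (b + d)) ≡⟨ sym (+-assoc a c (b + d)) ⟩
      (a + c) + (b + d) ∎

  count-∅ : ∀ xs → count (λ (_ : A) → false) xs ≡ 0
  count-∅ []       = refl
  count-∅ (x ∷ xs) = count-∅ xs

  count-mono : ∀ {p q : A → Bool} → (∀ x → T (p x) → T (q x)) →
               ∀ xs → count p xs ≤ count q xs
  count-mono {p} {q} h xs = subst₂≤ (count-mono₂ {p} {λ _ → false} {q} {λ _ → false} h′ xs)
    where
    h′ : ∀ x → 𝟙 (p x) + 0 ≤ 𝟙 (q x) + 0
    h′ x with p x | q x | h x
    ... | true  | true  | _  = ≤-refl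
    ... | true  | false | hx = ⊥-elim (hx tt)
    ... | false | _     | _  = z≤n
    subst₂≤ : count p xs + count (λ _ → false) xs ≤ count q xs + count (λ _ → false) xs →
              count p xs ≤ count q xs
    subst₂≤ = +-cancelʳ-≤ _ _ _

  count-∨∧ : ∀ (p q : A → Bool) xs →
             count (λ x → p x ∨ q x) xs + count (λ x → p x ∧ q x) xs ≡ count p xs + count q xs
  count-∨∧ p q xs = ≤-antisym
    (count-mono₂ (λ x → ≤-reflexive (bool (p x) (q x))) xs)
    (count-mono₂ (λ x → ≤-reflexive (sym (bool (p x) (q x)))) xs)
    where
    bool : ∀ a b → 𝟙 (a ∨ b) + 𝟙 (a ∧ b) ≡ 𝟙 a + 𝟙 b
    bool true  true  = refl
    bool true  false = refl
    bool false true  = refl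
    bool false false = refl

  count-∨-≤ : ∀ (p q : A → Bool) xs → count (λ x → p x ∨ q x) xs ≤ count p xs + count q xs
  count-∨-≤ p q xs = ≤-trans (m≤m+n _ _) (≤-reflexive (count-∨∧ p q xs))

  count-none : ∀ {p : A → Bool} → (∀ x → ¬ T (p x)) → ∀ xs → count p xs ≡ 0
  count-none h xs = n≤0⇒n≡0
    (≤-trans (count-mono (λ x px → ⊥-elim (h x px)) xs) (≤-reflexive (count-∅ xs)))

  count-disjoint : ∀ (p q : A → Bool) → (∀ x → T (p x) → ¬ T (q x)) → ∀ xs →
                   count p xs + count q xs ≡ count (λ x → p x ∨ q x) xs
  count-disjoint p q h xs = begin
    count p xs + count q xs
      ≡⟨ count-∨∧ p q xs ⟨
    count (λ x → p x ∨ q x) xs + count (λ x → p x ∧ q x) xs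
      ≡⟨ cong (count (λ x → p x ∨ q x) xs +_)
              (count-none (λ x pq → h x (proj₁ (∧⁻ pq)) (proj₂ (∧⁻ pq))) xs) ⟩
    count (λ x → p x ∨ q x) xs + 0
      ≡⟨ +-identityʳ _ ⟩
    count (λ x → p x ∨ q x) xs ∎
    where open ≡-Reasoning

  count-complement : ∀ (p : A → Bool) xs → count p xs + count (not ∘ p) xs ≡ length xs
  count-complement p []       = refl
  count-complement p (x ∷ xs) with p x
  ... | true  = cong suc (count-complement p xs)
  ... | false = trans (+-suc _ _) (cong suc (count-complement p xs))

  ∈-filterᵇ⁺ : ∀ (p : A → Bool) {x xs} → x ∈ xs → T (p x) → x ∈ filterᵇ p xs
  ∈-filterᵇ⁺ p = ∈-filter⁺ (T? ∘ p)

  ∈-filterᵇ⁻ : ∀ (p : A → Bool) xs {x} → x ∈ filterᵇ p xs → x ∈ xs × T (p x)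
  ∈-filterᵇ⁻ p xs = ∈-filter⁻ (T? ∘ p) {xs = xs}

  filterᵇ-unique : ∀ (p : A → Bool) {xs} → Unique xs → Unique (filterᵇ p xs)
  filterᵇ-unique p = Uniqueₚ.filter⁺ (T? ∘ p)

  -- Deletes the position at which the membership proof points, so `A` needs no decidable equality.
  remove : ∀ {x : A} {ys} → x ∈ ys → List A
  remove {ys = y ∷ ys} (here _)  = ys
  remove {ys = y ∷ ys} (there i) = y ∷ remove i

  length-remove : ∀ {x : A} {ys} (i : x ∈ ys) → length ys ≡ suc (length (remove i))
  length-remove (here _)  = refl
  length-remove (there i) = cong suc (length-remove i)

  ∈-remove : ∀ {x z : A} {ys} (i : x ∈ ys) → z ∈ ys → z ≢ x → z ∈ remove i
  ∈-remove (here refl) (here refl) z≢x = contradiction refl z≢x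
  ∈-remove (here _)    (there j)   _   = j
  ∈-remove (there _)   (here eq)   _   = here eq
  ∈-remove (there i)   (there j)   z≢x = there (∈-remove i j z≢x)

  ∈⇒positive : ∀ {x : A} {xs} → x ∈ xs → 1 ≤ length xs
  ∈⇒positive (here _)  = s≤s z≤n
  ∈⇒positive (there _) = s≤s z≤n

  -- The pigeonhole principle: each element of `xs` uses up a position of `ys` that no later element
  -- can need.
  unique-length-≤ : ∀ {xs ys : List A} → Unique xs → (∀ {x} → x ∈ xs → x ∈ ys) →
                    length xs ≤ length ys
  unique-length-≤ {[]} _ _ = z≤n
  unique-length-≤ {x ∷ xs} (x∉ ∷ u) h = subst (suc (length xs) ≤_)
    (sym (length-remove (h (here refl))))
    (s≤s (unique-length-≤ u λ z∈ →
      ∈-remove (h (here refl)) (h (there z∈)) (λ z≡x → All.lookup x∉ z∈ (sym z≡x))))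

  count-strict : ∀ {p q : A → Bool} {x xs} → (∀ y → T (p y) → T (q y)) →
                 x ∈ xs → T (q x) → ¬ T (p x) → count p xs < count q xs
  count-strict {p} {q} {x} {y ∷ ys} h (here refl) qx ¬px
    rewrite count-∷ p y ys | count-∷ q y ys with p y | q y
  ... | true  | _    = ⊥-elim (¬px tt)
  ... | false | true = s≤s (count-mono h ys)
  count-strict {p} {q} {x} {y ∷ ys} h (there i) qx ¬px
    rewrite count-∷ p y ys | count-∷ q y ys with p y | q y | h y
  ... | true  | true  | _  = s≤s (count-strict {p} {q} h i qx ¬px)
  ... | true  | false | hy = ⊥-elim (hy tt)
  ... | false | true  | _  = m≤n⇒m≤1+n (count-strict {p} {q} h i qx ¬px)
  ... | false | false | _  = count-strict {p} {q} h i qx ¬px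

  any-intro : ∀ (p : A → Bool) {x xs} → x ∈ xs → T (p x) → T (any p xs)
  any-intro p x∈ px = Anyₚ.any⁺ p (lose x∈ px)

  any-elim : ∀ (p : A → Bool) xs → T (any p xs) → ∃[ x ] (x ∈ xs × T (p x))
  any-elim p xs h = find (Anyₚ.any⁻ p xs h)

  -- `P` and `Q` need not be complementary; `Q` is whatever the failure of `P` provides, such as a
  -- tight set that spans the element.
  search : ∀ {P Q : A → Set} → (∀ x → P x ⊎ Q x) → ∀ xs → Any P xs ⊎ All Q xs
  search d [] = inj₂ []
  search d (x ∷ xs) with d x | search d xs
  ... | inj₁ px | _       = inj₁ (here px)
  ... | inj₂ _  | inj₁ ps = inj₁ (there ps)
  ... | inj₂ qx | inj₂ qs = inj₂ (qx ∷ qs)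

-- Edges

mkEdgeList : ∀ {n} (f : Fin n → Fin n → List (Edge n)) →
             concatMap (λ i → concatMap (λ j → f i j) (allFin n)) (allFin n) ≡ allEdges n →
             Fin n → Fin n → List (Edge n)
mkEdgeList f _ = f

module _ {n : ℕ} where

  -- The summand local to the definition of allEdges, recovered by unification.
  edgeList : Fin n → Fin n → List (Edge n)
  edgeList = mkEdgeList _ refl

  edge-≡ : ∀ {e f : Edge n} → proj₁ e ≡ proj₁ f → e ≡ f
  edge-≡ {_ , p} {_ , q} refl = cong (_ ,_) (<-irrelevant p q)

  ∈-edgeList⁺ : ∀ (e : Edge n) → e ∈ edgeList (proj₁ (proj₁ e)) (proj₂ (proj₁ e))
  ∈-edgeList⁺ ((i , j) , p) with i <? j
  ... | yes _  = here (edge-≡ refl)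
  ... | no ¬p = contradiction p ¬p

  ∈-edgeList⁻ : ∀ i j {e : Edge n} → e ∈ edgeList i j → proj₁ e ≡ (i , j)
  ∈-edgeList⁻ i j e∈ with i <? j
  ∈-edgeList⁻ i j (here refl) | yes _ = refl

  edgeList-unique : ∀ i j → Unique (edgeList i j)
  edgeList-unique i j with i <? j
  ... | yes _ = [] ∷ []
  ... | no _  = []

  ∈-allEdges : ∀ (e : Edge n) → e ∈ allEdges n
  ∈-allEdges e@((i , j) , _) = ∈-concatMap⁺ (λ i → concatMap (edgeList i) (allFin n))
    (lose (∈-allFin i) (∈-concatMap⁺ (edgeList i) (lose (∈-allFin j) (∈-edgeList⁺ e))))

  allEdges-unique : Unique (allEdges n)
  allEdges-unique = Uniqueₚ.concat⁺
    (Allₚ.map⁺ (All.universal row-unique (allFin n)))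
    (AllPairsₚ.map⁺ {f = row} (AllPairs.map (λ {i} {i′} → row-disjoint i i′) (Uniqueₚ.allFin⁺ n)))
    where
    row : Fin n → List (Edge n)
    row i = concatMap (edgeList i) (allFin n)
    row-fst : ∀ i {e} → e ∈ row i → proj₁ (proj₁ e) ≡ i
    row-fst i e∈ with find (∈-concatMap⁻ (edgeList i) {xs = allFin n} e∈)
    ... | j , _ , p = cong proj₁ (∈-edgeList⁻ i j p)
    row-disjoint : ∀ i i′ → i ≢ i′ → Disjoint (row i) (row i′)
    row-disjoint i i′ i≢i′ (p , q) = i≢i′ (trans (sym (row-fst i p)) (row-fst i′ q))
    edgeList-disjoint : ∀ i j j′ → j ≢ j′ → Disjoint (edgeList i j) (edgeList i j′)
    edgeList-disjoint i j j′ j≢j′ (p , q) =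
      j≢j′ (cong proj₂ (trans (sym (∈-edgeList⁻ i j p)) (∈-edgeList⁻ i j′ q)))
    row-unique : ∀ i → Unique (row i)
    row-unique i = Uniqueₚ.concat⁺
      (Allₚ.map⁺ (All.universal (edgeList-unique i) (allFin n)))
      (AllPairsₚ.map⁺ {f = edgeList i}
        (AllPairs.map (λ {j} {j′} → edgeList-disjoint i j j′) (Uniqueₚ.allFin⁺ n)))

  joins⁻ : ∀ (e : Edge n) {u v} → T (joins e u v) → proj₁ e ≡ (u , v) ⊎ proj₁ e ≡ (v , u)
  joins⁻ ((i , j) , _) {u} {v} h with ∨⁻ {does (i ≟ u) ∧ does (j ≟ v)} h
  ... | inj₁ p = inj₁ (cong₂ _,_ (does⁻ (i ≟ u) (proj₁ (∧⁻ {does (i ≟ u)} p)))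
                                 (does⁻ (j ≟ v) (proj₂ (∧⁻ {does (i ≟ u)} p))))
  ... | inj₂ p = inj₂ (cong₂ _,_ (does⁻ (i ≟ v) (proj₁ (∧⁻ {does (i ≟ v)} p)))
                                 (does⁻ (j ≟ u) (proj₂ (∧⁻ {does (i ≟ v)} p))))

  joins⁺ : ∀ (e : Edge n) → T (joins e (proj₁ (proj₁ e)) (proj₂ (proj₁ e)))
  joins⁺ ((i , j) , _) = ∨⁺ {does (i ≟ i) ∧ does (j ≟ j)}
    (inj₁ (∧⁺ (does⁺ (i ≟ i) refl) (does⁺ (j ≟ j) refl)))

  joins-sym : ∀ (e : Edge n) {u v} → T (joins e u v) → T (joins e v u)
  joins-sym ((i , j) , _) {u} {v} h with ∨⁻ {does (i ≟ u) ∧ does (j ≟ v)} h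
  ... | inj₁ p = ∨⁺ {does (i ≟ v) ∧ does (j ≟ u)} (inj₂ p)
  ... | inj₂ p = ∨⁺ {does (i ≟ v) ∧ does (j ≟ u)} (inj₁ p)

  joins-irrefl : ∀ (e : Edge n) {u} → ¬ T (joins e u u)
  joins-irrefl e@((i , j) , p) h with joins⁻ e h
  ... | inj₁ refl = <-irrefl refl p
  ... | inj₂ refl = <-irrefl refl p

  joins-unique : ∀ (e f : Edge n) {u v} → T (joins e u v) → T (joins f u v) → e ≡ f
  joins-unique e@(_ , p) f@(_ , q) h h′ with joins⁻ e h | joins⁻ f h′
  ... | inj₁ refl | inj₁ refl = edge-≡ refl
  ... | inj₁ refl | inj₂ refl = contradiction q (<-asym p)
  ... | inj₂ refl | inj₁ refl = contradiction q (<-asym p)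
  ... | inj₂ refl | inj₂ refl = edge-≡ refl

  joining : ∀ {u v : Fin n} → u ≢ v → ∃[ e ] T (joins e u v)
  joining {u} {v} u≢v with <-cmp u v
  ... | tri< p _ _ = ((u , v) , p) , joins⁺ ((u , v) , p)
  ... | tri≈ _ p _ = contradiction p u≢v
  ... | tri> _ _ p = ((v , u) , p) , joins-sym ((v , u) , p) (joins⁺ ((v , u) , p))

  sameEdge⁻ : ∀ (x e : Edge n) → T (sameEdge x e) → x ≡ e
  sameEdge⁻ x e h = joins-unique x e (joins⁺ x) h

  sameEdge-refl : ∀ (x : Edge n) → T (sameEdge x x)
  sameEdge-refl = joins⁺

  infixl 7 _∩_ _∖_

  _∩_ _∖_ : EdgeSet n → EdgeSet n → EdgeSet n
  (A ∩ B) e = A e ∧ B e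
  (A ∖ B) e = A e ∧ not (B e)

  -- The edge uv as a set; empty when u ≡ v.
  ⟦_,_⟧ : Fin n → Fin n → EdgeSet n
  ⟦ u , v ⟧ e = joins e u v

  ⊆-refl : {A : EdgeSet n} → A ⊆ A
  ⊆-refl _ h = h

  ⊆-trans : {A B C : EdgeSet n} → A ⊆ B → B ⊆ C → A ⊆ C
  ⊆-trans p q e h = q e (p e h)

  ∪-left : (A B : EdgeSet n) → A ⊆ (A ∪ B)
  ∪-left A B e h = ∨⁺ {A e} (inj₁ h)

  ∪-right : (A B : EdgeSet n) → B ⊆ (A ∪ B)
  ∪-right A B e h = ∨⁺ {A e} (inj₂ h)

  ∪-least : {A B C : EdgeSet n} → A ⊆ C → B ⊆ C → (A ∪ B) ⊆ C
  ∪-least {A} p q e h = [ p e , q e ]′ (∨⁻ {A e} h)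

  ∩-left : (A B : EdgeSet n) → (A ∩ B) ⊆ A
  ∩-left A B e h = proj₁ (∧⁻ {A e} h)

  ∩-right : (A B : EdgeSet n) → (A ∩ B) ⊆ B
  ∩-right A B e h = proj₂ (∧⁻ {A e} h)

  insert⁻ : ∀ x (A : EdgeSet n) e → T (insert x A e) → x ≡ e ⊎ T (A e)
  insert⁻ x A e h with ∨⁻ {sameEdge x e} h
  ... | inj₁ p = inj₁ (sameEdge⁻ x e p)
  ... | inj₂ p = inj₂ p

  insert-self : ∀ x (A : EdgeSet n) → T (insert x A x)
  insert-self x A = ∨⁺ {sameEdge x x} (inj₁ (sameEdge-refl x))

  insert-⊇ : ∀ x (A : EdgeSet n) → A ⊆ insert x A
  insert-⊇ x A e h = ∨⁺ {sameEdge x e} (inj₂ h)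

  insert-least : ∀ {x} {A B : EdgeSet n} → T (B x) → A ⊆ B → insert x A ⊆ B
  insert-least {x} {A} Bx A⊆B e h with insert⁻ x A e h
  ... | inj₁ refl = Bx
  ... | inj₂ Ae   = A⊆B e Ae

  insert-mono : ∀ x {A B : EdgeSet n} → A ⊆ B → insert x A ⊆ insert x B
  insert-mono x {A} {B} A⊆B = insert-least (insert-self x B) (⊆-trans A⊆B (insert-⊇ x B))

  ∣∣-mono : {A B : EdgeSet n} → A ⊆ B → ∣ A ∣ ≤ ∣ B ∣
  ∣∣-mono A⊆B = count-mono A⊆B (allEdges n)

  ∣∣-strict : {A B : EdgeSet n} → A ⊆ B → ∀ e → T (B e) → ¬ T (A e) → ∣ A ∣ < ∣ B ∣
  ∣∣-strict {A} {B} A⊆B e = count-strict {p = A} {B} A⊆B (∈-allEdges e)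

  ∣∪∣+∣∩∣ : (A B : EdgeSet n) → ∣ A ∪ B ∣ + ∣ A ∩ B ∣ ≡ ∣ A ∣ + ∣ B ∣
  ∣∪∣+∣∩∣ A B = count-∨∧ A B (allEdges n)

  ∣∪∣-≤ : (A B : EdgeSet n) → ∣ A ∪ B ∣ ≤ ∣ A ∣ + ∣ B ∣
  ∣∪∣-≤ A B = count-∨-≤ A B (allEdges n)

  ∣∣-list : {A : EdgeSet n} (es : List (Edge n)) → (∀ e → T (A e) → e ∈ es) → ∣ A ∣ ≤ length es
  ∣∣-list {A} es h = unique-length-≤ (filterᵇ-unique A allEdges-unique)
    (λ {e} e∈ → h e (proj₂ (∈-filterᵇ⁻ A (allEdges n) e∈)))

  ⊆-or-witness : (A B : EdgeSet n) → (∃[ e ] (T (A e) × ¬ T (B e))) ⊎ A ⊆ B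
  ⊆-or-witness A B with search dec (allEdges n)
    where
    dec : ∀ e → (T (A e) × ¬ T (B e)) ⊎ (T (A e) → T (B e))
    dec e with T? (A e) | T? (B e)
    ... | yes p | no q  = inj₁ (p , q)
    ... | yes p | yes q = inj₂ (λ _ → q)
    ... | no p  | _     = inj₂ (λ q → contradiction q p)
  ... | inj₁ some with find some
  ...   | e , _ , w = inj₁ (e , w)
  ⊆-or-witness A B | inj₂ sub = inj₂ (λ e → All.lookup sub (∈-allEdges e))

  nonempty-or-empty : (A : EdgeSet n) → Nonempty A ⊎ (∀ e → ¬ T (A e))
  nonempty-or-empty A with ⊆-or-witness A ∅
  ... | inj₁ (e , Ae , _) = inj₁ (e , Ae)
  ... | inj₂ A⊆∅          = inj₂ A⊆∅

  ∣∣≤1 : {A : EdgeSet n} → (∀ e f → T (A e) → T (A f) → e ≡ f) → ∣ A ∣ ≤ 1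
  ∣∣≤1 {A} h with nonempty-or-empty A
  ... | inj₁ (f , Af) = ∣∣-list {A} (f ∷ []) (λ e Ae → here (h e f Ae Af))
  ... | inj₂ none     = ≤-trans (≤-reflexive (count-none none (allEdges n))) z≤n

  ∣⟦⟧∣≤1 : ∀ u v → ∣ ⟦ u , v ⟧ ∣ ≤ 1
  ∣⟦⟧∣≤1 u v = ∣∣≤1 {⟦ u , v ⟧} (λ e f → joins-unique e f)

  ∣insert∣-≤ : ∀ x (A : EdgeSet n) → ∣ insert x A ∣ ≤ suc ∣ A ∣
  ∣insert∣-≤ x A = ≤-trans (∣∪∣-≤ (sameEdge x) A) (+-monoˡ-≤ ∣ A ∣
    (∣∣≤1 {sameEdge x} (λ e f p q → trans (sym (sameEdge⁻ x e p)) (sameEdge⁻ x f q))))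

  ∣∣-positive : {A : EdgeSet n} → Nonempty A → 1 ≤ ∣ A ∣
  ∣∣-positive {A} (e , Ae) =
    ≤-trans (s≤s z≤n) (∣∣-strict {∅} {A} (λ _ ()) e Ae (λ ()))

  ∣∅∣ : ∣ ∅ {n} ∣ ≡ 0
  ∣∅∣ = count-∅ (allEdges n)

  inV⁺ : ∀ (F : EdgeSet n) e {u v} → T (F e) → T (joins e u v) → T (inV F u)
  inV⁺ F e@((i , j) , _) {u} {v} Fe h =
    any-intro _ (∈-allEdges e) (∧⁺ {F e} Fe (∨⁺ {does (i ≟ u)} endpoint))
    where
    endpoint : T (does (i ≟ u)) ⊎ T (does (j ≟ u))
    endpoint with joins⁻ e h
    ... | inj₁ refl = inj₁ (does⁺ (i ≟ i) refl)
    ... | inj₂ refl = inj₂ (does⁺ (j ≟ j) refl)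

  inV⁻ : ∀ (F : EdgeSet n) {u} → T (inV F u) → ∃[ v ] Adj F u v
  inV⁻ F {u} h with any-elim _ (allEdges n) h
  ... | e@((i , j) , p) , _ , q with ∧⁻ {F e} q
  ...   | Fe , inc with ∨⁻ {does (i ≟ u)} inc
  ...     | inj₁ i≡u = j , e , Fe , subst (λ x → T (joins e x j)) (does⁻ (i ≟ u) i≡u) (joins⁺ e)
  ...     | inj₂ j≡u = i , e , Fe ,
            subst (λ x → T (joins e x i)) (does⁻ (j ≟ u) j≡u) (joins-sym e (joins⁺ e))

  inV-mono : {F G : EdgeSet n} → F ⊆ G → ∀ v → T (inV F v) → T (inV G v)
  inV-mono {F} {G} F⊆G v h with inV⁻ F {v} h
  ... | w , e , Fe , j = inV⁺ G e (F⊆G e Fe) j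

  Adj-sym : ∀ {F : EdgeSet n} {u v} → Adj F u v → Adj F v u
  Adj-sym (e , Fe , h) = e , Fe , joins-sym e h

  Adj-mono : ∀ {F G : EdgeSet n} → F ⊆ G → ∀ {u v} → Adj F u v → Adj G u v
  Adj-mono F⊆G (e , Fe , h) = e , F⊆G e Fe , h

-- Signed labellings: a bipartite component is represented by one of its
-- vertices, every vertex of it carrying the parity of its distance to that
-- vertex; the vertices of non-bipartite components are dead.

data Label (n : ℕ) : Set where
  dead : Label n
  live : Fin n → Bool → Label n

live-injective : ∀ {n} {l m : Fin n} {s t} → live l s ≡ live m t → l ≡ m × s ≡ t
live-injective refl = refl , refl

module _ {n : ℕ} where

  neg : Label n → Label n
  neg dead       = dead
  neg (live l s) = live l (not s)

  turn : Bool → Label n → Label n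
  turn false x = x
  turn true  x = neg x

  neg-involutive : ∀ x → neg (neg x) ≡ x
  neg-involutive dead       = refl
  neg-involutive (live l s) = cong (live l) (not-involutive s)

  turn-not : ∀ s x → turn (not s) x ≡ neg (turn s x)
  turn-not false x = refl
  turn-not true  x = sym (neg-involutive x)

  turn-dead : ∀ s → turn s dead ≡ dead
  turn-dead false = refl
  turn-dead true  = refl

  turn-live : ∀ s l t → turn s (live l t) ≡ live l (s xor t)
  turn-live false l t = refl
  turn-live true  l t = refl

  -- A live label changes its sign under `neg`. This is how an odd closed walk forces the label of
  -- its base vertex to be `dead`.
  self-opposite : ∀ x → x ≡ neg x → x ≡ dead
  self-opposite dead            _  = refl
  self-opposite (live l true)  ()
  self-opposite (live l false) ()

  isRoot : Label n → Fin n → Bool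
  isRoot (live l false) v = does (l ≟ v)
  isRoot _              v = false

  isRoot⁻ : ∀ x v → T (isRoot x v) → x ≡ live v false
  isRoot⁻ (live l false) v h = cong (λ m → live m false) (does⁻ (l ≟ v) h)

  isRoot⁺ : ∀ v → T (isRoot (live v false) v)
  isRoot⁺ v = does⁺ (v ≟ v) refl

  -- The value at `dead` is a filler; the function serves vertices whose label is known to be live.
  rootOf : Label n → Fin n → Fin n
  rootOf dead       v = v
  rootOf (live l _) v = l

  -- The Boolean index is the parity of the length, `true` for odd walks.
  data Walk (F : EdgeSet n) : Bool → Fin n → Fin n → Set where
    stay : ∀ {u} → Walk F false u u
    _◅_  : ∀ {p u v w} → Adj F u v → Walk F p v w → Walk F (not p) u w

  infixr 5 _◅_ _⊙_

  walk-mono : ∀ {F G} → F ⊆ G → ∀ {p u v} → Walk F p u v → Walk G p u v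
  walk-mono F⊆G stay    = stay
  walk-mono F⊆G (a ◅ w) = Adj-mono F⊆G a ◅ walk-mono F⊆G w

  _⊙_ : ∀ {F p q u v w} → Walk F p u v → Walk F q v w → Walk F (p xor q) u w
  stay ⊙ w′ = w′
  _⊙_ {F} {q = q} {u} {w = w} (_◅_ {false} a w₁) w′ = a ◅ (w₁ ⊙ w′)
  _⊙_ {F} {q = q} {u} {w = w} (_◅_ {true} a w₁) w′ =
    subst (λ b → Walk F b u w) (not-involutive q) (a ◅ (w₁ ⊙ w′))

  edge : ∀ {F u v} → Adj F u v → Walk F true u v
  edge a = a ◅ stay

  reverse : ∀ {F p u v} → Walk F p u v → Walk F p v u
  reverse stay = stay
  reverse {F} {u = u} {v} (_◅_ {p} a w) =
    subst (λ b → Walk F b v u) (xor-true p) (reverse w ⊙ edge (Adj-sym a))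
    where
    xor-true : ∀ b → b xor true ≡ not b
    xor-true false = refl
    xor-true true  = refl

  -- Evidence in both directions: `opposite` propagates labels along walks, while `reach` and `odd`
  -- give back walks that explain a label. So a labelling is determined by `F` up to the choice of
  -- the roots, and two labellings can be compared through walks.
  record Labelling (F : EdgeSet n) : Set where
    field
      σ        : Fin n → Label n
      opposite : ∀ {u v} → Adj F u v → σ u ≡ neg (σ v)
      reach    : ∀ {v l s} → σ v ≡ live l s → Walk F s v l
      root     : ∀ {v l s} → σ v ≡ live l s → σ l ≡ live l false
      odd      : ∀ {v} → σ v ≡ dead → Walk F true v v

    along : ∀ {p u v} → Walk F p u v → σ u ≡ turn p (σ v)
    along stay = refl
    along {v = v} (_◅_ {p} a w) =
      trans (opposite a) (trans (cong neg (along w)) (sym (turn-not p (σ v))))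

    isRootᵛ : Fin n → Bool
    isRootᵛ v = isRoot (σ v) v

    nonroots : ℕ
    nonroots = count (not ∘ isRootᵛ) (allFin n)

  open Labelling

  relabel : ∀ {F G} → F ⊆ G → G ⊆ F → Labelling F → Labelling G
  relabel F⊆G G⊆F L = record
    { σ        = σ L
    ; opposite = λ a → opposite L (Adj-mono G⊆F a)
    ; reach    = λ eq → walk-mono F⊆G (reach L eq)
    ; root     = root L
    ; odd      = λ eq → walk-mono F⊆G (odd L eq)
    }

  -- The relation in `F` is witnessed by odd closed walks at both ends, or by walks of opposite
  -- parity to a common root. They are also walks of `G`, where they force the labels of `M`.
  opposite-mono : ∀ {F G} → F ⊆ G → (L : Labelling F) (M : Labelling G) → ∀ {u v} →
                  σ L u ≡ neg (σ L v) → σ M u ≡ neg (σ M v)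
  opposite-mono F⊆G L M {u} {v} eq with σ L v in eqv
  ... | dead = trans (dies eq) (cong neg (sym (dies eqv)))
    where
    dies : ∀ {w} → σ L w ≡ dead → σ M w ≡ dead
    dies d = self-opposite _ (along M (walk-mono F⊆G (odd L d)))
  ... | live l s = trans (along M (walk-mono F⊆G (reach L eq)))
    (trans (turn-not s (σ M l)) (cong neg (sym (along M (walk-mono F⊆G (reach L eqv))))))

  map-unique : ∀ {A B : Set} (h : A → B) {xs} →
               (∀ {x y} → x ∈ xs → y ∈ xs → h x ≡ h y → x ≡ y) → Unique xs → Unique (map h xs)
  map-unique h inj [] = []
  map-unique h inj (x∉ ∷ u) =
    Allₚ.map⁺ (All.tabulate (λ y∈ eq → All.lookup x∉ y∈ (inj (here refl) (there y∈) eq)))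
    ∷ map-unique h (λ p q → inj (there p) (there q)) u

  -- Sending a root of M to its root in L is injective, because walks of F are walks of G.
  nonroots-mono : ∀ {F G} → F ⊆ G → (L : Labelling F) (M : Labelling G) → nonroots L ≤ nonroots M
  nonroots-mono {F} {G} F⊆G L M = +-cancelˡ-≤ (roots L) _ _ (begin
    roots L + nonroots L ≡⟨ count-complement (isRootᵛ L) (allFin n) ⟩
    length (allFin n)    ≡⟨ count-complement (isRootᵛ M) (allFin n) ⟨
    roots M + nonroots M ≤⟨ +-monoˡ-≤ (nonroots M) roots-≤ ⟩
    roots L + nonroots M ∎)
    where
    open ≤-Reasoning
    roots : ∀ {F} → Labelling F → ℕ
    roots L = count (isRootᵛ L) (allFin n)
    rootsM = filterᵇ (isRootᵛ M) (allFin n)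
    h : Fin n → Fin n
    h v = rootOf (σ L v) v
    rootM : ∀ {v} → v ∈ rootsM → σ M v ≡ live v false
    rootM {v} v∈ = isRoot⁻ (σ M v) v (proj₂ (∈-filterᵇ⁻ (isRootᵛ M) (allFin n) v∈))
    liveL : ∀ {v} → v ∈ rootsM → ∃[ s ] σ L v ≡ live (h v) s
    liveL {v} v∈ with σ L v in eq
    ... | live l s = s , refl
    ... | dead with trans (sym (rootM v∈)) (self-opposite _ (along M (walk-mono F⊆G (odd L eq))))
    ...   | ()
    h-inj : ∀ {u v} → u ∈ rootsM → v ∈ rootsM → h u ≡ h v → u ≡ v
    h-inj {u} {v} u∈ v∈ eq with liveL u∈ | liveL v∈
    ... | s , σu | t , σv =
      proj₁ (live-injective (trans (sym (rootM u∈)) (trans (along M (walk-mono F⊆G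
        (reach L σu ⊙ reverse (reach L (subst (λ l → σ L v ≡ live l t) (sym eq) σv)))))
        (trans (cong (turn (s xor t)) (rootM v∈)) (turn-live (s xor t) v false)))))
    h-root : ∀ {v} → v ∈ rootsM → h v ∈ filterᵇ (isRootᵛ L) (allFin n)
    h-root {v} v∈ = ∈-filterᵇ⁺ (isRootᵛ L) (∈-allFin (h v))
      (subst (λ x → T (isRoot x (h v))) (sym (root L (proj₂ (liveL v∈)))) (isRoot⁺ (h v)))
    roots-≤ : roots M ≤ roots L
    roots-≤ = ≤-trans (≤-reflexive (sym (length-map h rootsM)))
      (unique-length-≤ (map-unique h h-inj (filterᵇ-unique (isRootᵛ M) (Uniqueₚ.allFin⁺ n)))
        (λ x∈ → let v , v∈ , eq = ∈-map⁻ h x∈ in subst (_∈ _) (sym eq) (h-root v∈)))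

  -- The root `l` is treated as a signed variable for which `t` is substituted; this updates its
  -- whole component at once.
  replace : Fin n → Label n → Label n → Label n
  replace l t dead = dead
  replace l t (live m s) with m ≟ l
  ... | yes _ = turn s t
  ... | no _  = live m s

  replace-neg : ∀ l t x → replace l t (neg x) ≡ neg (replace l t x)
  replace-neg l t dead = refl
  replace-neg l t (live m s) with m ≟ l
  ... | yes _ = turn-not s t
  ... | no _  = refl

  replace-self : ∀ l t s → replace l t (live l s) ≡ turn s t
  replace-self l t s with l ≟ l
  ... | yes _ = refl
  ... | no l≢l = contradiction refl l≢l

  replace-other : ∀ {l m} t s → m ≢ l → replace l t (live m s) ≡ live m s
  replace-other {l} {m} t s m≢l with m ≟ l
  ... | yes eq = contradiction eq m≢l
  ... | no _   = refl

  -- The two fates of a root `l` when an edge is inserted: its component becomes nonbipartite, or it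
  -- is absorbed by the component of another root `m`. The stored walk is what restores `odd` and
  -- `reach` for the vertices that are relabelled.
  data Target (G : EdgeSet n) (τ : Fin n → Label n) (l : Fin n) : Label n → Set where
    kill  : Walk G true l l → Target G τ l dead
    graft : ∀ {m q} → m ≢ l → τ m ≡ live m false → Walk G q l m → Target G τ l (live m q)

  target-live : ∀ {G τ l t} → Target G τ l t → ∀ s {m q} → turn s t ≡ live m q →
                m ≢ l × τ m ≡ live m false × (∀ {v} → Walk G s v l → Walk G q v m)
  target-live (kill _) s eq with trans (sym (turn-dead s)) eq
  ... | ()
  target-live (graft {m} {q} m≢l m-root w) s eq with trans (sym (turn-live s m q)) eq
  ... | refl = m≢l , m-root , _⊙ w

  target-dead : ∀ {G τ l t} → Target G τ l t → ∀ s → turn s t ≡ dead →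
                ∀ {v} → Walk G s v l → Walk G true v v
  -- The odd closed walk at the root is conjugated by the walk from `v` to the root, which leaves
  -- its parity odd.
  target-dead {G} (kill w) s eq {v} w′ =
    subst (λ b → Walk G b v v) (conjugate s) (w′ ⊙ w ⊙ reverse w′)
    where
    conjugate : ∀ b → b xor (true xor b) ≡ true
    conjugate true  = refl
    conjugate false = refl
  target-dead (graft {m} {q} _ _ _) s eq with trans (sym (turn-live s m q)) eq
  ... | ()

  module _ {F G : EdgeSet n} (L : Labelling F) (F⊆G : F ⊆ G) {l : Fin n}
           (l-root : σ L l ≡ live l false) {t : Label n} (target : Target G (σ L) l t)
           (opp : ∀ {u v} → Adj G u v → replace l t (σ L u) ≡ neg (replace l t (σ L v))) where

    private
      data View (v : Fin n) : Set where
        old-dead : σ L v ≡ dead → replace l t (σ L v) ≡ dead → View v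
        kept     : ∀ {m s} → m ≢ l → σ L v ≡ live m s → replace l t (σ L v) ≡ live m s → View v
        moved    : ∀ {s} → σ L v ≡ live l s → replace l t (σ L v) ≡ turn s t → View v

      view : ∀ v → View v
      view v with σ L v in eq
      ... | dead = old-dead eq (cong (replace l t) eq)
      ... | live m s with m ≟ l
      ...   | yes refl = moved eq (trans (cong (replace l t) eq) (replace-self l t s))
      ...   | no m≢l   = kept m≢l eq (trans (cong (replace l t) eq) (replace-other t s m≢l))

      τ : Fin n → Label n
      τ v = replace l t (σ L v)

      τ-root : ∀ {m} → m ≢ l → σ L m ≡ live m false → τ m ≡ live m false
      τ-root m≢l eq = trans (cong (replace l t) eq) (replace-other t false m≢l)

      τ-reach : ∀ {v m s} → τ v ≡ live m s → Walk G s v m × τ m ≡ live m false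
      τ-reach {v} eq with view v
      ... | old-dead _ d with trans (sym d) eq
      ...   | ()
      τ-reach {v} eq | kept m≢l p q with trans (sym q) eq
      ...   | refl = walk-mono F⊆G (reach L p) , τ-root m≢l (root L p)
      τ-reach {v} eq | moved {s} p q with target-live target s (trans (sym q) eq)
      ...   | m≢l , m-root , extend = extend (walk-mono F⊆G (reach L p)) , τ-root m≢l m-root

      τ-odd : ∀ {v} → τ v ≡ dead → Walk G true v v
      τ-odd {v} eq with view v
      ... | old-dead p _ = walk-mono F⊆G (odd L p)
      ... | kept _ _ q with trans (sym q) eq
      ...   | ()
      τ-odd {v} eq | moved {s} p q =
        target-dead target s (trans (sym q) eq) (walk-mono F⊆G (reach L p))

    eliminate : Labelling G
    eliminate = record
      { σ        = τ
      ; opposite = opp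
      ; reach    = λ eq → proj₁ (τ-reach eq)
      ; root     = λ eq → proj₂ (τ-reach eq)
      ; odd      = τ-odd
      }

    private
      nonroot⇒ : ∀ v → T (not (isRoot (τ v) v)) → T (not (isRootᵛ L v) ∨ does (l ≟ v))
      nonroot⇒ v h with l ≟ v
      ... | yes _ = ∨⁺ {not (isRootᵛ L v)} (inj₂ tt)
      ... | no l≢v = ∨⁺ {not (isRootᵛ L v)} (inj₁ (not⁺ λ r → not⁻ h
              (subst (λ x → T (isRoot x v))
                     (sym (τ-root (l≢v ∘ sym) (isRoot⁻ (σ L v) v r))) (isRoot⁺ v))))

      moved-nonroot : ∀ v {s} → σ L v ≡ live l s → τ v ≡ turn s t → τ v ≢ live v false
      moved-nonroot v {s} p q r with target-live target s (trans (sym q) r)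
      ... | v≢l , v-root , _ = v≢l (proj₁ (live-injective (trans (sym v-root) p)))

      ⇒nonroot : ∀ v → T (not (isRootᵛ L v) ∨ does (l ≟ v)) → T (not (isRoot (τ v) v))
      ⇒nonroot v h = not⁺ (λ r → bad (isRoot⁻ (τ v) v r))
        where
        bad : τ v ≢ live v false
        bad r with view v | ∨⁻ {not (isRootᵛ L v)} h
        ... | moved p q   | _ = moved-nonroot v p q r
        ... | old-dead _ d | _ with trans (sym d) r
        ...   | ()
        bad r | kept m≢l p q | inj₁ nr = not⁻ nr
          (subst (λ x → T (isRoot x v)) (sym (trans p (trans (sym q) r))) (isRoot⁺ v))
        bad r | kept m≢l p q | inj₂ l≡v with does⁻ (l ≟ v) l≡v
        ...   | refl = m≢l (proj₁ (live-injective (trans (sym q) r)))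

    -- Only `l` changes its status. Other roots keep their labels, and a relabelled vertex cannot
    -- become a root: its new root was a root before, while the vertex itself belonged to `l`.
    nonroots-eliminate : nonroots eliminate ≡ suc (nonroots L)
    nonroots-eliminate = begin
      nonroots eliminate
        ≡⟨ ≤-antisym (count-mono nonroot⇒ (allFin n)) (count-mono ⇒nonroot (allFin n)) ⟩
      count (λ v → not (isRootᵛ L v) ∨ does (l ≟ v)) (allFin n)
        ≡⟨ count-disjoint (not ∘ isRootᵛ L) (λ v → does (l ≟ v)) disj (allFin n) ⟨
      nonroots L + count (λ v → does (l ≟ v)) (allFin n)
        ≡⟨ cong (nonroots L +_) single ⟩
      nonroots L + 1
        ≡⟨ +-comm (nonroots L) 1 ⟩
      suc (nonroots L) ∎
      where
      open ≡-Reasoning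
      disj : ∀ v → T (not (isRootᵛ L v)) → ¬ T (does (l ≟ v))
      disj v nr l≡v with does⁻ (l ≟ v) l≡v
      ... | refl = not⁻ nr (subst (λ x → T (isRoot x l)) (sym l-root) (isRoot⁺ l))
      single : count (λ v → does (l ≟ v)) (allFin n) ≡ 1
      single = ≤-antisym
        (unique-length-≤ {ys = l ∷ []} (filterᵇ-unique (λ v → does (l ≟ v)) (Uniqueₚ.allFin⁺ n))
          (λ {v} v∈ → here (sym (does⁻ (l ≟ v)
            (proj₂ (∈-filterᵇ⁻ (λ v → does (l ≟ v)) (allFin n) v∈))))))
        (unique-length-≤ {xs = l ∷ []} ([] ∷ [])
          (λ { (here refl) → ∈-filterᵇ⁺ (λ v → does (l ≟ v)) (∈-allFin l) (does⁺ (l ≟ l) refl) }))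

  Adj-insert : ∀ {F : EdgeSet n} {i j} (i<j : i Fin.< j) {u v} → Adj (insert ((i , j) , i<j) F) u v →
               Adj F u v ⊎ ((u ≡ i × v ≡ j) ⊎ (u ≡ j × v ≡ i))
  Adj-insert {F} {i} {j} i<j {u} {v} (e , h , jn) with insert⁻ ((i , j) , i<j) F e h
  ... | inj₂ Fe   = inj₁ (e , Fe , jn)
  ... | inj₁ refl with joins⁻ ((i , j) , i<j) jn
  ...   | inj₁ refl = inj₂ (inj₁ (refl , refl))
  ...   | inj₂ refl = inj₂ (inj₂ (refl , refl))

  data Insertion {F : EdgeSet n} (L : Labelling F) (e : Edge n) : Set where
    spanned : σ L (proj₁ (proj₁ e)) ≡ neg (σ L (proj₂ (proj₁ e))) →
              (M : Labelling (insert e F)) → nonroots M ≡ nonroots L → Insertion L e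
    free    : σ L (proj₁ (proj₁ e)) ≢ neg (σ L (proj₂ (proj₁ e))) →
              (M : Labelling (insert e F)) → nonroots M ≡ suc (nonroots L) → Insertion L e

  -- The labels of the two ends decide. Two dead ends, or a common root with opposite signs, change
  -- nothing. One dead and one live end, or a common root with equal signs, produce an odd closed
  -- walk at a live root, which is killed. Different roots are merged by a graft.
  insertion : ∀ {F : EdgeSet n} (L : Labelling F) e → Insertion L e
  insertion {F} L e@((i , j) , i<j) = go (σ L i) (σ L j) refl refl
    where
    G = insert e F
    F⊆G : F ⊆ G
    F⊆G = insert-⊇ e F
    new : Adj G i j
    new = e , insert-self e F , joins⁺ e
    up : ∀ {p u v} → Walk F p u v → Walk G p u v
    up = walk-mono F⊆G

    opp-all : ∀ (f : Label n → Label n) → (∀ x → f (neg x) ≡ neg (f x)) →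
              f (σ L i) ≡ neg (f (σ L j)) → ∀ {u v} → Adj G u v → f (σ L u) ≡ neg (f (σ L v))
    opp-all f f-neg h a with Adj-insert i<j a
    ... | inj₁ b                  = trans (cong f (opposite L b)) (f-neg _)
    ... | inj₂ (inj₁ (refl , refl)) = h
    ... | inj₂ (inj₂ (refl , refl)) = trans (sym (neg-involutive _)) (cong neg (sym h))

    same : σ L i ≡ neg (σ L j) → Insertion L e
    same h = spanned h (record
      { σ        = σ L
      ; opposite = opp-all id (λ _ → refl) h
      ; reach    = λ eq → up (reach L eq)
      ; root     = root L
      ; odd      = λ eq → up (odd L eq)
      }) refl

    elim : ∀ {l t} → σ L i ≢ neg (σ L j) → σ L l ≡ live l false → Target G (σ L) l t →
           replace l t (σ L i) ≡ neg (replace l t (σ L j)) → Insertion L e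
    elim {l} {t} not-opp l-root target h = free not-opp (eliminate L F⊆G l-root target opp)
      (nonroots-eliminate L F⊆G l-root target opp)
      where
      opp : ∀ {u v} → Adj G u v → replace l t (σ L u) ≡ neg (replace l t (σ L v))
      opp = opp-all (replace l t) (replace-neg l t) h

    replaced : ∀ {v x} l t → σ L v ≡ x → ∀ {y} → replace l t x ≡ y → replace l t (σ L v) ≡ y
    replaced l t eq h = trans (cong (replace l t) eq) h

    absurd : ∀ {x y} → σ L i ≡ x → σ L j ≡ y → x ≢ neg y → σ L i ≢ neg (σ L j)
    absurd p q x≢ eq = x≢ (trans (sym p) (trans eq (cong neg q)))

    lollipop : ∀ b → b xor (true xor (true xor (true xor b))) ≡ true
    lollipop true  = refl
    lollipop false = refl

    go : ∀ x y → σ L i ≡ x → σ L j ≡ y → Insertion L e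
    go dead dead p q = same (trans p (cong neg (sym q)))
    -- The odd walk has the shape of a lollipop: from `l` to `j`, over the new edge to `i`, around
    -- the odd closed walk at `i`, and back the same way.
    go dead (live l s) p q = elim (absurd p q (λ ())) (root L q)
      (kill (subst (λ b → Walk G b l l) (lollipop s)
        (reverse (up (reach L q)) ⊙ edge (Adj-sym new) ⊙ up (odd L p) ⊙ edge new ⊙ up (reach L q))))
      (trans (replaced l dead p refl)
        (cong neg (sym (replaced l dead q (trans (replace-self l dead s) (turn-dead s))))))
    go (live l s) dead p q = elim (absurd p q (λ ())) (root L p)
      (kill (subst (λ b → Walk G b l l) (lollipop s)
        (reverse (up (reach L p)) ⊙ edge new ⊙ up (odd L q) ⊙ edge (Adj-sym new) ⊙ up (reach L p))))
      (trans (replaced l dead p (trans (replace-self l dead s) (turn-dead s)))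
        (cong neg (sym (replaced l dead q refl))))
    go (live l s) (live m t) p q with l ≟ m | s Boolₚ.≟ t
    ... | yes refl | yes refl = elim (absurd p q (λ eq → not-¬ refl (proj₂ (live-injective eq))))
      (root L p)
      (kill (subst (λ b → Walk G b l l) (parity s)
        (reverse (up (reach L p)) ⊙ edge new ⊙ up (reach L q))))
      (trans (replaced l dead p (trans (replace-self l dead s) (turn-dead s)))
        (cong neg (sym (replaced l dead q (trans (replace-self l dead s) (turn-dead s))))))
      where
      parity : ∀ b → b xor (true xor b) ≡ true
      parity true  = refl
      parity false = refl
    ... | yes refl | no s≢t = same (trans p (trans (cong (live l) (¬-not s≢t)) (cong neg (sym q))))
    ... | no l≢m | _ = elim (absurd p q (λ eq → l≢m (proj₁ (live-injective eq))))
      (root L p)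
      (graft (l≢m ∘ sym) (root L q) (reverse (up (reach L p)) ⊙ edge new ⊙ up (reach L q)))
      (trans (replaced l r p (trans (replace-self l r s) (trans (turn-live s m _)
               (cong (live m) (parity s t)))))
        (cong neg (sym (replaced l r q (replace-other r t (l≢m ∘ sym))))))
      where
      -- The sign is the parity of the walk from `l` to `i`, over the new edge to `j` and on to `m`;
      -- with it the labels of `i` and `j` become opposite.
      r = live m (s xor (true xor t))
      parity : ∀ a b → a xor (a xor (true xor b)) ≡ not b
      parity true  b = not-involutive (not b)
      parity false b = refl

  -- The rank function of the even cycle matroid

  ofList : List (Edge n) → EdgeSet n
  ofList = foldr insert ∅

  ofList⁺ : ∀ {e es} → e ∈ es → T (ofList es e)
  ofList⁺ {es = e ∷ es} (here refl) = insert-self e (ofList es)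
  ofList⁺ {es = f ∷ es} (there e∈)  = insert-⊇ f (ofList es) _ (ofList⁺ e∈)

  ofList⁻ : ∀ es {e} → T (ofList es e) → e ∈ es
  ofList⁻ (f ∷ es) {e} h with insert⁻ f (ofList es) e h
  ... | inj₁ refl = here refl
  ... | inj₂ h′   = there (ofList⁻ es h′)

  elements : EdgeSet n → List (Edge n)
  elements F = filterᵇ F (allEdges n)

  elements⁺ : ∀ F e → T (F e) → e ∈ elements F
  elements⁺ F e = ∈-filterᵇ⁺ F (∈-allEdges e)

  elements⁻ : ∀ F {e} → e ∈ elements F → T (F e)
  elements⁻ F e∈ = proj₂ (∈-filterᵇ⁻ F (allEdges n) e∈)

  labelList : ∀ es → Labelling (ofList es)
  labelList [] = record
    { σ        = λ v → live v false
    ; opposite = λ { (_ , () , _) }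
    ; reach    = λ { refl → stay }
    ; root     = λ { refl → refl }
    ; odd      = λ ()
    }
  labelList (e ∷ es) with insertion (labelList es) e
  ... | spanned _ M _ = M
  ... | free _ M _    = M

  abstract
    -- An edge set is a Boolean function, so the labelling is built along a list of its edges and
    -- carried over. Being abstract, it enters later proofs only through its fields.
    labelling : ∀ F → Labelling F
    labelling F = relabel (λ e h → elements⁻ F (ofList⁻ (elements F) h))
                          (λ e h → ofList⁺ (elements⁺ F e h)) (labelList (elements F))

  -- The rank function |V(F)| − β(F) of the even cycle matroid.
  ρ : EdgeSet n → ℕ
  ρ F = nonroots (labelling F)

  ρ-mono : ∀ {F G} → F ⊆ G → ρ F ≤ ρ G
  ρ-mono F⊆G = nonroots-mono F⊆G (labelling _) (labelling _)

  -- Two labellings of the same set may choose different roots; monotonicity in both directions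
  -- shows that they have equally many.
  ρ-nonroots : ∀ {F} (L : Labelling F) → nonroots L ≡ ρ F
  ρ-nonroots L = ≤-antisym (nonroots-mono ⊆-refl L (labelling _))
                           (nonroots-mono ⊆-refl (labelling _) L)

  -- For an edge uv this is membership in the closure of `F` in the even cycle matroid.
  Opposite : EdgeSet n → Fin n → Fin n → Set
  Opposite F u v = σ (labelling F) u ≡ neg (σ (labelling F) v)

  ρ-insert : ∀ F e → (Opposite F (proj₁ (proj₁ e)) (proj₂ (proj₁ e)) × ρ (insert e F) ≡ ρ F)
                   ⊎ ((¬ Opposite F (proj₁ (proj₁ e)) (proj₂ (proj₁ e))) × ρ (insert e F) ≡ suc (ρ F))
  ρ-insert F e with insertion (labelling F) e
  ... | spanned h M eq = inj₁ (h , trans (sym (ρ-nonroots M)) eq)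
  ... | free h M eq    = inj₂ (h , trans (sym (ρ-nonroots M)) eq)

  -- Diminishing returns could fail only if `e` were spanned by `F` and free over `G`, which
  -- `opposite-mono` excludes.
  ρ-local : ∀ {F G} → F ⊆ G → ∀ e → ρ (insert e G) + ρ F ≤ ρ G + ρ (insert e F)
  ρ-local {F} {G} F⊆G e with ρ-insert F e | ρ-insert G e
  ... | inj₁ (h , eq) | inj₁ (_ , eq′) = ≤-reflexive (cong₂ _+_ eq′ (sym eq))
  ... | inj₁ (h , eq) | inj₂ (¬h , _)  =
    contradiction (opposite-mono F⊆G (labelling F) (labelling G) h) ¬h
  ... | inj₂ (_ , eq) | inj₁ (_ , eq′) = +-mono-≤ (≤-reflexive eq′) (ρ-mono (insert-⊇ e F))
  ... | inj₂ (_ , eq) | inj₂ (_ , eq′) = ≤-reflexive (trans (cong (_+ ρ F) eq′)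
    (trans (sym (+-suc (ρ G) (ρ F))) (cong (ρ G +_) (sym eq))))

-- Bipartite components and their number

AllPairs-∈ : ∀ {A : Set} {R : A → A → Set} {xs} → Unique xs →
             (∀ {x y} → x ∈ xs → y ∈ xs → x ≢ y → R x y) → AllPairs R xs
AllPairs-∈ [] h = []
AllPairs-∈ (x∉ ∷ u) h =
  All.tabulate (λ y∈ → h (here refl) (there y∈) (All.lookup x∉ y∈))
  ∷ AllPairs-∈ u (λ p q → h (there p) (there q))

module _ {n : ℕ} where

  open Labelling

  walk⇒connected : ∀ {F : EdgeSet n} {p u v} → Walk F p u v → Connected F u v
  walk⇒connected stay    = ε
  walk⇒connected (a ◅ w) = a Star.◅ walk⇒connected w

  connected⇒walk : ∀ {F : EdgeSet n} {u v} → Connected F u v → ∃[ p ] Walk F p u v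
  connected⇒walk ε = false , stay
  connected⇒walk (a Star.◅ w) with connected⇒walk w
  ... | p , w′ = not p , a ◅ w′

  walk-alternates : ∀ {F : EdgeSet n} {r} ((c , _) : BipartiteComp F r) → ∀ {p u v} →
                    Connected F r u → Walk F p u v → c u ≡ p xor c v
  walk-alternates _ _ stay = refl
  walk-alternates B@(c , h) {u = u} {v} r~u (_◅_ {p} {v = w} a w′) =
    trans (¬-not (h u w r~u a))
      (trans (cong not (walk-alternates B (r~u Star.◅◅ (a Star.◅ ε)) w′)) (not-xor p (c v)))
    where
    not-xor : ∀ a b → not (a xor b) ≡ not a xor b
    not-xor true  b = not-involutive b
    not-xor false b = refl

  bipartite⇒¬odd : ∀ {F : EdgeSet n} {r} → BipartiteComp F r → ¬ Walk F true r r
  bipartite⇒¬odd {r = r} B@(c , _) w = not-¬ refl (walk-alternates B ε w)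

  walk-inV : ∀ {F : EdgeSet n} {p u v} → Walk F p u v → u ≡ v ⊎ T (inV F u)
  walk-inV stay                 = inj₁ refl
  walk-inV ((e , Fe , h) ◅ _) = inj₂ (inV⁺ _ e Fe h)

  odd-inV : ∀ {F : EdgeSet n} {p u v} → Walk F p u v → T p → T (inV F u)
  odd-inV ((e , Fe , h) ◅ _) _ = inV⁺ _ e Fe h

  walk-inV-end : ∀ {F : EdgeSet n} {p u v} → Walk F p u v → T (inV F u) → T (inV F v)
  walk-inV-end {F} w u∈ with walk-inV {F} (reverse w)
  ... | inj₁ refl = u∈
  ... | inj₂ v∈   = v∈

  rootᵛ : ∀ {F : EdgeSet n} (L : Labelling F) {v l s} → σ L v ≡ live l s → T (isRootᵛ L l)
  rootᵛ L {l = l} eq = subst (λ x → T (isRoot x l)) (sym (root L eq)) (isRoot⁺ l)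

  isolated-root : ∀ {F : EdgeSet n} (L : Labelling F) {v} → ¬ T (inV F v) → T (isRootᵛ L v)
  isolated-root {F} L {v} v∉ with σ L v in eq
  ... | dead = contradiction (odd-inV (odd L eq) tt) v∉
  ... | live l s with walk-inV (reach L eq)
  ...   | inj₂ v∈   = contradiction v∈ v∉
  ...   | inj₁ refl = subst (λ x → T (isRoot x v)) (trans (sym (root L eq)) eq) (isRoot⁺ v)

  bipRoot : EdgeSet n → Fin n → Bool
  bipRoot F v = isRootᵛ (labelling F) v ∧ inV F v

  β : EdgeSet n → ℕ
  β F = count (bipRoot F) (allFin n)

  -- An isolated vertex is its own root. Hence nonroots lie in V(F), and the remaining vertices of
  -- V(F) are the roots that represent its bipartite components.
  ρ+β : ∀ F → ρ F + β F ≡ ∣V F ∣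
  ρ+β F = trans (count-disjoint (not ∘ isRootᵛ L) (bipRoot F) disjoint (allFin n))
                (≤-antisym (count-mono into (allFin n)) (count-mono onto (allFin n)))
    where
    L = labelling F
    disjoint : ∀ v → T (not (isRootᵛ L v)) → ¬ T (bipRoot F v)
    disjoint v nr br = not⁻ nr (proj₁ (∧⁻ br))
    into : ∀ v → T (not (isRootᵛ L v) ∨ bipRoot F v) → T (inV F v)
    into v h with ∨⁻ {not (isRootᵛ L v)} h
    ... | inj₂ br = proj₂ (∧⁻ {isRootᵛ L v} br)
    ... | inj₁ nr with T? (inV F v)
    ...   | yes v∈ = v∈
    ...   | no v∉  = contradiction (isolated-root L v∉) (not⁻ nr)
    onto : ∀ v → T (inV F v) → T (not (isRootᵛ L v) ∨ bipRoot F v)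
    onto v v∈ with T? (isRootᵛ L v)
    ... | yes r = ∨⁺ {not (isRootᵛ L v)} (inj₂ (∧⁺ r v∈))
    ... | no ¬r = ∨⁺ {not (isRootᵛ L v)} (inj₁ (not⁺ ¬r))

  module _ {F : EdgeSet n} where

    private
      L = labelling F

      bipRoots : List (Fin n)
      bipRoots = filterᵇ (bipRoot F) (allFin n)

      bipRoots⁻ : ∀ {v} → v ∈ bipRoots → σ L v ≡ live v false × T (inV F v)
      bipRoots⁻ {v} v∈ with ∧⁻ {isRootᵛ L v} (proj₂ (∈-filterᵇ⁻ (bipRoot F) (allFin n) v∈))
      ... | r , v∈V = isRoot⁻ (σ L v) v r , v∈V

      bipRoots⁺ : ∀ {v l s} → σ L v ≡ live l s → T (inV F v) → l ∈ bipRoots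
      bipRoots⁺ {v} {l} eq v∈ = ∈-filterᵇ⁺ (bipRoot F) (∈-allFin l)
        (∧⁺ {isRootᵛ L l} (rootᵛ L {v} eq) (walk-inV-end (reach L eq) v∈))

      connected-label : ∀ {u v l s} → σ L v ≡ live l s → Connected F u v → ∃[ t ] σ L u ≡ live l t
      connected-label {l = l} {s} eq c with connected⇒walk c
      ... | p , w = p xor s , trans (along L w) (trans (cong (turn p) eq) (turn-live p l s))

    live⇒bipartite : ∀ {v l s} → σ L v ≡ live l s → BipartiteComp F v
    live⇒bipartite {v} {l} eq = (λ w → sign (σ L w)) , proper
      where
      sign : Label n → Bool
      -- A filler: every vertex connected to `v` shares its root and is live.
      sign dead       = false
      sign (live _ s) = s
      proper : ∀ u w → Connected F v u → Adj F u w → sign (σ L u) ≢ sign (σ L w)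
      proper u w v~u a same with connected-label eq (Star.reverse Adj-sym v~u)
      ... | t , σu with σ L w | opposite L a
      ...   | dead | h with trans (sym σu) h
      ...     | ()
      proper u w v~u a same | t , σu | live m r | h rewrite h = not-¬ refl (sym same)

    bipartite⇒live : ∀ {v} → BipartiteComp F v → ∃[ l ] ∃[ s ] σ L v ≡ live l s
    bipartite⇒live {v} B with σ L v in eq
    ... | live l s = l , s , refl
    ... | dead     = contradiction (odd L eq) (bipartite⇒¬odd B)

    Beta-β : Beta F (β F)
    Beta-β = bipRoots , refl
      , All.tabulate (λ v∈ → proj₂ (bipRoots⁻ v∈) , live⇒bipartite (proj₁ (bipRoots⁻ v∈)))
      , AllPairs-∈ (filterᵇ-unique (bipRoot F) (Uniqueₚ.allFin⁺ n)) separate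
      , complete
      where
      separate : ∀ {u v} → u ∈ bipRoots → v ∈ bipRoots → u ≢ v → ¬ Connected F u v
      separate u∈ v∈ u≢v c with connected-label (proj₁ (bipRoots⁻ v∈)) c
      ... | t , eq = u≢v (proj₁ (live-injective (trans (sym (proj₁ (bipRoots⁻ u∈))) eq)))
      complete : ∀ v → T (inV F v) → BipartiteComp F v → Any (Connected F v) bipRoots
      complete v v∈ B with bipartite⇒live B
      ... | l , s , eq = lose (bipRoots⁺ eq v∈) (walk⇒connected (reach L eq))

    -- Each representative is sent to the root in its label. This is injective since distinct
    -- representatives lie in distinct components, and it reaches every root in V(F) since such a
    -- root is connected to some representative.
    Beta-unique : ∀ {b} → Beta F b → b ≡ β F
    Beta-unique (reps , refl , bips , apart , complete) = ≤-antisym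
      (≤-trans (≤-reflexive (sym (length-map h reps)))
        (unique-length-≤ (AllPairsₚ.map⁺ (distinct bips apart)) images))
      (≤-trans (unique-length-≤ (filterᵇ-unique (bipRoot F) (Uniqueₚ.allFin⁺ n)) preimages)
        (≤-reflexive (length-map h reps)))
      where
      h : Fin n → Fin n
      h v = rootOf (σ L v) v
      h-live : ∀ {v} → BipartiteComp F v → ∃[ s ] σ L v ≡ live (h v) s
      h-live {v} B with σ L v | bipartite⇒live B
      ... | live l s | _ = s , refl
      distinct : ∀ {rs} → All (λ r → T (inV F r) × BipartiteComp F r) rs →
                 AllPairs (λ r s → ¬ Connected F r s) rs → AllPairs (λ r s → h r ≢ h s) rs
      distinct [] [] = []
      distinct {r ∷ rs} ((_ , B) ∷ bs) (a ∷ as) =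
        All.zipWith (λ { {s} (¬c , (_ , B′)) eq → ¬c (joined s B′ eq) }) (a , bs) ∷ distinct bs as
        where
        joined : ∀ s → BipartiteComp F s → h r ≡ h s → Connected F r s
        joined s B′ eq with h-live B | h-live B′
        ... | t , σr | t′ , σs = walk⇒connected
          (reach L σr ⊙ reverse (reach L (subst (λ l → σ L s ≡ live l t′) (sym eq) σs)))
      images : ∀ {x} → x ∈ map h reps → x ∈ bipRoots
      images x∈ with ∈-map⁻ h x∈
      ... | r , r∈ , refl with All.lookup bips r∈
      ...   | r∈V , B = bipRoots⁺ (proj₂ (h-live B)) r∈V
      preimages : ∀ {x} → x ∈ bipRoots → x ∈ map h reps
      preimages {x} x∈ =
        let σx , x∈V = bipRoots⁻ x∈
            r , r∈ , c = find (complete x x∈V (live⇒bipartite σx))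
            _ , σr = connected-label σx (Star.reverse Adj-sym c)
        in subst (_∈ map h reps) (cong (λ y → rootOf y r) σr) (∈-map⁺ h r∈)

  Beta-ρ : ∀ {F b} → Beta F b → ρ F + b ≡ ∣V F ∣
  Beta-ρ {F} B = trans (cong (ρ F +_) (Beta-unique B)) (ρ+β F)

  -- Submodularity

  Monotone Submodular : (EdgeSet n → ℕ) → Set
  Monotone f   = ∀ {A B} → A ⊆ B → f A ≤ f B
  Submodular f = ∀ A B → f (A ∪ B) + f (A ∩ B) ≤ f A + f B

  _⊕_ : EdgeSet n → List (Edge n) → EdgeSet n
  C ⊕ xs = foldr insert C xs

  ⊕-base : ∀ C xs → C ⊆ (C ⊕ xs)
  ⊕-base C []       = ⊆-refl
  ⊕-base C (x ∷ xs) = ⊆-trans (⊕-base C xs) (insert-⊇ x (C ⊕ xs))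

  ⊕-∈ : ∀ C {xs e} → e ∈ xs → T ((C ⊕ xs) e)
  ⊕-∈ C {x ∷ xs} (here refl) = insert-self x (C ⊕ xs)
  ⊕-∈ C {x ∷ xs} (there e∈)  = insert-⊇ x (C ⊕ xs) _ (⊕-∈ C e∈)

  -- The elements of `B` are inserted one by one into both `A` and `A ∩ B`. By `local` no insertion
  -- gains more over the larger set; the first chain ends above `A ∪ B`, the second stays inside
  -- `B`.
  local⇒submodular : ∀ (f : EdgeSet n → ℕ) → Monotone f →
    (∀ {A B} → A ⊆ B → ∀ e → f (insert e B) + f A ≤ f B + f (insert e A)) → Submodular f
  local⇒submodular f mono local A B = ≤-trans
    (≤-trans (+-monoˡ-≤ _ (mono (∪-least (⊕-base A es) (λ e h → ⊕-∈ A (elements⁺ B e h)))))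
      (chain es))
    (+-monoʳ-≤ (f A) (mono (within es (λ e∈ → elements⁻ B e∈))))
    where
    es = elements B
    ⊕-mono : ∀ {C D} → C ⊆ D → ∀ xs → (C ⊕ xs) ⊆ (D ⊕ xs)
    ⊕-mono C⊆D []       = C⊆D
    ⊕-mono C⊆D (x ∷ xs) = insert-mono x (⊕-mono C⊆D xs)
    within : ∀ xs → (∀ {e} → e ∈ xs → T (B e)) → ((A ∩ B) ⊕ xs) ⊆ B
    within []       h = ∩-right A B
    within (x ∷ xs) h = insert-least (h (here refl)) (within xs (h ∘ there))
    rearrange₁ : ∀ x′ c x y → x′ + c + (x + y) ≡ (x′ + y) + (x + c)
    rearrange₁ = solve-∀
    rearrange₂ : ∀ x y′ a y → (x + y′) + (a + y) ≡ a + y′ + (x + y)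
    rearrange₂ = solve-∀
    add : ∀ x′ y x y′ c a → x′ + y ≤ x + y′ → x + c ≤ a + y → x′ + c ≤ a + y′
    add x′ y x y′ c a p q = +-cancelʳ-≤ (x + y) _ _ (begin
      x′ + c + (x + y)     ≡⟨ rearrange₁ x′ c x y ⟩
      (x′ + y) + (x + c)   ≤⟨ +-mono-≤ p q ⟩
      (x + y′) + (a + y)   ≡⟨ rearrange₂ x y′ a y ⟩
      a + y′ + (x + y)     ∎)
      where open ≤-Reasoning
    chain : ∀ xs → f (A ⊕ xs) + f (A ∩ B) ≤ f A + f ((A ∩ B) ⊕ xs)
    chain []       = ≤-refl
    chain (x ∷ xs) = add _ (f ((A ∩ B) ⊕ xs)) (f (A ⊕ xs)) _ _ (f A) (local (⊕-mono (∩-left A B) xs) x) (chain xs)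

  ρ-submodular : Submodular ρ
  ρ-submodular = local⇒submodular ρ ρ-mono ρ-local

  V-mono : Monotone ∣V_∣
  V-mono {A} {B} A⊆B = count-mono (inV-mono {F = A} {B} A⊆B) (allFin n)

  V-submodular : Submodular ∣V_∣
  V-submodular A B = ≤-trans
    (+-mono-≤ (count-mono union (allFin n)) (count-mono meet (allFin n)))
    (≤-reflexive (count-∨∧ (inV A) (inV B) (allFin n)))
    where
    union : ∀ v → T (inV (A ∪ B) v) → T (inV A v ∨ inV B v)
    union v h with inV⁻ (A ∪ B) {v} h
    ... | w , e , h′ , j with ∨⁻ {A e} h′
    ...   | inj₁ Ae = ∨⁺ {inV A v} (inj₁ (inV⁺ A e Ae j))
    ...   | inj₂ Be = ∨⁺ {inV A v} (inj₂ (inV⁺ B e Be j))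
    meet : ∀ v → T (inV (A ∩ B) v) → T (inV A v ∧ inV B v)
    meet v h = ∧⁺ {inV A v} (inV-mono {F = A ∩ B} {A} (∩-left A B) v h)
                            (inV-mono {F = A ∩ B} {B} (∩-right A B) v h)

  V-pendant : ∀ {F : EdgeSet n} {v u} e → ¬ T (inV F v) → T (joins e v u) →
              suc ∣V F ∣ ≤ ∣V insert e F ∣
  V-pendant {F} {v} e v∉ j = count-strict {p = inV F} {inV (insert e F)}
    (inV-mono {F = F} {insert e F} (insert-⊇ e F)) (∈-allFin v)
    (inV⁺ (insert e F) e (insert-self e F) j) v∉

  -- The new vertex `v` is isolated in `F`, hence its own root. If the edge were spanned, the label
  -- of `u` would have root `v`, and a walk of `F` would reach `v`.
  ρ-pendant : ∀ {F : EdgeSet n} {v u} e → ¬ T (inV F v) → T (joins e v u) →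
              suc (ρ F) ≤ ρ (insert e F)
  ρ-pendant {F} {v} {u} e@((i , j) , i<j) v∉ jn with ρ-insert F e
  ... | inj₂ (_ , eq) = ≤-reflexive (sym eq)
  ... | inj₁ (opp , _) = ⊥-elim (v≢u (both (joins⁻ e jn)))
    where
    L = labelling F
    v≢u : v ≢ u
    v≢u refl = joins-irrefl e jn
    stuck : ∀ {s} → σ L u ≡ live v s → v ≡ u
    stuck eq with walk-inV (reverse (reach L eq))
    ... | inj₁ p  = p
    ... | inj₂ v∈ = contradiction v∈ v∉
    σv : σ L v ≡ live v false
    σv = isRoot⁻ (σ L v) v (isolated-root L v∉)
    both : proj₁ e ≡ (v , u) ⊎ proj₁ e ≡ (u , v) → v ≡ u
    both (inj₁ refl) = stuck (trans (sym (neg-involutive _)) (cong neg (trans (sym opp) σv)))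
    both (inj₂ refl) = stuck (trans opp (cong neg σv))

  ρ≤V : ∀ F → ρ F ≤ ∣V F ∣
  ρ≤V F = ≤-trans (m≤m+n (ρ F) (β F)) (≤-reflexive (ρ+β F))

  ∉V∅ : ∀ v → ¬ T (inV (∅ {n}) v)
  ∉V∅ v h = proj₁ (proj₂ (proj₂ (inV⁻ ∅ {v} h)))

  V∅ : ∣V ∅ {n} ∣ ≡ 0
  V∅ = count-none ∉V∅ (allFin n)

  ρ∅ : ρ (∅ {n}) ≡ 0
  ρ∅ = n≤0⇒n≡0 (≤-trans (ρ≤V ∅) (≤-reflexive V∅))

  ρ-single : ∀ e → ρ (insert e ∅) ≡ 1
  ρ-single e = ≤-antisym upper
    (≤-trans (≤-reflexive (cong suc (sym ρ∅)))
      (ρ-pendant {F = ∅} {proj₁ (proj₁ e)} {proj₂ (proj₁ e)} e (∉V∅ (proj₁ (proj₁ e))) (joins⁺ e)))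
    where
    upper : ρ (insert e ∅) ≤ 1
    upper with ρ-insert ∅ e
    ... | inj₁ (_ , eq) = ≤-trans (≤-reflexive (trans eq ρ∅)) z≤n
    ... | inj₂ (_ , eq) = ≤-reflexive (trans eq (cong suc ρ∅))

  V-single : ∀ e → ∣V insert e ∅ ∣ ≡ 2
  V-single e@((i , j) , i<j) = ≤-antisym
    (unique-length-≤ {ys = i ∷ j ∷ []} (filterᵇ-unique (inV (insert e ∅)) (Uniqueₚ.allFin⁺ n)) ends)
    (unique-length-≤ {xs = i ∷ j ∷ []} ((i≢j ∷ []) ∷ [] ∷ []) λ
      { (here refl)         → ∈-filterᵇ⁺ (inV (insert e ∅)) (∈-allFin i)
                                (inV⁺ (insert e ∅) e (insert-self e ∅) (joins⁺ e))
      ; (there (here refl)) → ∈-filterᵇ⁺ (inV (insert e ∅)) (∈-allFin j)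
                                (inV⁺ (insert e ∅) e (insert-self e ∅) (joins-sym e (joins⁺ e))) })
    where
    i≢j : i ≢ j
    i≢j refl = <-irrefl refl i<j
    ends : ∀ {v} → v ∈ filterᵇ (inV (insert e ∅)) (allFin n) → v ∈ i ∷ j ∷ []
    ends {v} v∈ with inV⁻ (insert e ∅) {v} (proj₂ (∈-filterᵇ⁻ (inV (insert e ∅)) (allFin n) v∈))
    ... | w , f , h , jn with insert⁻ e ∅ f h
    ...   | inj₁ refl with joins⁻ e jn
    ...     | inj₁ refl = here refl
    ...     | inj₂ refl = there (here refl)

  -- The triangle is an odd closed walk at each of its three vertices, so all three are dead and
  -- thus nonroots.
  triangle-ρ : ∀ {F : EdgeSet n} {u v w} → Adj F u v → Adj F v w → Adj F w u →
               u ≢ v → v ≢ w → u ≢ w → 3 ≤ ρ F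
  triangle-ρ {F} {u} {v} {w} a b c u≢v v≢w u≢w =
    unique-length-≤ {xs = u ∷ v ∷ w ∷ []} ((u≢v ∷ u≢w ∷ []) ∷ (v≢w ∷ []) ∷ [] ∷ []) λ
      { (here refl)                 → nonroot (a ◅ b ◅ c ◅ stay)
      ; (there (here refl))         → nonroot (b ◅ c ◅ a ◅ stay)
      ; (there (there (here refl))) → nonroot (c ◅ a ◅ b ◅ stay) }
    where
    L = labelling F
    nonroot : ∀ {x} → Walk F true x x → x ∈ filterᵇ (not ∘ isRootᵛ L) (allFin n)
    nonroot {x} o = ∈-filterᵇ⁺ (not ∘ isRootᵛ L) (∈-allFin x) (subst (λ y → T (not (isRoot y x)))
      (sym (self-opposite _ (along L o))) tt)

-- Proper sequences of circuits bound the size of independent sets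

module _ {n : ℕ} (M : Matroid n) where

  open IsMatroid (isMatroid M)

  -- `d` bounds the number of augmentations still to be made.
  augment : ∀ d I J → ∣ J ∣ ≤ d + ∣ I ∣ → Ind M I → Ind M J →
            ∃[ K ] (I ⊆ K × K ⊆ (I ∪ J) × Ind M K × ∣ J ∣ ≤ ∣ K ∣)
  augment zero I J le indI indJ = I , ⊆-refl , ∪-left I J , indI , le
  augment (suc d) I J le indI indJ with ∣ J ∣ ≤? ∣ I ∣
  ... | yes J≤I = I , ⊆-refl , ∪-left I J , indI , J≤I
  ... | no J≰I with ind-aug I J indI indJ (≰⇒> J≰I)
  ...   | e , Je , ¬Ie , ind-eI with augment d (insert e I) J
                (≤-trans le (≤-trans (≤-reflexive (sym (+-suc d ∣ I ∣)))
                  (+-monoʳ-≤ d (∣∣-strict (insert-⊇ e I) e (insert-self e I) ¬Ie))))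
                ind-eI indJ
  ...     | K , I⊆K , K⊆ , indK , J≤K = K , ⊆-trans (insert-⊇ e I) I⊆K
          , ⊆-trans K⊆ (∪-least (insert-least (∪-right I J e Je) (∪-left I J)) (∪-right I J))
          , indK , J≤K

  -- The nullity of `A` is at least `m`, stated without a rank function.
  Deficient : EdgeSet n → ℕ → Set
  Deficient A m = ∀ J → J ⊆ A → Ind M J → ∣ J ∣ + m ≤ ∣ A ∣

  -- A maximum independent set of A ∪ X may be chosen to contain A ∩ X, and then misses
  -- an element of X outside A.
  deficient-step : ∀ {A X m} → Deficient A m → Circuit M X → ¬ (X ⊆ A) → Deficient (A ∪ X) (suc m)
  deficient-step {A} {X} {m} def (dep , indep) X⊈A J J⊆ indJ
    with ⊆-or-witness X A
  ... | inj₂ X⊆A = contradiction X⊆A X⊈A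
  ... | inj₁ (x , Xx , ¬Ax) with augment ∣ J ∣ (A ∩ X) J (m≤m+n ∣ J ∣ _)
            (indep (A ∩ X) (∩-right A X) (x , Xx , λ h → ¬Ax (∩-left A X x h))) indJ
  ...   | K , A∩X⊆K , K⊆ , indK , J≤K with ⊆-or-witness X K
  ...     | inj₂ X⊆K = contradiction (ind-sub K X X⊆K indK) dep
  ...     | inj₁ (y , Xy , ¬Ky) = begin
    ∣ J ∣ + suc m                    ≤⟨ +-monoˡ-≤ (suc m) J≤K ⟩
    ∣ K ∣ + suc m                    ≤⟨ +-monoˡ-≤ (suc m) (∣∣-mono K-split) ⟩
    ∣ (K ∩ A) ∪ (K ∩ (X ∖ A)) ∣ + suc m
      ≤⟨ +-monoˡ-≤ (suc m) (∣∪∣-≤ (K ∩ A) (K ∩ (X ∖ A))) ⟩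
    (∣ K ∩ A ∣ + ∣ K ∩ (X ∖ A) ∣) + suc m
      ≡⟨ rearrange ∣ K ∩ A ∣ ∣ K ∩ (X ∖ A) ∣ m ⟩
    (∣ K ∩ A ∣ + m) + suc ∣ K ∩ (X ∖ A) ∣
      ≤⟨ +-mono-≤ (def (K ∩ A) (∩-right K A) (ind-sub K (K ∩ A) (∩-left K A) indK))
                  (∣∣-strict (∩-right K (X ∖ A)) y y∈X∖A (λ h → ¬Ky (∩-left K (X ∖ A) y h))) ⟩
    ∣ A ∣ + ∣ X ∖ A ∣                ≡⟨ count-disjoint A (X ∖ A) A-disjoint (allEdges n) ⟩
    ∣ A ∪ (X ∖ A) ∣                  ≤⟨ ∣∣-mono (∪-least (∪-left A X)
                                         (⊆-trans (∩-left X (not ∘ A)) (∪-right A X))) ⟩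
    ∣ A ∪ X ∣                        ∎
    where
    open ≤-Reasoning
    rearrange : ∀ p q m → (p + q) + suc m ≡ (p + m) + suc q
    rearrange = solve-∀
    A-disjoint : ∀ e → T (A e) → ¬ T ((X ∖ A) e)
    A-disjoint e Ae h = not⁻ (∩-right X (not ∘ A) e h) Ae
    y∈X∖A : T ((X ∖ A) y)
    y∈X∖A = ∧⁺ {X y} Xy (not⁺ (λ Ay → ¬Ky (A∩X⊆K y (∧⁺ {A y} Ay Xy))))
    K-split : K ⊆ ((K ∩ A) ∪ (K ∩ (X ∖ A)))
    K-split e Ke with T? (A e)
    ... | yes Ae = ∪-left (K ∩ A) (K ∩ (X ∖ A)) e (∧⁺ {K e} Ke Ae)
    ... | no ¬Ae = ∪-right (K ∩ A) (K ∩ (X ∖ A)) e (∧⁺ {K e} Ke (∧⁺ {X e} Xe (not⁺ ¬Ae)))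
      where
      Xe : T (X e)
      Xe with ∨⁻ {A e} ([ (λ h → ∪-left A X e (∩-left A X e h)) , J⊆ e ]′
                        (∨⁻ {(A ∩ X) e} (K⊆ e Ke)))
      ... | inj₁ Ae = contradiction Ae ¬Ae
      ... | inj₂ Xe = Xe

  deficient-seq : ∀ {A m} S → Deficient A m → All (Circuit M) S → ProperFrom A S →
                  Deficient (A ∪ ⋃ S) (length S + m)
  deficient-seq {A} {m} [] def _ _ J J⊆ indJ = ≤-trans (def J J⊆A indJ) (∣∣-mono (∪-left A ∅))
    where
    J⊆A : J ⊆ A
    J⊆A = ⊆-trans J⊆ (∪-least ⊆-refl (λ _ ()))
  deficient-seq {A} {m} (X ∷ S) def (cX ∷ cS) (X⊈A , proper) J J⊆ indJ = begin
    ∣ J ∣ + suc (length S + m)   ≡⟨ cong (∣ J ∣ +_) (+-suc (length S) m) ⟨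
    ∣ J ∣ + (length S + suc m)   ≤⟨ deficient-seq S (deficient-step def cX X⊈A) cS proper J
                                      (⊆-trans J⊆ assocʳ) indJ ⟩
    ∣ (A ∪ X) ∪ ⋃ S ∣            ≤⟨ ∣∣-mono assocˡ ⟩
    ∣ A ∪ ⋃ (X ∷ S) ∣            ∎
    where
    open ≤-Reasoning
    assocʳ : (A ∪ (X ∪ ⋃ S)) ⊆ ((A ∪ X) ∪ ⋃ S)
    assocʳ = ∪-least (⊆-trans (∪-left A X) (∪-left (A ∪ X) (⋃ S)))
      (∪-least (⊆-trans (∪-right A X) (∪-left (A ∪ X) (⋃ S))) (∪-right (A ∪ X) (⋃ S)))
    assocˡ : ((A ∪ X) ∪ ⋃ S) ⊆ (A ∪ (X ∪ ⋃ S))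
    assocˡ = ∪-least (∪-least (∪-left A (X ∪ ⋃ S))
      (⊆-trans (∪-left X (⋃ S)) (∪-right A (X ∪ ⋃ S))))
      (⊆-trans (∪-right X (⋃ S)) (∪-right A (X ∪ ⋃ S)))

  -- `Proper` puts no condition on the first member, but a circuit is dependent and therefore not
  -- contained in `∅`.
  proper-from-∅ : ∀ {S} → All (Circuit M) S → Proper S → ProperFrom ∅ S
  proper-from-∅ [] _ = tt
  proper-from-∅ {X ∷ _} ((dep , _) ∷ _) p = (λ X⊆∅ → dep (ind-sub ∅ X X⊆∅ ind-∅)) , p

  -- By `deficient-seq`, started at `∅`, the union of the sequence has nullity at least `length S`,
  -- which bounds the part of `J` inside it; the part of `J` outside is bounded by the part of `F`
  -- outside.
  independent-≤-val : ∀ {S} → All (Circuit M) S → Proper S → ∀ J F → J ⊆ F → Ind M J →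
                      ∣ J ∣ + length S ≤ ∣ F ∪ ⋃ S ∣
  independent-≤-val {S} circuits proper J F J⊆F indJ = begin
    ∣ J ∣ + length S
      ≤⟨ +-monoˡ-≤ (length S) (∣∣-mono J-split) ⟩
    ∣ (J ∩ ⋃ S) ∪ (F ∖ ⋃ S) ∣ + length S
      ≤⟨ +-monoˡ-≤ (length S) (∣∪∣-≤ (J ∩ ⋃ S) (F ∖ ⋃ S)) ⟩
    (∣ J ∩ ⋃ S ∣ + ∣ F ∖ ⋃ S ∣) + length S
      ≡⟨ rearrange ∣ J ∩ ⋃ S ∣ ∣ F ∖ ⋃ S ∣ (length S) ⟩
    (∣ J ∩ ⋃ S ∣ + (length S + 0)) + ∣ F ∖ ⋃ S ∣
      ≤⟨ +-monoˡ-≤ ∣ F ∖ ⋃ S ∣ (deficient-seq S base circuits (proper-from-∅ circuits proper)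
           (J ∩ ⋃ S) (∩-right J (⋃ S)) (ind-sub J _ (∩-left J (⋃ S)) indJ)) ⟩
    ∣ ⋃ S ∣ + ∣ F ∖ ⋃ S ∣
      ≡⟨ count-disjoint (⋃ S) (F ∖ ⋃ S)
           (λ e Se h → not⁻ (∩-right F (not ∘ ⋃ S) e h) Se) (allEdges n) ⟩
    ∣ ⋃ S ∪ (F ∖ ⋃ S) ∣
      ≤⟨ ∣∣-mono (∪-least (∪-right F (⋃ S)) (⊆-trans (∩-left F (not ∘ ⋃ S)) (∪-left F (⋃ S)))) ⟩
    ∣ F ∪ ⋃ S ∣ ∎
    where
    open ≤-Reasoning
    rearrange : ∀ p q m → (p + q) + m ≡ (p + (m + 0)) + q
    rearrange = solve-∀
    base : Deficient ∅ 0
    base J J⊆∅ _ = ≤-trans (≤-reflexive (+-identityʳ ∣ J ∣)) (∣∣-mono J⊆∅)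
    J-split : J ⊆ ((J ∩ ⋃ S) ∪ (F ∖ ⋃ S))
    J-split e Je with T? (⋃ S e)
    ... | yes Se = ∪-left (J ∩ ⋃ S) (F ∖ ⋃ S) e (∧⁺ {J e} Je Se)
    ... | no ¬Se = ∪-right (J ∩ ⋃ S) (F ∖ ⋃ S) e (∧⁺ {F e} (J⊆F e Je) (not⁺ ¬Se))

-- Generating edge sets by proper sequences

-- `j` is a budget for paid edges: all but at most `j` edges of `U` are balanced by members of the
-- sequence.
record Generated {n : ℕ} (H : List Pattern) (U : EdgeSet n) (j : ℕ) : Set where
  field
    seq    : List (EdgeSet n)
    inX    : All (InX H) seq
    proper : ProperFrom ∅ seq
    within : ⋃ seq ⊆ U
    size   : ∣ U ∣ ≤ j + length seq

module _ {n : ℕ} {H : List Pattern} where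

  open Generated

  generated-∅ : Generated {n} H ∅ 0
  generated-∅ = record
    { seq = [] ; inX = [] ; proper = tt ; within = λ _ () ; size = ≤-reflexive (∣∅∣ {n}) }

  generated-weaken : ∀ {U : EdgeSet n} {i j} → i ≤ j → Generated H U i → Generated H U j
  generated-weaken i≤j G = record
    { seq = seq G ; inX = inX G ; proper = proper G ; within = within G
    ; size = ≤-trans (size G) (+-monoˡ-≤ (length (seq G)) i≤j) }

  add-free : ∀ {U : EdgeSet n} {j} x y → Generated H U j → Generated H (U ∪ ⟦ x , y ⟧) (suc j)
  add-free {U} {j} x y G = record
    { seq = seq G ; inX = inX G ; proper = proper G
    ; within = ⊆-trans (within G) (∪-left U ⟦ x , y ⟧)
    ; size = ≤-trans (∣∪∣-≤ U ⟦ x , y ⟧) (≤-trans (+-mono-≤ (size G) (∣⟦⟧∣≤1 x y))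
                     (≤-reflexive (+-comm (j + length (seq G)) 1))) }

  properFrom-snoc : ∀ {A U X : EdgeSet n} S → ProperFrom A S → ¬ (X ⊆ U) → A ⊆ U → ⋃ S ⊆ U →
                    ProperFrom A (S ∷ʳ X)
  properFrom-snoc [] _ X⊈U A⊆U _ = (λ X⊆A → X⊈U (⊆-trans X⊆A A⊆U)) , tt
  properFrom-snoc (Y ∷ S) (Y⊈A , p) X⊈U A⊆U S⊆U = Y⊈A ,
    properFrom-snoc S p X⊈U (∪-least A⊆U (⊆-trans (∪-left Y (⋃ S)) S⊆U))
      (⊆-trans (∪-right Y (⋃ S)) S⊆U)

  ⋃-snoc : ∀ {U X : EdgeSet n} S → ⋃ S ⊆ U → X ⊆ U → ⋃ (S ∷ʳ X) ⊆ U
  ⋃-snoc [] _ X⊆U = ∪-least X⊆U (λ _ ())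
  ⋃-snoc (Y ∷ S) S⊆U X⊆U = ∪-least (⊆-trans (∪-left Y (⋃ S)) S⊆U)
    (⋃-snoc S (⊆-trans (∪-right Y (⋃ S)) S⊆U) X⊆U)

  -- If `X` already lies in `U`, so does the edge xy, and nothing is appended, as `X` would violate
  -- properness. Otherwise the one new edge is balanced by the one new member.
  add-step : ∀ {U X : EdgeSet n} {j} x y → InX H X → X ⊆ (U ∪ ⟦ x , y ⟧) → ⟦ x , y ⟧ ⊆ X →
             Generated H U j → Generated H (U ∪ ⟦ x , y ⟧) j
  add-step {U} {X} {j} x y X∈ X⊆ xy⊆X G with ⊆-or-witness X U
  ... | inj₂ X⊆U = record
    { seq = seq G ; inX = inX G ; proper = proper G
    ; within = ⊆-trans (within G) (∪-left U ⟦ x , y ⟧)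
    ; size = ≤-trans (∣∣-mono (∪-least (⊆-refl {A = U}) (⊆-trans xy⊆X X⊆U))) (size G) }
  ... | inj₁ (e , Xe , ¬Ue) = record
    { seq    = seq G ∷ʳ X
    ; inX    = Allₚ.∷ʳ⁺ (inX G) X∈
    ; proper = properFrom-snoc (seq G) (proper G) (λ X⊆U → ¬Ue (X⊆U e Xe)) (λ _ ()) (within G)
    ; within = ⋃-snoc (seq G) (⊆-trans (within G) (∪-left U ⟦ x , y ⟧)) X⊆
    ; size   = ≤-trans (∣∪∣-≤ U ⟦ x , y ⟧) (≤-trans (+-mono-≤ (size G) (∣⟦⟧∣≤1 x y))
        (≤-reflexive (trans (+-assoc j (length (seq G)) 1) (cong (j +_)
          (sym (length-++ (seq G))))))) }

-- Matroids induced by submodular functions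

-- `single` makes one-edge sets tight and fixes `c`. The constants `a`, the gain from an edge at a
-- new vertex, and `t`, a lower bound on triangles, serve the verification that copies of the
-- patterns are circuits.
record Weight (n : ℕ) : Set where
  field
    f          : EdgeSet n → ℕ
    c a t      : ℕ
    monotone   : Monotone f
    submodular : Submodular f
    single     : ∀ e → f (insert e ∅) ≡ suc c
    pendant    : ∀ {F v u} e → ¬ T (inV F v) → T (joins e v u) → a + f F ≤ f (insert e F)
    triangle   : ∀ {F u v w} → Adj F u v → Adj F v w → Adj F w u →
                 u ≢ v → v ≢ w → u ≢ w → t ≤ f F

  Independent : EdgeSet n → Set
  Independent F = ∀ I → I ⊆ F → Nonempty I → ∣ I ∣ + c ≤ f I

module InducedMatroid {n : ℕ} (W : Weight n) where

  open Weight W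

  cl : EdgeSet n → EdgeSet n
  cl A e = does (f (insert e A) ≤? f A)

  cl⁻ : ∀ A e → T (cl A e) → f (insert e A) ≤ f A
  cl⁻ A e = does⁻ (f (insert e A) ≤? f A)

  cl⁺ : ∀ A e → f (insert e A) ≤ f A → T (cl A e)
  cl⁺ A e = does⁺ (f (insert e A) ≤? f A)

  -- Submodularity for `insert e A` and `B`: an edge that gains nothing over `A` gains nothing over
  -- `B`.
  cl-mono : ∀ {A B} → A ⊆ B → cl A ⊆ cl B
  cl-mono {A} {B} A⊆B e h = cl⁺ B e (+-cancelʳ-≤ (f A) _ _ (begin
    f (insert e B) + f A
      ≤⟨ +-mono-≤ (monotone (insert-least (∪-left (insert e A) B e (insert-self e A))
                                          (∪-right (insert e A) B)))
                  (monotone (λ x Ax → ∧⁺ {insert e A x} (insert-⊇ e A x Ax) (A⊆B x Ax))) ⟩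
    f (insert e A ∪ B) + f (insert e A ∩ B)
      ≤⟨ submodular (insert e A) B ⟩
    f (insert e A) + f B
      ≤⟨ +-monoˡ-≤ (f B) (cl⁻ A e h) ⟩
    f A + f B
      ≡⟨ +-comm (f A) (f B) ⟩
    f B + f A ∎))
    where open ≤-Reasoning

  -- The elements of the closure are added one at a time; by `cl-mono` each of them is still in the
  -- closure of the set built so far.
  f-cl : ∀ A → f (cl A) ≤ f A
  f-cl A = ≤-trans (monotone (λ e h → ⊕-∈ A (elements⁺ (cl A) e h)))
                   (go (elements (cl A)) (elements⁻ (cl A)))
    where
    go : ∀ es → (∀ {e} → e ∈ es → T (cl A e)) → f (A ⊕ es) ≤ f A
    go []       _ = ≤-refl
    go (e ∷ es) h = ≤-trans (cl⁻ (A ⊕ es) e (cl-mono (⊕-base A es) e (h (here refl))))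
                            (go es (h ∘ there))

  record Tight (I A : EdgeSet n) : Set where
    field
      sub      : A ⊆ I
      nonempty : Nonempty A
      tight    : f A ≤ ∣ A ∣ + c
  open Tight

  Spanned : EdgeSet n → Edge n → Set
  Spanned I e = ∃[ A ] (Tight I A × T (cl A e))

  tight-mono : ∀ {I J A} → I ⊆ J → Tight I A → Tight J A
  tight-mono I⊆J t = record { sub = ⊆-trans (sub t) I⊆J ; nonempty = nonempty t ; tight = tight t }

  spanned-mono : ∀ {I J} → I ⊆ J → ∀ {e} → Spanned I e → Spanned J e
  spanned-mono I⊆J {e} (A , t , h) = A , tight-mono I⊆J t , h

  spanned-self : ∀ {I e} → T (I e) → Spanned I e
  spanned-self {I} {e} Ie = insert e ∅ , record
      { sub = insert-least Ie (λ _ ())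
      ; nonempty = e , insert-self e ∅
      ; tight = ≤-trans (≤-reflexive (single e))
          (+-monoˡ-≤ c (∣∣-positive {A = insert e ∅} (e , insert-self e ∅))) }
    , cl⁺ (insert e ∅) e (monotone (insert-least {x = e} (insert-self e ∅) (⊆-refl {A = insert e ∅})))

  -- Uncrossing. The sets must meet, because independence gives its lower bound on `f (A ∩ B)` for a
  -- nonempty intersection only.
  tight-∪ : ∀ {I A B} → Independent I → Tight I A → Tight I B → Nonempty (A ∩ B) → Tight I (A ∪ B)
  tight-∪ {I} {A} {B} ind tA tB ne = record
    { sub = ∪-least (sub tA) (sub tB)
    ; nonempty = proj₁ ne , ∪-left A B _ (∩-left A B _ (proj₂ ne))
    ; tight = +-cancelʳ-≤ (∣ A ∩ B ∣ + c) _ _ (begin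
        f (A ∪ B) + (∣ A ∩ B ∣ + c)
          ≤⟨ +-monoʳ-≤ (f (A ∪ B)) (ind (A ∩ B) (⊆-trans (∩-left A B) (sub tA)) ne) ⟩
        f (A ∪ B) + f (A ∩ B)             ≤⟨ submodular A B ⟩
        f A + f B                         ≤⟨ +-mono-≤ (tight tA) (tight tB) ⟩
        (∣ A ∣ + c) + (∣ B ∣ + c)         ≡⟨ rearrange ∣ A ∣ ∣ B ∣ c ⟩
        (∣ A ∣ + ∣ B ∣) + (c + c)         ≡⟨ cong (_+ (c + c)) (∣∪∣+∣∩∣ A B) ⟨
        (∣ A ∪ B ∣ + ∣ A ∩ B ∣) + (c + c) ≡⟨ rearrange ∣ A ∪ B ∣ ∣ A ∩ B ∣ c ⟨
        (∣ A ∪ B ∣ + c) + (∣ A ∩ B ∣ + c) ∎) }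
    where
    open ≤-Reasoning
    rearrange : ∀ x y z → (x + z) + (y + z) ≡ (x + y) + (z + z)
    rearrange = solve-∀

  -- Edge sets are functions, so the list contains each subset only up to mutual inclusion. This is
  -- enough to decide independence, since size and `f` are monotone.
  subsets : List (Edge n) → List (EdgeSet n)
  subsets []       = ∅ ∷ []
  subsets (e ∷ es) = subsets es ++ map (insert e) (subsets es)

  subsets-sound : ∀ es {J} → J ∈ subsets es → J ⊆ ofList es
  subsets-sound [] (here refl) = ⊆-refl
  subsets-sound (e ∷ es) J∈ with ∈-++⁻ (subsets es) J∈
  ... | inj₁ p = ⊆-trans (subsets-sound es p) (insert-⊇ e (ofList es))
  ... | inj₂ p with ∈-map⁻ (insert e) p
  ...   | K , K∈ , refl = insert-mono e (subsets-sound es K∈)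

  subsets-complete : ∀ es I → I ⊆ ofList es → ∃[ J ] (J ∈ subsets es × J ⊆ I × I ⊆ J)
  subsets-complete [] I I⊆ = ∅ , here refl , (λ _ ()) , I⊆
  subsets-complete (e ∷ es) I I⊆ with T? (I e)
  ... | no ¬Ie with subsets-complete es I shrink
    where
    shrink : I ⊆ ofList es
    shrink x Ix with insert⁻ e (ofList es) x (I⊆ x Ix)
    ... | inj₁ refl = contradiction Ix ¬Ie
    ... | inj₂ h    = h
  ...   | J , J∈ , p , q = J , ∈-++⁺ˡ J∈ , p , q
  subsets-complete (e ∷ es) I I⊆ | yes Ie with subsets-complete es (I ∖ sameEdge e) shrink
    where
    shrink : (I ∖ sameEdge e) ⊆ ofList es
    shrink x h with insert⁻ e (ofList es) x (I⊆ x (∩-left I (not ∘ sameEdge e) x h))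
    ... | inj₁ refl = contradiction (sameEdge-refl e) (not⁻ (∩-right I (not ∘ sameEdge e) e h))
    ... | inj₂ h′   = h′
  ...   | J , J∈ , p , q = insert e J
          , ∈-++⁺ʳ (subsets es) (∈-map⁺ (insert e) J∈)
          , insert-least Ie (⊆-trans p (∩-left I (not ∘ sameEdge e)))
          , grow
    where
    grow : I ⊆ insert e J
    grow x Ix with T? (sameEdge e x)
    ... | yes s = ∨⁺ {sameEdge e x} (inj₁ s)
    ... | no ¬s = insert-⊇ e J x (q x (∧⁺ {I x} Ix (not⁺ ¬s)))

  Violated : EdgeSet n → Set
  Violated I = Nonempty I × f I < ∣ I ∣ + c

  independent-or-violated : ∀ F → (∃[ I ] (I ⊆ F × Violated I)) ⊎ Independent F
  independent-or-violated F with search dec (subsets (elements F))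
    where
    dec : ∀ I → Violated I ⊎ (Nonempty I → ∣ I ∣ + c ≤ f I)
    dec I with nonempty-or-empty I | ∣ I ∣ + c ≤? f I
    ... | _        | yes le = inj₂ (λ _ → le)
    ... | inj₁ ne  | no ≰   = inj₁ (ne , ≰⇒> ≰)
    ... | inj₂ emp | no _   = inj₂ (λ (e , Ie) → contradiction Ie (emp e))
  ... | inj₁ some with find some
  ...   | I , I∈ , v = inj₁ (I
          , (λ e h → elements⁻ F (ofList⁻ (elements F) (subsets-sound (elements F) I∈ e h))) , v)
  independent-or-violated F | inj₂ every = inj₂ check
    where
    check : Independent F
    check I I⊆F (e , Ie) with subsets-complete (elements F) I
                                (λ x Ix → ofList⁺ (elements⁺ F x (I⊆F x Ix)))
    ... | J , J∈ , J⊆I , I⊆J = ≤-trans (+-monoˡ-≤ c (∣∣-mono I⊆J))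
            (≤-trans (All.lookup every J∈ (e , I⊆J e Ie)) (monotone J⊆I))

  -- A violating set K must contain `e`, and dropping `e` costs one element, so f K ≤ |K ∩ I| + c ≤
  -- f (K ∩ I). Hence K ∩ I is tight and has `e` in its closure.
  insert-or-spanned : ∀ I e → Independent I → Independent (insert e I) ⊎ Spanned I e
  insert-or-spanned I e ind with independent-or-violated (insert e I)
  ... | inj₂ ind′ = inj₁ ind′
  ... | inj₁ (K , K⊆ , (x , Kx) , K-bad) with T? (K e)
  ...   | no ¬Ke = contradiction (ind K K⊆I (x , Kx)) (<⇒≱ K-bad)
    where
    K⊆I : K ⊆ I
    K⊆I y Ky with insert⁻ e I y (K⊆ y Ky)
    ... | inj₁ refl = contradiction Ky ¬Ke
    ... | inj₂ Iy   = Iy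
  ...   | yes Ke with nonempty-or-empty (K ∩ I)
  -- Here K is just the edge `e`, which cannot be violating because `f` is `suc c` on a single edge.
  ...     | inj₂ empty = contradiction K-bad (≤⇒≯ (begin
              ∣ K ∣ + c              ≤⟨ +-monoˡ-≤ c (∣∣-mono K⊆e) ⟩
              ∣ insert e ∅ ∣ + c     ≤⟨ +-monoˡ-≤ c (∣insert∣-≤ e ∅) ⟩
              suc ∣ ∅ {n} ∣ + c      ≡⟨ cong (λ m → suc m + c) (∣∅∣ {n}) ⟩
              suc c                  ≡⟨ single e ⟨
              f (insert e ∅)         ≤⟨ monotone (insert-least Ke (λ _ ())) ⟩
              f K                    ∎))
    where
    open ≤-Reasoning
    K⊆e : K ⊆ insert e ∅
    K⊆e y Ky with insert⁻ e I y (K⊆ y Ky)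
    ... | inj₁ refl = insert-self e ∅
    ... | inj₂ Iy   = contradiction (∧⁺ {K y} Ky Iy) (empty y)
  ...     | inj₁ ne = inj₂ (K ∩ I
          , record { sub = ∩-right K I ; nonempty = ne
                   ; tight = ≤-trans (monotone (∩-left K I)) f-K }
          , cl⁺ (K ∩ I) e (≤-trans (monotone (insert-least Ke (∩-left K I)))
              (≤-trans f-K (ind (K ∩ I) (∩-right K I) ne))))
    where
    K⊆′ : K ⊆ insert e (K ∩ I)
    K⊆′ y Ky with insert⁻ e I y (K⊆ y Ky)
    ... | inj₁ refl = insert-self e (K ∩ I)
    ... | inj₂ Iy   = insert-⊇ e (K ∩ I) y (∧⁺ {K y} Ky Iy)
    f-K : f K ≤ ∣ K ∩ I ∣ + c
    f-K = ≤-pred (≤-trans K-bad (+-monoˡ-≤ c (≤-trans (∣∣-mono K⊆′) (∣insert∣-≤ e (K ∩ I)))))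

  independent-∅ : Independent ∅
  independent-∅ I I⊆∅ (e , Ie) = ⊥-elim (I⊆∅ e Ie)

  basis-from : ∀ I es → Independent I →
               ∃[ J ] (I ⊆ J × J ⊆ (I ⊕ es) × Independent J × All (Spanned J) es)
  basis-from I [] ind = I , ⊆-refl , ⊆-refl , ind , []
  basis-from I (e ∷ es) ind with basis-from I es ind
  ... | J , I⊆J , J⊆ , indJ , sp with insert-or-spanned J e indJ
  ...   | inj₂ s   = J , I⊆J , ⊆-trans J⊆ (insert-⊇ e (I ⊕ es)) , indJ , s ∷ sp
  ...   | inj₁ ind′ = insert e J , ⊆-trans I⊆J (insert-⊇ e J) , insert-mono e J⊆ , ind′
          , spanned-self {e = e} (insert-self e J) ∷ All.map (λ {x} → spanned-mono (insert-⊇ e J) {x}) sp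

  basis : ∀ F → ∃[ I ] (I ⊆ F × Independent I × (∀ e → T (F e) → Spanned I e))
  basis F with basis-from ∅ (elements F) independent-∅
  ... | I , _ , I⊆ , ind , sp = I
    , (λ e h → elements⁻ F (ofList⁻ (elements F) (I⊆ e h)))
    , ind , (λ e Fe → All.lookup sp (elements⁺ F e Fe))

  -- Disjoint families of tight sets

  data Packing (I : EdgeSet n) : List (EdgeSet n) → Set where
    []   : Packing I []
    cons : ∀ {A P} → Tight I A → (∀ e → T (A e) → ¬ T (⋃ P e)) → Packing I P → Packing I (A ∷ P)

  Covered : List (EdgeSet n) → Edge n → Set
  Covered P e = Any (λ A → T (cl A e)) P

  -- `cl-mono` keeps covered edges covered when sets are united. The bound on `⋃ Q` is what keeps a
  -- set that is passed over disjoint from the result.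
  merge : ∀ {I A P} → Independent I → Tight I A → Packing I P →
          ∃[ Q ] (Packing I Q × ⋃ Q ⊆ (A ∪ ⋃ P) × (∀ e → Covered (A ∷ P) e → Covered Q e))
  merge {A = A} ind tA [] =
    (A ∷ []) , cons tA (λ _ _ ()) [] , ⊆-refl , (λ _ c → c)
  merge {A = A} {B ∷ P} ind tA (cons tB B# pk) with nonempty-or-empty (A ∩ B)
  ... | inj₁ ne with merge ind (tight-∪ ind tA tB ne) pk
  ...   | Q , pkQ , Q⊆ , cov = Q , pkQ
          , ⊆-trans Q⊆ (∪-least (∪-least (∪-left A (B ∪ ⋃ P))
              (⊆-trans (∪-left B (⋃ P)) (∪-right A (B ∪ ⋃ P))))
              (⊆-trans (∪-right B (⋃ P)) (∪-right A (B ∪ ⋃ P))))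
          , λ { e (here h)          → cov e (here (cl-mono (∪-left A B) e h))
              ; e (there (here h))  → cov e (here (cl-mono (∪-right A B) e h))
              ; e (there (there c)) → cov e (there c) }
  merge {A = A} {B ∷ P} ind tA (cons tB B# pk) | inj₂ disjoint with merge ind tA pk
  ...   | Q , pkQ , Q⊆ , cov = (B ∷ Q) , cons tB B#Q pkQ
          , ∪-least (⊆-trans (∪-left B (⋃ P)) (∪-right A (B ∪ ⋃ P)))
              (⊆-trans Q⊆ (∪-least (∪-left A (B ∪ ⋃ P))
                (⊆-trans (∪-right B (⋃ P)) (∪-right A (B ∪ ⋃ P)))))
          , λ { e (here h)          → there (cov e (here h))
              ; e (there (here h))  → here h
              ; e (there (there c)) → there (cov e (there c)) }
    where
    B#Q : ∀ e → T (B e) → ¬ T (⋃ Q e)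
    B#Q e Be Qe with ∨⁻ {A e} (Q⊆ e Qe)
    ... | inj₁ Ae = disjoint e (∧⁺ {A e} Ae Be)
    ... | inj₂ Pe = B# e Be Pe

  packing : ∀ {I} es → Independent I → All (Spanned I) es → ∃[ P ] (Packing I P × All (Covered P) es)
  packing [] ind [] = [] , [] , []
  packing (e ∷ es) ind ((A , tA , h) ∷ sp) with packing es ind sp
  ... | P , pk , cov with merge ind tA pk
  ...   | Q , pkQ , _ , cov′ = Q , pkQ , cov′ e (here h) ∷ All.map (λ {x} c → cov′ x (there c)) cov

  total : List (EdgeSet n) → ℕ
  total P = sum (map ∣_∣ P)

  packing-total : ∀ {I P} → Packing I P → total P ≤ ∣ I ∣
  packing-total {I} pk = ≤-trans (disjoint-sum pk) (∣∣-mono (inside pk))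
    where
    disjoint-sum : ∀ {P} → Packing I P → total P ≤ ∣ ⋃ P ∣
    disjoint-sum [] = z≤n
    disjoint-sum (cons {A} {P} _ A# pk) = ≤-trans (+-monoʳ-≤ ∣ A ∣ (disjoint-sum pk))
      (≤-reflexive (count-disjoint A (⋃ P) A# (allEdges n)))
    inside : ∀ {P} → Packing I P → ⋃ P ⊆ I
    inside []             = λ _ ()
    inside (cons t _ pk) = ∪-least (sub t) (inside pk)

  coverage : List (EdgeSet n) → EdgeSet n
  coverage P = ⋃ (map cl P)

  covered⇒coverage : ∀ {P e} → Covered P e → T (coverage P e)
  covered⇒coverage {A ∷ P} {e} (here h)  = ∪-left (cl A) (coverage P) e h
  covered⇒coverage {A ∷ P} {e} (there c) = ∪-right (cl A) (coverage P) e (covered⇒coverage c)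

  -- Inside one closure, |J ∩ cl A| + c ≤ f (cl A) ≤ f A ≤ |A| + c, so `J` has no more edges there
  -- than the tight set itself.
  independent-≤-packing : ∀ {I J P} → Packing I P → Independent J → ∣ J ∩ coverage P ∣ ≤ total P
  independent-≤-packing {J = J} [] indJ =
    ≤-trans (∣∣-mono (∩-right J ∅)) (≤-reflexive (∣∅∣ {n}))
  independent-≤-packing {J = J} (cons {A} {P} t _ pk) indJ = begin
    ∣ J ∩ (cl A ∪ coverage P) ∣           ≤⟨ ∣∣-mono split ⟩
    ∣ (J ∩ cl A) ∪ (J ∩ coverage P) ∣     ≤⟨ ∣∪∣-≤ (J ∩ cl A) (J ∩ coverage P) ⟩
    ∣ J ∩ cl A ∣ + ∣ J ∩ coverage P ∣     ≤⟨ +-mono-≤ one (independent-≤-packing pk indJ) ⟩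
    ∣ A ∣ + total P                       ∎
    where
    open ≤-Reasoning
    split : (J ∩ (cl A ∪ coverage P)) ⊆ ((J ∩ cl A) ∪ (J ∩ coverage P))
    split e h with ∧⁻ {J e} h
    ... | Je , h′ with ∨⁻ {cl A e} h′
    ...   | inj₁ q = ∪-left (J ∩ cl A) (J ∩ coverage P) e (∧⁺ {J e} Je q)
    ...   | inj₂ q = ∪-right (J ∩ cl A) (J ∩ coverage P) e (∧⁺ {J e} Je q)
    one : ∣ J ∩ cl A ∣ ≤ ∣ A ∣
    one with nonempty-or-empty (J ∩ cl A)
    ... | inj₂ empty = ≤-trans (≤-reflexive (count-none empty (allEdges n))) z≤n
    ... | inj₁ ne    = +-cancelʳ-≤ c _ _ (begin
      ∣ J ∩ cl A ∣ + c ≤⟨ indJ (J ∩ cl A) (∩-left J (cl A)) ne ⟩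
      f (J ∩ cl A)     ≤⟨ monotone (∩-right J (cl A)) ⟩
      f (cl A)         ≤⟨ f-cl A ⟩
      f A              ≤⟨ tight t ⟩
      ∣ A ∣ + c        ∎)

  -- This exchange bound gives both the augmentation axiom and the fact that a basis of `F` has the
  -- size of the rank.
  spanned-bound : ∀ {I J} → Independent I → Independent J → (∀ e → T (J e) → Spanned I e) →
                  ∣ J ∣ ≤ ∣ I ∣
  spanned-bound {I} {J} indI indJ sp
    with packing (elements J) indI (All.tabulate (λ e∈ → sp _ (elements⁻ J e∈)))
  ... | P , pk , cov = ≤-trans
    (∣∣-mono (λ e Je → ∧⁺ {J e} Je (covered⇒coverage (All.lookup cov (elements⁺ J e Je)))))
    (≤-trans (independent-≤-packing pk indJ) (packing-total pk))

  isMatroid-Independent : IsMatroid Independent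
  isMatroid-Independent = record
    { ind-∅   = independent-∅
    ; ind-sub = λ I J J⊆I ind K K⊆J → ind K (⊆-trans K⊆J J⊆I)
    ; ind-aug = aug
    }
    where
    aug : ∀ I J → Independent I → Independent J → ∣ I ∣ < ∣ J ∣ →
          ∃[ e ] (T (J e) × ¬ T (I e) × Independent (insert e I))
    aug I J indI indJ I<J with search dec (elements J)
      where
      dec : ∀ e → (¬ T (I e) × Independent (insert e I)) ⊎ Spanned I e
      dec e with T? (I e) | insert-or-spanned I e indI
      ... | yes Ie | _        = inj₂ (spanned-self Ie)
      ... | no ¬Ie | inj₁ ind = inj₁ (¬Ie , ind)
      ... | no _   | inj₂ s   = inj₂ s
    ... | inj₁ some with find some
    ...   | e , e∈ , ¬Ie , ind = e , elements⁻ J e∈ , ¬Ie , ind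
    aug I J indI indJ I<J | inj₂ every = contradiction I<J (≤⇒≯
      (spanned-bound indI indJ (λ e Je → All.lookup every (elements⁺ J e Je))))

  -- The combinatorial property of the patterns behind the rank formula. For a tight `A` the cost is
  -- at most the size of `A`, so a packing inside a basis costs no more than the basis.
  Generates : List Pattern → Set
  Generates H = ∀ A → Nonempty A → ∀ {U j} → Generated H U j →
                ∃[ U′ ] (U ⊆ U′ × cl A ⊆ U′ × Generated H U′ (j + (f A ∸ c)))

  generate-basis : ∀ {H} → Generates H → ∀ {F I} → Independent I → (∀ e → T (F e) → Spanned I e) →
                   ∃[ U ] (F ⊆ U × Generated H U ∣ I ∣)
  generate-basis {H} gen {F} {I} indI sp
    with packing (elements F) indI (All.tabulate (λ e∈ → sp _ (elements⁻ F e∈)))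
  ... | P , pk , cov with go pk
    where
    go : ∀ {P} → Packing I P → ∃[ U ] (coverage P ⊆ U × Generated H U (total P))
    go [] = ∅ , (λ _ ()) , generated-∅
    go (cons {A} {P} t _ pk) with go pk
    ... | U , P⊆U , G with gen A (nonempty t) G
    ...   | U′ , U⊆U′ , A⊆U′ , G′ = U′ , ∪-least A⊆U′ (⊆-trans P⊆U U⊆U′)
            , generated-weaken (≤-trans (+-monoʳ-≤ (total P)
                (≤-trans (∸-monoˡ-≤ c (tight t)) (≤-reflexive (m+n∸n≡m ∣ A ∣ c))))
                (≤-reflexive (+-comm (total P) ∣ A ∣))) G′
  ...   | U , P⊆U , G = U
          , (λ e Fe → P⊆U e (covered⇒coverage (All.lookup cov (elements⁺ F e Fe))))
          , generated-weaken (packing-total pk) G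

-- Growing complete and complete bipartite graphs

module _ {n : ℕ} where

  Has : EdgeSet n → Fin n → Fin n → Set
  Has U x y = ⟦ x , y ⟧ ⊆ U

  has-sym : ∀ {U x y} → Has U x y → Has U y x
  has-sym h e j = h e (joins-sym e j)

  has-refl : ∀ {U x} → Has U x x
  has-refl e j = ⊥-elim (joins-irrefl e j)

  copy-⊆ : ∀ G (φ : Fin (k G) → Fin n) {U} →
           All (λ p → Has U (φ (proj₁ p)) (φ (proj₂ p))) (pedges G) → copyEdges G φ ⊆ U
  copy-⊆ G φ h e c with any-elim (λ p → joins e (φ (proj₁ p)) (φ (proj₂ p))) (pedges G) c
  ... | p , p∈ , j = All.lookup h p∈ e j

  copy-⊇ : ∀ G (φ : Fin (k G) → Fin n) {p} → p ∈ pedges G →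
           Has (copyEdges G φ) (φ (proj₁ p)) (φ (proj₂ p))
  copy-⊇ G φ p∈ e j = any-intro (λ p → joins e (φ (proj₁ p)) (φ (proj₂ p))) p∈ j

  lookup-injective : ∀ {m} {xs : Vec (Fin n) m} → VUnique.Unique xs → Injective _≡_ _≡_ (Vec.lookup xs)
  lookup-injective u {i} {j} = VUniqueₚ.lookup-injective u i j

  -- The two lists may overlap, since the diagonal asks for nothing; `Complete U D D` says that `D`
  -- is a clique.
  Complete : EdgeSet n → List (Fin n) → List (Fin n) → Set
  Complete U A B = ∀ x y → x ∈ A → y ∈ B → Has U x y

  complete-mono : ∀ {U U′ A B} → U ⊆ U′ → Complete U A B → Complete U′ A B
  complete-mono U⊆U′ c x y x∈ y∈ = ⊆-trans (c x y x∈ y∈) U⊆U′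

  complete-sym : ∀ {U A B} → Complete U A B → Complete U B A
  complete-sym c x y x∈ y∈ = has-sym (c y x y∈ x∈)

  complete-∷ : ∀ {U z A B} → Complete U (z ∷ []) B → Complete U A B → Complete U (z ∷ A) B
  complete-∷ s c x y (here refl) = s x y (here refl)
  complete-∷ s c x y (there x∈)  = c x y x∈

  clique-∷ : ∀ {U z D} → Complete U (z ∷ []) D → Complete U D D → Complete U (z ∷ D) (z ∷ D)
  clique-∷ s c x y (here refl) (here refl) = has-refl
  clique-∷ s c x y (here refl) (there y∈)  = s x y (here refl) y∈
  clique-∷ s c x y (there x∈)  (here refl) = has-sym (s y x (here refl) x∈)
  clique-∷ s c x y (there x∈)  (there y∈)  = c x y x∈ y∈

module Growth {n : ℕ} (H : List Pattern) where

  -- U can be enlarged to a set satisfying Q at the cost of m on the rank.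
  Grow : EdgeSet n → ℕ → (EdgeSet n → Set) → Set
  Grow U m Q = ∃[ U′ ] (U ⊆ U′ × Q U′ × (∀ {j} → Generated H U j → Generated H U′ (m + j)))

  grow-weaken : ∀ {U l m} {Q R : EdgeSet n → Set} → l ≤ m → (∀ {U′} → Q U′ → R U′) →
                Grow U l Q → Grow U m R
  grow-weaken l≤m QR (U′ , s , q , g) =
    U′ , s , QR q , λ {j} G → generated-weaken (+-monoˡ-≤ j l≤m) (g G)

  grow-refl : ∀ {U} {Q : EdgeSet n → Set} → Q U → Grow U 0 Q
  grow-refl {U} q = U , ⊆-refl , q , id

  grow-bind : ∀ {U l m} {Q R : EdgeSet n → Set} → Grow U l Q →
              (∀ {U′} → U ⊆ U′ → Q U′ → Grow U′ m R) → Grow U (l + m) R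
  grow-bind {l = l} {m} (U′ , s , q , g) k with k s q
  ... | U″ , s′ , r , g′ = U″ , ⊆-trans s s′ , r , λ {j} G →
    generated-weaken (≤-reflexive (trans (sym (+-assoc m l j)) (cong (_+ j) (+-comm m l)))) (g′ (g G))

  free-star : ∀ U z Q → Grow U (length Q) (λ U′ → Complete U′ (z ∷ []) Q)
  free-star U z [] = grow-refl (λ _ _ _ ())
  free-star U z (q ∷ Q) with free-star (U ∪ ⟦ z , q ⟧) z Q
  ... | U′ , s , c , g = U′ , ⊆-trans (∪-left U ⟦ z , q ⟧) s , star
      , λ {j} G → generated-weaken (≤-reflexive (+-suc (length Q) j)) (g (add-free z q G))
    where
    star : Complete U′ (z ∷ []) (q ∷ Q)
    star x y (here refl) (here refl) = ⊆-trans (∪-right U ⟦ z , q ⟧) s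
    star x y (here refl) (there y∈)  = c x y (here refl) y∈

  -- Each copy uses only the original `U` and its own new edge, so the edges can be added in turn
  -- without disturbing the copies still to come.
  step-star : ∀ U z Q →
    (∀ {q} → q ∈ Q → ∃[ X ] (InX H X × Has X z q × X ⊆ (U ∪ ⟦ z , q ⟧))) →
    Grow U 0 (λ U′ → Complete U′ (z ∷ []) Q)
  step-star U z [] _ = grow-refl (λ _ _ _ ())
  step-star U z (q ∷ Q) steps with step-star (U ∪ ⟦ z , q ⟧) z Q steps′
    where
    steps′ : ∀ {q′} → q′ ∈ Q → ∃[ X ] (InX H X × Has X z q′ × X ⊆ ((U ∪ ⟦ z , q ⟧) ∪ ⟦ z , q′ ⟧))
    steps′ {q′} q∈ with steps (there q∈)
    ... | X , X∈ , has , X⊆ = X , X∈ , has , ⊆-trans X⊆ (∪-least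
            (⊆-trans (∪-left U ⟦ z , q ⟧) (∪-left (U ∪ ⟦ z , q ⟧) ⟦ z , q′ ⟧))
            (∪-right (U ∪ ⟦ z , q ⟧) ⟦ z , q′ ⟧))
  ... | U′ , s , c , g with steps (here refl)
  ...   | X , X∈ , has , X⊆ = U′ , ⊆-trans (∪-left U ⟦ z , q ⟧) s , star
          , λ G → g (add-step z q X∈ X⊆ has G)
    where
    star : Complete U′ (z ∷ []) (q ∷ Q)
    star x y (here refl) (here refl) = ⊆-trans (∪-right U ⟦ z , q ⟧) s
    star x y (here refl) (there y∈)  = c x y (here refl) y∈

  free-bipartite : ∀ U A B → Grow U (length A * length B) (λ U′ → Complete U′ A B)
  free-bipartite U [] B = grow-refl (λ _ _ ())
  free-bipartite U (z ∷ A) B = grow-bind (free-star U z B) λ _ star →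
    bind star (free-bipartite _ A B)
    where
    bind : ∀ {U′ m} → Complete U′ (z ∷ []) B → Grow U′ m (λ U″ → Complete U″ A B) →
           Grow U′ m (λ U″ → Complete U″ (z ∷ A) B)
    bind star (U″ , s , c , g) = U″ , s , complete-∷ (complete-mono s star) c , g

  triangular : ℕ → ℕ
  triangular zero    = 0
  triangular (suc m) = m + triangular m

  free-clique : ∀ U D → Grow U (triangular (length D)) (λ U′ → Complete U′ D D)
  free-clique U [] = grow-refl (λ _ _ ())
  free-clique U (z ∷ D) = grow-bind (free-star U z D) λ _ star → bind star (free-clique _ D)
    where
    bind : ∀ {U′ m} → Complete U′ (z ∷ []) D → Grow U′ m (λ U″ → Complete U″ D D) →
           Grow U′ m (λ U″ → Complete U″ (z ∷ D) (z ∷ D))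
    bind star (U″ , s , c , g) = U″ , s , clique-∷ (complete-mono s star) c , g

Apart : {A : Set} → List A → List A → Set
Apart A B = ∀ x y → x ∈ A → y ∈ B → x ≢ y

-- Complete graphs generated by four-cycles

module EvenCycle {n : ℕ} where

  H : List Pattern
  H = C₄ ∷ []

  open Growth {n} H

  cycle-step : ∀ {U} {z q x q′ : Fin n} → VUnique.Unique (z ∷ q ∷ x ∷ q′ ∷ []) →
               Has U z q → Has U q x → Has U x q′ →
               ∃[ X ] (InX H X × Has X z q′ × X ⊆ (U ∪ ⟦ z , q′ ⟧))
  cycle-step {U} {z} {q} {x} {q′} u zq qx xq′ = copyEdges C₄ φ
    , here (φ , lookup-injective u , λ _ → refl)
    , has-sym (copy-⊇ C₄ φ (there (there (there (here refl)))))
    , copy-⊆ C₄ φ (up zq ∷ up qx ∷ up xq′ ∷ has-sym (∪-right U ⟦ z , q′ ⟧) ∷ [])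
    where
    φ = Vec.lookup (z ∷ q ∷ x ∷ q′ ∷ [])
    up : ∀ {a b} → Has U a b → Has (U ∪ ⟦ z , q′ ⟧) a b
    up h = ⊆-trans h (∪-left U ⟦ z , q′ ⟧)

  -- The paid edges form a spanning tree. A new vertex `z` pays for zq, and every other zq′ closes
  -- the four-cycle z q p q′ through the old vertex `p`.
  bipartite : ∀ U A B → Unique A → Unique B → Apart A B →
              Grow U (length A + length B ∸ 1) (λ U′ → Complete U′ A B)
  bipartite U [] B _ _ _ = grow-weaken z≤n id (grow-refl (λ _ _ ()))
  bipartite U (z ∷ []) B _ _ _ = free-star U z B
  bipartite U (z ∷ p ∷ P) [] _ _ _ = grow-weaken z≤n id (grow-refl (λ _ _ _ ()))
  bipartite U (z ∷ p ∷ P) (q ∷ Q) uA@((z≢p ∷ _) ∷ uP) uB@(q∉ ∷ _) A#B =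
    grow-weaken (≤-reflexive (+-comm (length P + suc (length Q)) 1)) id
      (grow-bind (bipartite U (p ∷ P) (q ∷ Q) uP uB (λ x y x∈ → A#B x y (there x∈))) λ _ old →
       grow-bind (free-star _ z (q ∷ [])) λ s₁ zq →
       finish (complete-mono s₁ old) (zq z q (here refl) (here refl)))
    where
    finish : ∀ {U} → Complete U (p ∷ P) (q ∷ Q) → Has U z q →
             Grow U 0 (λ U′ → Complete U′ (z ∷ p ∷ P) (q ∷ Q))
    finish {U} old zq with step-star U z Q (λ {q′} q′∈ → cycle-step
        ((A#B z q (here refl) (here refl) ∷ z≢p ∷ A#B z q′ (here refl) (there q′∈) ∷ [])
         ∷ (A#B p q (there (here refl)) (here refl) ∘ sym ∷ All.lookup q∉ q′∈ ∷ [])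
         ∷ (A#B p q′ (there (here refl)) (there q′∈) ∷ [])
         ∷ [] ∷ [])
        zq (has-sym (old p q (here refl) (here refl))) (old p q′ (here refl) (there q′∈)))
    ... | U′ , s , c , g = U′ , s , complete-∷ star (complete-mono s old) , g
      where
      star : Complete U′ (z ∷ []) (q ∷ Q)
      star x y (here refl) (here refl) = ⊆-trans zq s
      star x y (here refl) (there y∈)  = c x y (here refl) y∈

  -- After a paid triangle, each new vertex pays for one edge. The four-cycle z d₁ x d needs an `x`
  -- apart from `d₁` and `d`, hence three old vertices.
  clique : ∀ U D → Unique D → Grow U (length D) (λ U′ → Complete U′ D D)
  clique U D@[] _               = free-clique U D
  clique U D@(_ ∷ []) _         = grow-weaken z≤n id (free-clique U D)
  clique U D@(_ ∷ _ ∷ []) _     = grow-weaken (s≤s z≤n) id (free-clique U D)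
  clique U D@(_ ∷ _ ∷ _ ∷ []) _ = free-clique U D
  clique U (z ∷ d₁ ∷ d₂ ∷ d₃ ∷ ds) ((z≢d₁ ∷ z≢d₂ ∷ z≢d₃ ∷ z∉) ∷ u@(d₁∉@(d₁≢d₂ ∷ d₁≢d₃ ∷ _) ∷ d₂∉ ∷ _)) =
    grow-weaken (≤-reflexive (+-comm (3 + length ds) 1)) id
      (grow-bind (clique U (d₁ ∷ d₂ ∷ d₃ ∷ ds) u) λ _ old →
       grow-bind (free-star _ z (d₁ ∷ [])) λ s₁ zd →
       finish (complete-mono s₁ old) (zd z d₁ (here refl) (here refl)))
    where
    D = d₂ ∷ d₃ ∷ ds
    other : ∀ {d} → d ∈ D → ∃[ x ] (x ∈ D × z ≢ x × d₁ ≢ x × x ≢ d)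
    other (here refl) = d₃ , there (here refl) , z≢d₃ , d₁≢d₃ , All.head d₂∉ ∘ sym
    other (there d∈)  = d₂ , here refl , z≢d₂ , d₁≢d₂ , All.lookup d₂∉ d∈
    finish : ∀ {U} → Complete U (d₁ ∷ D) (d₁ ∷ D) → Has U z d₁ →
             Grow U 0 (λ U′ → Complete U′ (z ∷ d₁ ∷ D) (z ∷ d₁ ∷ D))
    finish {U} old zd₁ with step-star U z D (λ {d} d∈ →
        let x , x∈ , z≢x , d₁≢x , x≢d = other d∈ in cycle-step
        ((z≢d₁ ∷ z≢x ∷ All.lookup (z≢d₂ ∷ z≢d₃ ∷ z∉) d∈ ∷ [])
         ∷ (d₁≢x ∷ All.lookup d₁∉ d∈ ∷ []) ∷ (x≢d ∷ []) ∷ [] ∷ [])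
        zd₁ (old d₁ x (here refl) (there x∈)) (old x d (there x∈) (there d∈)))
    ... | U′ , s , c , g = U′ , s , clique-∷ star (complete-mono s old) , g
      where
      star : Complete U′ (z ∷ []) (d₁ ∷ D)
      star x y (here refl) (here refl) = ⊆-trans zd₁ s
      star x y (here refl) (there y∈)  = c x y (here refl) y∈

-- Complete graphs generated by `K₅⁻` and `K₃₄`

module TwoOneTwo {n : ℕ} where

  H : List Pattern
  H = K₅⁻ ∷ K₃₄ ∷ []

  open Growth {n} H

  -- `z` and `w` take the two nonadjacent places of `K₅⁻`, so the edge zw need not be present.
  K₅⁻-step : ∀ {U} {d₁ d₂ d z w : Fin n} → VUnique.Unique (d₁ ∷ d₂ ∷ d ∷ z ∷ w ∷ []) →
             Has U d₁ d₂ → Has U d₁ d → Has U d₁ z → Has U d₁ w →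
             Has U d₂ d → Has U d₂ z → Has U d₂ w → Has U d w →
             ∃[ X ] (InX H X × Has X z d × X ⊆ (U ∪ ⟦ z , d ⟧))
  K₅⁻-step {U} {d₁} {d₂} {d} {z} {w} u h₀₁ h₀₂ h₀₃ h₀₄ h₁₂ h₁₃ h₁₄ h₂₄ = copyEdges K₅⁻ φ
    , here (φ , lookup-injective u , λ _ → refl)
    , has-sym (copy-⊇ K₅⁻ φ (there (there (there (there (there (there (there (here refl)))))))))
    , copy-⊆ K₅⁻ φ (up h₀₁ ∷ up h₀₂ ∷ up h₀₃ ∷ up h₀₄ ∷ up h₁₂ ∷ up h₁₃ ∷ up h₁₄
        ∷ has-sym (∪-right U ⟦ z , d ⟧) ∷ up h₂₄ ∷ [])
    where
    φ = Vec.lookup (d₁ ∷ d₂ ∷ d ∷ z ∷ w ∷ [])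
    up : ∀ {a b} → Has U a b → Has (U ∪ ⟦ z , d ⟧) a b
    up h = ⊆-trans h (∪-left U ⟦ z , d ⟧)

  K₃₄-step : ∀ {U} {q₁ q₂ q z p₁ p₂ p₃ : Fin n} →
             VUnique.Unique (q₁ ∷ q₂ ∷ q ∷ z ∷ p₁ ∷ p₂ ∷ p₃ ∷ []) →
             Complete U (z ∷ p₁ ∷ p₂ ∷ p₃ ∷ []) (q₁ ∷ q₂ ∷ []) → Complete U (p₁ ∷ p₂ ∷ p₃ ∷ []) (q ∷ []) →
             ∃[ X ] (InX H X × Has X z q × X ⊆ (U ∪ ⟦ z , q ⟧))
  K₃₄-step {U} {q₁} {q₂} {q} {z} {p₁} {p₂} {p₃} u c c′ = copyEdges K₃₄ φ
    , there (here (φ , lookup-injective u , λ _ → refl))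
    , has-sym (copy-⊇ K₃₄ φ (there (there (there (there (there (there (there (there (here refl))))))))))
    , copy-⊆ K₃₄ φ
        ( old #0 #0 ∷ old #1 #0 ∷ old #2 #0 ∷ old #3 #0
        ∷ old #0 #1 ∷ old #1 #1 ∷ old #2 #1 ∷ old #3 #1
        ∷ has-sym (∪-right U ⟦ z , q ⟧) ∷ new #0 ∷ new #1 ∷ new #2 ∷ [])
    where
    φ = Vec.lookup (q₁ ∷ q₂ ∷ q ∷ z ∷ p₁ ∷ p₂ ∷ p₃ ∷ [])
    #0 : ∀ {x : Fin n} {xs} → x ∈ x ∷ xs
    #0 = here refl
    #1 : ∀ {x y : Fin n} {xs} → x ∈ y ∷ x ∷ xs
    #1 = there #0
    #2 : ∀ {x y y′ : Fin n} {xs} → x ∈ y ∷ y′ ∷ x ∷ xs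
    #2 = there #1
    #3 : ∀ {x y y′ y″ : Fin n} {xs} → x ∈ y ∷ y′ ∷ y″ ∷ x ∷ xs
    #3 = there #2
    up : ∀ {a b} → Has U a b → Has (U ∪ ⟦ z , q ⟧) a b
    up h = ⊆-trans h (∪-left U ⟦ z , q ⟧)
    old : ∀ {x y} → x ∈ z ∷ p₁ ∷ p₂ ∷ p₃ ∷ [] → y ∈ q₁ ∷ q₂ ∷ [] → Has (U ∪ ⟦ z , q ⟧) y x
    old x∈ y∈ = up (has-sym (c _ _ x∈ y∈))
    new : ∀ {x} → x ∈ p₁ ∷ p₂ ∷ p₃ ∷ [] → Has (U ∪ ⟦ z , q ⟧) q x
    new x∈ = up (has-sym (c′ _ _ x∈ (here refl)))

  private
    cost-step : ∀ k → 2 ≤ k → (2 * k ∸ 3) + 2 ≡ 2 * suc k ∸ 3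
    cost-step (suc zero) (s≤s ())
    cost-step (suc (suc j)) _ = trans (cong (_+ 2) (cong (_∸ 3) (lhs j)))
      (trans (+-comm (1 + 2 * j) 2) (cong (_∸ 3) (sym (rhs j))))
      where
      lhs : ∀ j → 2 * (2 + j) ≡ 3 + (1 + 2 * j)
      lhs = solve-∀
      rhs : ∀ j → 2 * (3 + j) ≡ 3 + (3 + 2 * j)
      rhs = solve-∀

    cost-comm : ∀ (A B : List (Fin n)) → 2 * (length A + length B) ∸ 3 ≤ 2 * (length B + length A) ∸ 3
    cost-comm A B = ≤-reflexive (cong (λ m → 2 * m ∸ 3) (+-comm (length A) (length B)))

    -- When one side has at most two vertices, the complete bipartite graph has so few edges that
    -- all of them can be paid for.
    small-cost : ∀ {x} → x ≤ 2 → ∀ y → x * y ≤ 2 * (x + y) ∸ 3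
    small-cost {0} _ y = z≤n
    small-cost {1} _ zero = z≤n
    small-cost {1} _ (suc m) = ≤-trans (s≤s (+-monoʳ-≤ m (z≤n {m + 0})))
      (≤-reflexive (cong (_∸ 3) (sym (double m))))
      where
      double : ∀ m → 2 * (1 + suc m) ≡ 3 + (1 + 2 * m)
      double = solve-∀
    small-cost {2} _ y = ≤-trans (n≤1+n (2 * y)) (≤-reflexive (cong (_∸ 3) (sym (double y))))
      where
      double : ∀ y → 2 * (2 + y) ≡ 3 + (1 + 2 * y)
      double = solve-∀
    small-cost {suc (suc (suc _))} (s≤s (s≤s ()))

  -- `z` pays for its edges to `q₁` and `q₂`. Every further zq completes a `K₃₄` with `q₁`, `q₂`, q
  -- on one side and `z` with three old vertices on the other.
  add-vertex : ∀ {U z p₁ p₂ p₃ q₁ q₂ P Q} → Unique (z ∷ p₁ ∷ p₂ ∷ p₃ ∷ P) → Unique (q₁ ∷ q₂ ∷ Q) →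
               Apart (z ∷ p₁ ∷ p₂ ∷ p₃ ∷ P) (q₁ ∷ q₂ ∷ Q) →
               Complete U (p₁ ∷ p₂ ∷ p₃ ∷ P) (q₁ ∷ q₂ ∷ Q) →
               Grow U 2 (λ U′ → Complete U′ (z ∷ p₁ ∷ p₂ ∷ p₃ ∷ P) (q₁ ∷ q₂ ∷ Q))
  add-vertex {U} {z} {p₁} {p₂} {p₃} {q₁} {q₂} {P} {Q}
    ((z≢p₁ ∷ z≢p₂ ∷ z≢p₃ ∷ _) ∷ (p₁≢p₂ ∷ p₁≢p₃ ∷ _) ∷ (p₂≢p₃ ∷ _) ∷ _)
    ((q₁≢q₂ ∷ q₁∉) ∷ q₂∉ ∷ _) apart old =
    grow-bind (free-star U z (q₁ ∷ q₂ ∷ [])) λ s new₂ → finish (complete-mono s old) new₂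
    where
    Ps = p₁ ∷ p₂ ∷ p₃ ∷ []
    into : ∀ {x} → x ∈ Ps → x ∈ p₁ ∷ p₂ ∷ p₃ ∷ P
    into (here p)                 = here p
    into (there (here p))         = there (here p)
    into (there (there (here p))) = there (there (here p))
    qs : ∀ {x} → x ∈ q₁ ∷ q₂ ∷ [] → x ∈ q₁ ∷ q₂ ∷ Q
    qs (here p)         = here p
    qs (there (here p)) = there (here p)
    away : ∀ {x y} → x ∈ z ∷ p₁ ∷ p₂ ∷ p₃ ∷ P → y ∈ q₁ ∷ q₂ ∷ Q → y ≢ x
    away x∈ y∈ eq = apart _ _ x∈ y∈ (sym eq)
    unique : ∀ {q} → q ∈ Q → VUnique.Unique (q₁ ∷ q₂ ∷ q ∷ z ∷ p₁ ∷ p₂ ∷ p₃ ∷ [])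
    unique q∈ =
      (q₁≢q₂ ∷ All.lookup q₁∉ q∈ ∷ row (here refl))
      ∷ (All.lookup q₂∉ q∈ ∷ row (there (here refl)))
      ∷ row (there (there q∈))
      ∷ (z≢p₁ ∷ z≢p₂ ∷ z≢p₃ ∷ []) ∷ (p₁≢p₂ ∷ p₁≢p₃ ∷ []) ∷ (p₂≢p₃ ∷ []) ∷ [] ∷ []
      where
      row : ∀ {y} → y ∈ q₁ ∷ q₂ ∷ Q → VAll.All (y ≢_) (z ∷ p₁ ∷ p₂ ∷ p₃ ∷ [])
      row y∈ = away (here refl) y∈ ∷ away (there (here refl)) y∈
             ∷ away (there (there (here refl))) y∈ ∷ away (there (there (there (here refl)))) y∈ ∷ []
    finish : ∀ {U} → Complete U (p₁ ∷ p₂ ∷ p₃ ∷ P) (q₁ ∷ q₂ ∷ Q) → Complete U (z ∷ []) (q₁ ∷ q₂ ∷ []) →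
             Grow U 0 (λ U′ → Complete U′ (z ∷ p₁ ∷ p₂ ∷ p₃ ∷ P) (q₁ ∷ q₂ ∷ Q))
    finish {U} old new₂ with step-star U z Q (λ {q} q∈ → K₃₄-step (unique q∈)
        (complete-∷ new₂ (λ x y x∈ y∈ → old x y (into x∈) (qs y∈)))
        (λ { x y x∈ (here refl) → old x y (into x∈) (there (there q∈)) }))
    ... | U′ , s , c , g = U′ , s , complete-∷ star (complete-mono s old) , g
      where
      star : Complete U′ (z ∷ []) (q₁ ∷ q₂ ∷ Q)
      star x y x∈ (here refl)         = ⊆-trans (new₂ x y x∈ (here refl)) s
      star x y x∈ (there (here refl)) = ⊆-trans (new₂ x y x∈ (there (here refl))) s
      star x y x∈ (there (there y∈))  = c x y x∈ y∈

  bipartite-large : ∀ {U a₁ a₂ a₃ b₁ b₂ b₃} A B →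
    Unique (a₁ ∷ a₂ ∷ a₃ ∷ A) → Unique (b₁ ∷ b₂ ∷ b₃ ∷ B) → Apart (a₁ ∷ a₂ ∷ a₃ ∷ A) (b₁ ∷ b₂ ∷ b₃ ∷ B) →
    Grow U (2 * ((3 + length A) + (3 + length B)) ∸ 3)
           (λ U′ → Complete U′ (a₁ ∷ a₂ ∷ a₃ ∷ A) (b₁ ∷ b₂ ∷ b₃ ∷ B))
  -- K₃,₃ has 9 = 2 · 6 - 3 edges, all of them paid.
  bipartite-large {U} {a₁} {a₂} {a₃} {b₁} {b₂} {b₃} [] [] _ _ _ =
    free-bipartite U (a₁ ∷ a₂ ∷ a₃ ∷ []) (b₁ ∷ b₂ ∷ b₃ ∷ [])
  bipartite-large {U} {a₁} {a₂} {a₃} {z} {b₁} {b₂} [] (b₃ ∷ B) uA uB@(_ ∷ uB′) apart =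
    grow-weaken (≤-reflexive (cost-step (6 + length B) (s≤s (s≤s z≤n)))) complete-sym
      (grow-bind (bipartite-large [] B uA uB′ (λ x y x∈ y∈ → apart x y x∈ (there y∈))) λ _ old →
       add-vertex uB uA (λ x y x∈ y∈ eq → apart y x y∈ x∈ (sym eq)) (complete-sym old))
  bipartite-large {U} {z} {a₁} {a₂} (a₃ ∷ A) B uA@(_ ∷ uA′) uB apart =
    grow-weaken (≤-reflexive (cost-step ((3 + length A) + (3 + length B)) (s≤s (s≤s z≤n)))) id
      (grow-bind (bipartite-large A B uA′ uB (λ x y x∈ → apart x y (there x∈))) λ _ old →
       add-vertex uA uB apart old)

  bipartite : ∀ U A B → Unique A → Unique B → Apart A B →
              Grow U (2 * (length A + length B) ∸ 3) (λ U′ → Complete U′ A B)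
  bipartite U (a₁ ∷ a₂ ∷ a₃ ∷ A) (b₁ ∷ b₂ ∷ b₃ ∷ B) uA uB apart = bipartite-large A B uA uB apart
  bipartite U A@[] B _ _ _ = grow-weaken (small-cost z≤n (length B)) id (free-bipartite U A B)
  bipartite U A@(_ ∷ []) B _ _ _ =
    grow-weaken (small-cost (s≤s z≤n) (length B)) id (free-bipartite U A B)
  bipartite U A@(_ ∷ _ ∷ []) B _ _ _ =
    grow-weaken (small-cost (s≤s (s≤s z≤n)) (length B)) id (free-bipartite U A B)
  bipartite U A@(_ ∷ _ ∷ _ ∷ _) B@[] _ _ _ =
    grow-weaken (≤-trans (small-cost z≤n (length A)) (cost-comm B A)) complete-sym
      (free-bipartite U B A)
  bipartite U A@(_ ∷ _ ∷ _ ∷ _) B@(_ ∷ []) _ _ _ =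
    grow-weaken (≤-trans (small-cost (s≤s z≤n) (length A)) (cost-comm B A)) complete-sym
      (free-bipartite U B A)
  bipartite U A@(_ ∷ _ ∷ _ ∷ _) B@(_ ∷ _ ∷ []) _ _ _ =
    grow-weaken (≤-trans (small-cost (s≤s (s≤s z≤n)) (length A)) (cost-comm B A)) complete-sym
      (free-bipartite U B A)

  -- A new vertex `z` pays for its edges to `d₁` and `d₂`; each further zd completes a `K₅⁻` with
  -- another old vertex `w`. Four old vertices are therefore needed.
  clique : ∀ U D → Unique D → Grow U (2 * length D ∸ 2) (λ U′ → Complete U′ D D)
  clique U D@[] _                   = free-clique U D
  clique U D@(_ ∷ []) _             = free-clique U D
  clique U D@(_ ∷ _ ∷ []) _         = grow-weaken (s≤s z≤n) id (free-clique U D)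
  clique U D@(_ ∷ _ ∷ _ ∷ []) _     = grow-weaken (s≤s (s≤s (s≤s z≤n))) id (free-clique U D)
  -- K₄ has 6 = 2 · 4 - 2 edges, all of them paid.
  clique U D@(_ ∷ _ ∷ _ ∷ _ ∷ []) _ = free-clique U D
  clique U (z ∷ d₁ ∷ d₂ ∷ d₃ ∷ d₄ ∷ ds)
    ((z≢d₁ ∷ z≢d₂ ∷ z∉) ∷ u@((d₁≢d₂ ∷ d₁∉) ∷ d₂∉ ∷ d₃∉ ∷ _)) =
    grow-weaken (≤-reflexive (cost (length ds))) id
      (grow-bind (clique U (d₁ ∷ d₂ ∷ D) u) λ _ old →
       grow-bind (free-star _ z (d₁ ∷ d₂ ∷ [])) λ s new₂ → finish (complete-mono s old) new₂)
    where
    D = d₃ ∷ d₄ ∷ ds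
    cost : ∀ m → (2 * (4 + m) ∸ 2) + (2 + 0) ≡ 2 * (5 + m) ∸ 2
    cost m = trans (cong (_+ 2) (cong (_∸ 2) (lhs m)))
      (trans (+-comm (6 + 2 * m) 2) (cong (_∸ 2) (sym (rhs m))))
      where
      lhs : ∀ m → 2 * (4 + m) ≡ 2 + (6 + 2 * m)
      lhs = solve-∀
      rhs : ∀ m → 2 * (5 + m) ≡ 2 + (8 + 2 * m)
      rhs = solve-∀
    other : ∀ {d} → d ∈ D → ∃[ w ] (w ∈ D × d ≢ w)
    other (here refl) = d₄ , there (here refl) , All.head d₃∉
    other (there d∈)  = d₃ , here refl , All.lookup d₃∉ d∈ ∘ sym
    finish : ∀ {U} → Complete U (d₁ ∷ d₂ ∷ D) (d₁ ∷ d₂ ∷ D) → Complete U (z ∷ []) (d₁ ∷ d₂ ∷ []) →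
             Grow U 0 (λ U′ → Complete U′ (z ∷ d₁ ∷ d₂ ∷ D) (z ∷ d₁ ∷ d₂ ∷ D))
    finish {U} old new₂ with step-star U z D (λ {d} d∈ →
        let w , w∈ , d≢w = other d∈ in K₅⁻-step
        ((d₁≢d₂ ∷ All.lookup d₁∉ d∈ ∷ z≢d₁ ∘ sym ∷ All.lookup d₁∉ w∈ ∷ [])
         ∷ (All.lookup d₂∉ d∈ ∷ z≢d₂ ∘ sym ∷ All.lookup d₂∉ w∈ ∷ [])
         ∷ (All.lookup z∉ d∈ ∘ sym ∷ d≢w ∷ []) ∷ (All.lookup z∉ w∈ ∷ []) ∷ [] ∷ [])
        (old d₁ d₂ (here refl) (there (here refl)))
        (old d₁ d (here refl) (there (there d∈)))
        (has-sym (new₂ z d₁ (here refl) (here refl)))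
        (old d₁ w (here refl) (there (there w∈)))
        (old d₂ d (there (here refl)) (there (there d∈)))
        (has-sym (new₂ z d₂ (here refl) (there (here refl))))
        (old d₂ w (there (here refl)) (there (there w∈)))
        (old d w (there (there d∈)) (there (there w∈))))
    ... | U′ , s , c , g = U′ , s , clique-∷ star (complete-mono s old) , g
      where
      star : Complete U′ (z ∷ []) (d₁ ∷ d₂ ∷ D)
      star x y x∈ (here refl)         = ⊆-trans (new₂ x y x∈ (here refl)) s
      star x y x∈ (there (here refl)) = ⊆-trans (new₂ x y x∈ (there (here refl))) s
      star x y x∈ (there (there y∈))  = c x y x∈ y∈

-- Closures are unions of a complete graph and complete bipartite graphs

module _ {n : ℕ} where

  isDead : Label n → Bool
  isDead dead       = true
  isDead (live _ _) = false

  isLive : Fin n → Bool → Label n → Bool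
  isLive l s dead       = false
  isLive l s (live m t) = does (m ≟ l) ∧ does (t Boolₚ.≟ s)

  hasRoot : Fin n → Label n → Bool
  hasRoot l dead       = false
  hasRoot l (live m _) = does (m ≟ l)

  isDead⁻ : ∀ x → T (isDead x) → x ≡ dead
  isDead⁻ dead _ = refl

  isLive⁺ : ∀ l s → T (isLive l s (live l s))
  isLive⁺ l s = ∧⁺ (does⁺ (l ≟ l) refl) (does⁺ (s Boolₚ.≟ s) refl)

  isLive⁻ : ∀ {l s} x → T (isLive l s x) → x ≡ live l s
  isLive⁻ {l} {s} (live m t) h with ∧⁻ {does (m ≟ l)} h
  ... | p , q = cong₂ live (does⁻ (m ≟ l) p) (does⁻ (t Boolₚ.≟ s) q)

  hasRoot⁻ : ∀ {l} x → T (hasRoot l x) → ∃[ s ] x ≡ live l s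
  hasRoot⁻ {l} (live m s) h = s , cong (λ r → live r s) (does⁻ (m ≟ l) h)

  module Parts (A : EdgeSet n) where

    open Labelling (labelling A)

    deadVertices : List (Fin n)
    deadVertices = filterᵇ (isDead ∘ σ) (allFin n)

    side : Bool → Fin n → List (Fin n)
    side s l = filterᵇ (isLive l s ∘ σ) (allFin n)

    roots : List (Fin n)
    roots = filterᵇ (bipRoot A) (allFin n)

    partSize : Fin n → ℕ
    partSize l = length (side true l) + length (side false l)

    ∈-dead : ∀ {v} → σ v ≡ dead → v ∈ deadVertices
    ∈-dead {v} eq = ∈-filterᵇ⁺ (isDead ∘ σ) (∈-allFin v) (subst (T ∘ isDead) (sym eq) tt)

    ∈-side : ∀ {v l s} → σ v ≡ live l s → v ∈ side s l
    ∈-side {v} {l} {s} eq =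
      ∈-filterᵇ⁺ (isLive l s ∘ σ) (∈-allFin v) (subst (T ∘ isLive l s) (sym eq) (isLive⁺ l s))

    side⁻ : ∀ {v l} s → v ∈ side s l → σ v ≡ live l s
    side⁻ {v} {l} s v∈ = isLive⁻ (σ v) (proj₂ (∈-filterᵇ⁻ (isLive l s ∘ σ) (allFin n) v∈))

    ∈-roots : ∀ {v l s} → σ v ≡ live l s → T (inV A v) → l ∈ roots
    ∈-roots {v} {l} eq v∈ = ∈-filterᵇ⁺ (bipRoot A) (∈-allFin l)
      (∧⁺ {isRootᵛ l} (rootᵛ (labelling A) {v} eq) (walk-inV-end (reach eq) v∈))

    roots⁻ : ∀ {l} → l ∈ roots → σ l ≡ live l false × T (inV A l)
    roots⁻ {l} l∈ with ∧⁻ {isRootᵛ l} (proj₂ (∈-filterᵇ⁻ (bipRoot A) (allFin n) l∈))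
    ... | r , l∈V = isRoot⁻ (σ l) l r , l∈V

    side-unique : ∀ s l → Unique (side s l)
    side-unique s l = filterᵇ-unique (isLive l s ∘ σ) (Uniqueₚ.allFin⁺ n)

    sides-apart : ∀ l → Apart (side true l) (side false l)
    sides-apart l x y x∈ y∈ refl with trans (sym (side⁻ true x∈)) (side⁻ false y∈)
    ... | ()

    -- A root in V(A) has a neighbour on the other side. The bound keeps the truncated subtractions
    -- in the costs of the bipartite parts exact.
    partSize-≥2 : ∀ {l} → l ∈ roots → 2 ≤ partSize l
    partSize-≥2 {l} l∈ with roots⁻ l∈
    ... | σl , l∈V with inV⁻ A l∈V
    ...   | w , a = +-mono-≤ (∈⇒positive (∈-side {w} (trans (sym (neg-involutive (σ w)))
              (cong neg (trans (sym (opposite a)) σl))))) (∈⇒positive (∈-side {l} σl))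

    parts-nonempty : Nonempty A → 1 ≤ length roots + length deadVertices
    parts-nonempty (e , Ae) with σ (proj₁ (proj₁ e)) in eq
    ... | dead     = ≤-trans (∈⇒positive (∈-dead eq)) (m≤n+m _ (length roots))
    ... | live l s = ≤-trans (∈⇒positive (∈-roots eq (inV⁺ A e Ae (joins⁺ e)))) (m≤m+n _ _)

    private
      parted : List (Fin n) → Fin n → Bool
      parted R v = any (λ l → hasRoot l (σ v)) R

      partSize-count : ∀ l → partSize l ≤ count (hasRoot l ∘ σ) (allFin n)
      partSize-count l = ≤-trans
        (≤-reflexive (count-disjoint (isLive l true ∘ σ) (isLive l false ∘ σ) disjoint (allFin n)))
        (count-mono either (allFin n))
        where
        disjoint : ∀ v → T (isLive l true (σ v)) → ¬ T (isLive l false (σ v))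
        disjoint v p q with trans (sym (isLive⁻ (σ v) p)) (isLive⁻ (σ v) q)
        ... | ()
        has : ∀ {s} x → x ≡ live l s → T (hasRoot l x)
        has x refl = does⁺ (l ≟ l) refl
        either : ∀ v → T (isLive l true (σ v) ∨ isLive l false (σ v)) → T (hasRoot l (σ v))
        either v h with ∨⁻ {isLive l true (σ v)} h
        ... | inj₁ p = has (σ v) (isLive⁻ (σ v) p)
        ... | inj₂ p = has (σ v) (isLive⁻ (σ v) p)

      sum-parts : ∀ R → Unique R → sum (map partSize R) ≤ count (parted R) (allFin n)
      sum-parts [] _ = z≤n
      sum-parts (l ∷ R) (l∉ ∷ u) = ≤-trans (+-mono-≤ (partSize-count l) (sum-parts R u))
        (≤-reflexive (count-disjoint (hasRoot l ∘ σ) (parted R) disjoint (allFin n)))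
        where
        disjoint : ∀ v → T (hasRoot l (σ v)) → ¬ T (parted R v)
        disjoint v p q with any-elim (λ l → hasRoot l (σ v)) R q
        ... | m , m∈ , p′ with hasRoot⁻ (σ v) p | hasRoot⁻ (σ v) p′
        ...   | _ , eq | _ , eq′ = All.lookup l∉ m∈ (proj₁ (live-injective (trans (sym eq) eq′)))

    parts-total : sum (map partSize roots) + length deadVertices ≤ ∣V A ∣
    parts-total = begin
      sum (map partSize roots) + length deadVertices
        ≤⟨ +-monoˡ-≤ (length deadVertices)
             (sum-parts roots (filterᵇ-unique (bipRoot A) (Uniqueₚ.allFin⁺ n))) ⟩
      count (parted roots) (allFin n) + length deadVertices
        ≡⟨ count-disjoint (parted roots) (isDead ∘ σ) disjoint (allFin n) ⟩
      count (λ v → parted roots v ∨ isDead (σ v)) (allFin n)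
        ≤⟨ count-mono inside (allFin n) ⟩
      ∣V A ∣ ∎
      where
      open ≤-Reasoning
      parted⁻ : ∀ v → T (parted roots v) → ∃[ l ] (l ∈ roots × ∃[ s ] σ v ≡ live l s)
      parted⁻ v h with any-elim (λ l → hasRoot l (σ v)) roots h
      ... | l , l∈ , p = l , l∈ , hasRoot⁻ (σ v) p
      disjoint : ∀ v → T (parted roots v) → ¬ T (isDead (σ v))
      disjoint v p d with parted⁻ v p
      ... | l , _ , s , eq with trans (sym eq) (isDead⁻ (σ v) d)
      ...   | ()
      inside : ∀ v → T (parted roots v ∨ isDead (σ v)) → T (inV A v)
      inside v h with ∨⁻ {parted roots v} h
      ... | inj₂ d = odd-inV (odd (isDead⁻ (σ v) d)) tt
      ... | inj₁ p with parted⁻ v p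
      ...   | l , l∈ , s , eq = walk-inV-end (reverse (reach eq)) (proj₂ (roots⁻ l∈))

  -- A live pair shares its root and differs in sign. The walk joining the two distinct vertices
  -- puts them into V(A), so their root is among the recorded ones.
  opposite-parts : ∀ A {u v} → u ≢ v → Opposite A u v →
    let open Parts A in (u ∈ deadVertices × v ∈ deadVertices)
      ⊎ ∃[ l ] (l ∈ roots × ∃[ s ] (u ∈ side s l × v ∈ side (not s) l))
  opposite-parts A {u} {v} u≢v opp = go (σ u) (σ v) refl refl opp
    where
    open Parts A
    open Labelling (labelling A)
    go : ∀ x y → σ u ≡ x → σ v ≡ y → σ u ≡ neg (σ v) →
         (u ∈ deadVertices × v ∈ deadVertices)
         ⊎ ∃[ l ] (l ∈ roots × ∃[ s ] (u ∈ side s l × v ∈ side (not s) l))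
    go x dead p q h = inj₁ (∈-dead (trans h (cong neg q)) , ∈-dead q)
    go x (live l s) p q h = inj₂ (l , ∈-roots σu u∈V , not s , ∈-side {u} σu
                                 , ∈-side {v} (trans q (cong (live l) (sym (Boolₚ.not-involutive s)))))
      where
      σu : σ u ≡ live l (not s)
      σu = trans h (cong neg q)
      u∈V : T (inV A u)
      u∈V with walk-inV (reach σu ⊙ reverse (reach q))
      ... | inj₁ u≡v = contradiction u≡v u≢v
      ... | inj₂ u∈  = u∈

module ClosureGrowth {n : ℕ} (H : List Pattern) (bipCost cliqueCost : ℕ → ℕ)
  (bipartite : ∀ U A B → Unique A → Unique B → Apart A B →
               Growth.Grow {n} H U (bipCost (length A + length B)) (λ U′ → Complete U′ A B))
  (clique : ∀ U D → Unique D → Growth.Grow {n} H U (cliqueCost (length D)) (λ U′ → Complete U′ D D))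
  where

  open Growth {n} H

  closureCost : EdgeSet n → ℕ
  closureCost A = cliqueCost (length deadVertices) + sum (map (bipCost ∘ partSize) roots)
    where open Parts A

  grow-parts : ∀ A U R → let open Parts A in
    Grow U (sum (map (bipCost ∘ partSize) R)) (λ U′ → ∀ l → l ∈ R → Complete U′ (side true l) (side false l))
  grow-parts A U [] = grow-refl (λ _ ())
  grow-parts A U (l ∷ R) = grow-bind
    (bipartite U (side true l) (side false l) (side-unique true l) (side-unique false l) (sides-apart l))
    λ _ c → bind c (grow-parts A _ R)
    where
    open Parts A
    bind : ∀ {U m} → Complete U (side true l) (side false l) →
           Grow U m (λ U′ → ∀ l → l ∈ R → Complete U′ (side true l) (side false l)) →
           Grow U m (λ U′ → ∀ l′ → l′ ∈ l ∷ R → Complete U′ (side true l′) (side false l′))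
    bind c (U′ , s , cs , g) = U′ , s
      , (λ { l′ (here refl) → complete-mono s c ; l′ (there l∈) → cs l′ l∈ }) , g

  grow-closure : ∀ A U → Grow U (closureCost A) (λ U′ → ∀ u v → u ≢ v → Opposite A u v → Has U′ u v)
  grow-closure A U = grow-bind (clique U deadVertices (filterᵇ-unique (isDead ∘ σ) (Uniqueₚ.allFin⁺ n)))
    λ _ c → bind c (grow-parts A _ roots)
    where
    open Parts A
    open Labelling (labelling A) using (σ)
    bind : ∀ {U m} → Complete U deadVertices deadVertices →
           Grow U m (λ U′ → ∀ l → l ∈ roots → Complete U′ (side true l) (side false l)) →
           Grow U m (λ U′ → ∀ u v → u ≢ v → Opposite A u v → Has U′ u v)
    bind c (U′ , s , cs , g) = U′ , s , has , g
      where
      has : ∀ u v → u ≢ v → Opposite A u v → Has U′ u v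
      has u v u≢v opp with opposite-parts A u≢v opp
      ... | inj₁ (u∈ , v∈)                  = ⊆-trans (c u v u∈ v∈) s
      ... | inj₂ (l , l∈ , true , u∈ , v∈)  = cs l l∈ u v u∈ v∈
      ... | inj₂ (l , l∈ , false , u∈ , v∈) = has-sym (cs l l∈ v u v∈ u∈)

  generates : (W : Weight n) → let open Weight W in
              (∀ A e → f (insert e A) ≤ f A → Opposite A (proj₁ (proj₁ e)) (proj₂ (proj₁ e))) →
              (∀ A → Nonempty A → closureCost A ≤ f A ∸ c) →
              InducedMatroid.Generates W H
  generates W spans cost A ne {U} {j} G with grow-closure A U
  ... | U′ , s , has , g = U′ , s , cl⊆ , generated-weaken
      (≤-trans (+-monoˡ-≤ j (cost A ne)) (≤-reflexive (+-comm (f A ∸ c) j))) (g G)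
    where
    open Weight W
    open InducedMatroid W
    cl⊆ : cl A ⊆ U′
    cl⊆ e@((u , v) , u<v) h = has u v (λ { refl → <-irrefl refl u<v }) (spans A e (cl⁻ A e h)) e (joins⁺ e)

-- The two weights and the cost of their closures

evenCycleWeight : ∀ n → Weight n
evenCycleWeight n = record
  { f = ρ ; c = 0 ; a = 1 ; t = 3 ; monotone = ρ-mono ; submodular = ρ-submodular
  ; single = ρ-single ; pendant = ρ-pendant ; triangle = triangle-ρ }

-- With ρ = |V| - β the function 2|V| - β is |V| + ρ. It is 2 + 1 on an edge, grows by 1 + 1 with an
-- edge at a new vertex, and is at least 3 + 3 on a triangle.
g₂₁₂Weight : ∀ n → Weight n
g₂₁₂Weight n = record
  { f = λ F → ∣V F ∣ + ρ F ; c = 2 ; a = 2 ; t = 6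
  ; monotone   = λ A⊆B → +-mono-≤ (V-mono A⊆B) (ρ-mono A⊆B)
  ; submodular = λ A B → add ∣V A ∪ B ∣ ∣V A ∩ B ∣ ∣V A ∣ ∣V B ∣ (ρ (A ∪ B)) (ρ (A ∩ B)) (ρ A) (ρ B)
                           (V-submodular A B) (ρ-submodular A B)
  ; single     = λ e → cong₂ _+_ (V-single e) (ρ-single e)
  ; pendant    = λ {F} e v∉ j → ≤-trans (≤-reflexive (sym (cong suc (+-suc ∣V F ∣ (ρ F)))))
                                  (+-mono-≤ (V-pendant {F = F} e v∉ j) (ρ-pendant {F = F} e v∉ j))
  ; triangle   = λ {F} p q r x y z → let 3≤ρ = triangle-ρ {F = F} p q r x y z in
                   +-mono-≤ (≤-trans 3≤ρ (ρ≤V F)) 3≤ρ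
  }
  where
  interchange : ∀ a b x y → (a + x) + (b + y) ≡ (a + b) + (x + y)
  interchange = solve-∀
  add : ∀ a b c d x y z w → a + b ≤ c + d → x + y ≤ z + w → (a + x) + (b + y) ≤ (c + z) + (d + w)
  add a b c d x y z w p q = ≤-trans (≤-reflexive (interchange a b x y))
    (≤-trans (+-mono-≤ p q) (≤-reflexive (sym (interchange c d z w))))

ρ-closed⇒opposite : ∀ {n} (A : EdgeSet n) e → ρ (insert e A) ≤ ρ A →
                    Opposite A (proj₁ (proj₁ e)) (proj₂ (proj₁ e))
ρ-closed⇒opposite A e le with ρ-insert A e
... | inj₁ (opp , _) = opp
... | inj₂ (_ , eq)  = contradiction (≤-trans (≤-reflexive (sym eq)) le) (<⇒≱ ≤-refl)

evenCycle-generates : ∀ n → InducedMatroid.Generates (evenCycleWeight n) (C₄ ∷ [])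
evenCycle-generates n = generates (evenCycleWeight n) ρ-closed⇒opposite (λ A _ → cost A)
  where
  open ClosureGrowth {n} (C₄ ∷ []) (_∸ 1) id EvenCycle.bipartite EvenCycle.clique
  pred-sum : ∀ (k : Fin n → ℕ) R → All (λ l → 2 ≤ k l) R →
             sum (map ((_∸ 1) ∘ k) R) + length R ≡ sum (map k R)
  pred-sum k [] _ = refl
  pred-sum k (l ∷ R) (2≤ ∷ h) = trans (rearrange (k l ∸ 1) _ (length R))
    (cong₂ _+_ (m∸n+n≡m (≤-trans (s≤s z≤n) 2≤)) (pred-sum k R h))
    where
    rearrange : ∀ x y z → (x + y) + suc z ≡ (x + 1) + (y + z)
    rearrange = solve-∀
  -- Adding the number of roots on both sides cancels the subtractions and leaves a count of
  -- vertices.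
  cost : ∀ A → closureCost A ≤ ρ A
  cost A = +-cancelʳ-≤ (length roots) _ _ (begin
    (d + K) + length roots          ≡⟨ +-assoc d K (length roots) ⟩
    d + (K + length roots)          ≡⟨ cong (d +_) (pred-sum partSize roots (All.tabulate partSize-≥2)) ⟩
    d + sum (map partSize roots)    ≡⟨ +-comm d _ ⟩
    sum (map partSize roots) + d    ≤⟨ parts-total ⟩
    ∣V A ∣                          ≡⟨ ρ+β A ⟨
    ρ A + length roots              ∎)
    where
    open ≤-Reasoning
    open Parts A
    d = length deadVertices
    K = sum (map ((_∸ 1) ∘ partSize) roots)

g₂₁₂-generates : ∀ n → InducedMatroid.Generates (g₂₁₂Weight n) (K₅⁻ ∷ K₃₄ ∷ [])
g₂₁₂-generates n = generates (g₂₁₂Weight n) spans cost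
  where
  open ClosureGrowth {n} (K₅⁻ ∷ K₃₄ ∷ []) (λ m → 2 * m ∸ 3) (λ m → 2 * m ∸ 2)
    TwoOneTwo.bipartite TwoOneTwo.clique
  -- |V| cannot drop, so a sum that does not grow leaves no room for ρ to grow.
  spans : ∀ A e → ∣V insert e A ∣ + ρ (insert e A) ≤ ∣V A ∣ + ρ A →
          Opposite A (proj₁ (proj₁ e)) (proj₂ (proj₁ e))
  spans A e le = ρ-closed⇒opposite A e (+-cancelˡ-≤ ∣V A ∣ _ _
    (≤-trans (+-monoˡ-≤ (ρ (insert e A)) (V-mono (insert-⊇ e A))) le))
  bip-sum : ∀ (k : Fin n → ℕ) R → All (λ l → 2 ≤ k l) R →
            sum (map (λ l → 2 * k l ∸ 3) R) + 3 * length R ≡ 2 * sum (map k R)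
  bip-sum k [] _ = refl
  bip-sum k (l ∷ R) (2≤ ∷ h) = trans (rearrange (2 * k l ∸ 3) _ (length R))
    (trans (cong₂ _+_ (m∸n+n≡m (≤-trans (n≤1+n 3) (*-monoʳ-≤ 2 2≤))) (bip-sum k R h))
      (sym (*-distribˡ-+ 2 (k l) _)))
    where
    rearrange : ∀ x y z → (x + y) + 3 * suc z ≡ (x + 3) + (y + 3 * z)
    rearrange = solve-∀
  -- Each bipartite part and the dead part leave a slack of 2, so one part already pays for c = 2.
  slack : ∀ r d K S v ρ′ → 1 ≤ r + d → K + 3 * r ≡ 2 * S → S + d ≤ v → ρ′ + r ≡ v →
          (2 * d ∸ 2) + K + 2 ≤ v + ρ′
  slack zero (suc d) K S v ρ′ _ eq le eq′ = begin
    (2 * suc d ∸ 2) + K + 2    ≡⟨ rearrange (2 * suc d ∸ 2) K ⟩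
    (2 * suc d ∸ 2 + 2) + (K + 0) ≡⟨ cong₂ _+_ (m∸n+n≡m {2 * suc d} {2} (*-monoʳ-≤ 2 (s≤s z≤n))) eq ⟩
    2 * suc d + 2 * S          ≡⟨ double (suc d) S ⟩
    (S + suc d) + (S + suc d)  ≤⟨ +-mono-≤ le (≤-trans le (≤-reflexive (trans (sym eq′) (+-identityʳ ρ′)))) ⟩
    v + ρ′                     ∎
    where
    open ≤-Reasoning
    rearrange : ∀ x y → x + y + 2 ≡ (x + 2) + (y + 0)
    rearrange = solve-∀
    double : ∀ x y → 2 * x + 2 * y ≡ (y + x) + (y + x)
    double = solve-∀
  slack (suc r) d K S v ρ′ _ eq le eq′ = +-cancelʳ-≤ (suc r) _ _ (begin
    (2 * d ∸ 2) + K + 2 + suc r ≤⟨ +-monoˡ-≤ (suc r) (+-monoˡ-≤ 2 (+-monoˡ-≤ K (m∸n≤m (2 * d) 2))) ⟩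
    2 * d + K + 2 + suc r       ≤⟨ m≤m+n _ (2 * r) ⟩
    2 * d + K + 2 + suc r + 2 * r ≡⟨ rearrange d K r ⟩
    2 * d + (K + 3 * suc r)     ≡⟨ cong (2 * d +_) eq ⟩
    2 * d + 2 * S               ≡⟨ double d S ⟩
    (S + d) + (S + d)           ≤⟨ +-mono-≤ le (≤-trans le (≤-reflexive (sym eq′))) ⟩
    v + (ρ′ + suc r)            ≡⟨ +-assoc v ρ′ (suc r) ⟨
    v + ρ′ + suc r              ∎)
    where
    open ≤-Reasoning
    rearrange : ∀ d K r → 2 * d + K + 2 + suc r + 2 * r ≡ 2 * d + (K + 3 * suc r)
    rearrange = solve-∀
    double : ∀ x y → 2 * x + 2 * y ≡ (y + x) + (y + x)
    double = solve-∀
  cost : ∀ A → Nonempty A → closureCost A ≤ (∣V A ∣ + ρ A) ∸ 2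
  cost A ne = ≤-trans (≤-reflexive (sym (m+n∸n≡m (closureCost A) 2))) (∸-monoˡ-≤ 2
    (slack (length roots) (length deadVertices) _ _ ∣V A ∣ (ρ A) (parts-nonempty ne)
      (bip-sum partSize roots (All.tabulate partSize-≥2)) parts-total (ρ+β A)))
    where open Parts A

-- Boolean tests on the edge list of a pattern

module _ {k : ℕ} where

  Edges : Set
  Edges = List (Fin k × Fin k)

  incident : Fin k → Fin k × Fin k → Bool
  incident z (x , y) = does (x ≟ z) ∨ does (y ≟ z)

  touches : Fin k → Edges → Bool
  touches z = any (incident z)

  samePair : Fin k × Fin k → Fin k × Fin k → Bool
  samePair (x , y) (u , v) = does (x ≟ u) ∧ does (y ≟ v)

  samePair⁻ : ∀ p q → T (samePair p q) → p ≡ q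
  samePair⁻ (x , y) (u , v) h with ∧⁻ {does (x ≟ u)} h
  ... | h₁ , h₂ = cong₂ _,_ (does⁻ (x ≟ u) h₁) (does⁻ (y ≟ v) h₂)

  at away : Fin k → Edges → Edges
  at z   = filterᵇ (incident z)
  away z = filterᵇ (not ∘ incident z)

  delete : Fin k × Fin k → Edges → Edges
  delete p = filterᵇ (not ∘ samePair p)

  distinct : Fin k → Fin k → Bool
  distinct x y = not (does (x ≟ y))

  distinct⁻ : ∀ x y → T (distinct x y) → x ≢ y
  distinct⁻ x y h x≡y = not⁻ h (does⁺ (x ≟ y) x≡y)

  twin : Fin k → Fin k → Fin k × Fin k → Bool
  twin x y q = samePair (x , y) q ∨ samePair (y , x) q

  simple : Edges → Bool
  simple []             = true
  simple ((x , y) ∷ es) =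
    distinct x y ∧ not (any (twin x y) es) ∧ simple es

  fresh : Fin k × Fin k → Edges → Bool
  fresh (x , y) es = distinct x y ∧ (not (touches x es) ∨ not (touches y es))

  -- Recognises only triangles listed as xy, xz, yz. A missed triangle can weaken the certificate
  -- but not its soundness.
  isTriangle : Fin k × Fin k → Fin k × Fin k → Fin k × Fin k → Bool
  isTriangle (x , y) (x′ , z) (y′ , z′) =
    does (x ≟ x′) ∧ does (y ≟ y′) ∧ does (z ≟ z′) ∧ distinct x y ∧ distinct y z ∧ distinct x z

  bichromatic : (Fin k → Bool) → Edges → Bool
  bichromatic col = all (λ p → col (proj₁ p) xor col (proj₂ p))

-- Certifying independence of copies of patterns

module Certificate (k c a t : ℕ) where

  -- The graph is built up from `base`, reading the list from its end; `a` is gained whenever an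
  -- edge brings a new vertex.
  lowerBound : Edges {k} → ℕ → Edges → ℕ
  lowerBound base b []       = b
  lowerBound base b (p ∷ ps) =
    if fresh p (ps ++ base) then a + lowerBound base b ps else lowerBound base b ps

  edgeSpans : Edges → Fin k × Fin k → Bool
  edgeSpans es p =
    distinct (proj₁ p) (proj₂ p) ∧ (length es + c ≤ᵇ lowerBound (p ∷ []) (suc c) es)

  triangleSpans : Edges → Fin k × Fin k → Fin k × Fin k → Fin k × Fin k → Bool
  triangleSpans es p q r =
    isTriangle p q r ∧ (length es + c ≤ᵇ lowerBound (p ∷ q ∷ r ∷ []) t es)

  -- On m vertices the bound for |V| + ρ from an edge is at most 3 + 2(m - 2) = 2m - 1. Starting
  -- from a triangle can reach 6 + 2(m - 3) = 2m, which is needed when `K₅⁻` loses an edge between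
  -- two vertices of degree 4.
  large : Edges → Bool
  large es = any (edgeSpans es) es
           ∨ any (λ p → any (λ q → any (triangleSpans es p q) es) es) es

  -- A vertex without edges is passed over, as removing it would leave the list unchanged.
  removable : ∀ (es : Edges) → List (Fin k) → Maybe (∃[ z ] T (length (at z es) ≤ᵇ a))
  removable es [] = nothing
  removable es (z ∷ zs) with T? (length (at z es) ≤ᵇ a) | touches z es
  ... | yes h | true = just (z , h)
  ... | _     | _    = removable es zs

  -- A vertex of degree at most a can be removed, because an edge at a new vertex raises f by a.
  certified : ℕ → Edges → Bool
  certified _       [] = true
  certified zero    _  = false
  certified (suc m) es@(_ ∷ _) with removable es (allFin k)
  ... | just (z , _) = certified m (away z es)
  ... | nothing      = large es ∧ all (λ p → certified m (delete p es)) es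

  minimal : Edges → Bool
  minimal es = all (λ p → certified (length es) (delete p es)) es

-- Soundness of the certificates

module Copies {n : ℕ} (W : Weight n) {k : ℕ} (φ : Fin k → Fin n) (φ-inj : Injective _≡_ _≡_ φ) where

  open Weight W
  open InducedMatroid W using (independent-∅)
  open Certificate k c a t

  copy : Edges → EdgeSet n
  copy es e = any (λ p → joins e (φ (proj₁ p)) (φ (proj₂ p))) es

  copy⁻ : ∀ es e → T (copy es e) → ∃[ p ] (p ∈ es × T (joins e (φ (proj₁ p)) (φ (proj₂ p))))
  copy⁻ es e = any-elim (λ p → joins e (φ (proj₁ p)) (φ (proj₂ p))) es

  copy⁺ : ∀ {es p} e → p ∈ es → T (joins e (φ (proj₁ p)) (φ (proj₂ p))) → T (copy es e)
  copy⁺ e p∈ j = any-intro (λ p → joins e (φ (proj₁ p)) (φ (proj₂ p))) p∈ j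

  copy-mono : ∀ {es es′} → (∀ {p} → p ∈ es → p ∈ es′) → copy es ⊆ copy es′
  copy-mono {es} h e c with copy⁻ es e c
  ... | p , p∈ , j = copy⁺ e (h p∈) j

  ∣copy∣-≤ : ∀ es → ∣ copy es ∣ ≤ length es
  ∣copy∣-≤ []       = ≤-reflexive (∣∅∣ {n})
  ∣copy∣-≤ (p ∷ es) = ≤-trans (∣∪∣-≤ ⟦ φ (proj₁ p) , φ (proj₂ p) ⟧ (copy es))
    (+-mono-≤ (∣⟦⟧∣≤1 (φ (proj₁ p)) (φ (proj₂ p))) (∣copy∣-≤ es))

  joins-endpoints : ∀ (e : Edge n) {u v x y} → T (joins e u v) → T (joins e x y) →
                    (u ≡ x × v ≡ y) ⊎ (u ≡ y × v ≡ x)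
  joins-endpoints e j j′ with joins⁻ e j | joins⁻ e j′
  ... | inj₁ refl | inj₁ refl = inj₁ (refl , refl)
  ... | inj₁ refl | inj₂ refl = inj₂ (refl , refl)
  ... | inj₂ refl | inj₁ refl = inj₂ (refl , refl)
  ... | inj₂ refl | inj₂ refl = inj₁ (refl , refl)

  ∣copy∣-≥ : ∀ es → T (simple es) → length es ≤ ∣ copy es ∣
  ∣copy∣-≥ [] _ = z≤n
  ∣copy∣-≥ ((x , y) ∷ es) h with ∧⁻ {distinct x y} h
  ... | x≢y , h′ with ∧⁻ {not (any (twin x y) es)} h′ | joining {n} (distinct⁻ x y x≢y ∘ φ-inj)
  ...   | new , s | e , j = ≤-trans (s≤s (∣copy∣-≥ es s)) (∣∣-strict {A = copy es} {copy ((x , y) ∷ es)}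
            (∪-right ⟦ φ x , φ y ⟧ (copy es)) e (∪-left ⟦ φ x , φ y ⟧ (copy es) e j) old)
    where
    self : ∀ (p : Fin k × Fin k) → T (samePair p p)
    self (u , v) = ∧⁺ (does⁺ (u ≟ u) refl) (does⁺ (v ≟ v) refl)
    old : ¬ T (copy es e)
    old ce with copy⁻ es e ce
    ... | (u , v) , q∈ , j′ with joins-endpoints e j j′
    ...   | inj₁ (p , q) with φ-inj p | φ-inj q
    ...     | refl | refl = not⁻ new (any-intro (twin x y) q∈ (∨⁺ {samePair (x , y) (x , y)} (inj₁ (self (x , y)))))
    old ce | (u , v) , q∈ , j′ | inj₂ (p , q) with φ-inj p | φ-inj q
    ...     | refl | refl = not⁻ new (any-intro (twin x y) q∈ (∨⁺ {samePair (x , y) (y , x)} (inj₂ (self (y , x)))))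

  copy-inV : ∀ es z → T (inV (copy es) (φ z)) → T (touches z es)
  copy-inV es z h with inV⁻ (copy es) {φ z} h
  ... | v , e , ce , j with copy⁻ es e ce
  ...   | (x , y) , p∈ , j′ with joins-endpoints e j j′
  ...     | inj₁ (eq , _) = any-intro (incident z) p∈
              (∨⁺ {does (x ≟ z)} (inj₁ (does⁺ (x ≟ z) (sym (φ-inj eq)))))
  ...     | inj₂ (eq , _) = any-intro (incident z) p∈
              (∨⁺ {does (x ≟ z)} (inj₂ (does⁺ (y ≟ z) (sym (φ-inj eq)))))

  ∣V-copy∣ : ∀ es → ∣V copy es ∣ ≤ k
  ∣V-copy∣ es = ≤-trans
    (unique-length-≤ (filterᵇ-unique (inV (copy es)) (Uniqueₚ.allFin⁺ n)) image)
    (≤-reflexive (trans (length-map φ (allFin k))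
                        (length-tabulate {n = k} id)))
    where
    image : ∀ {v} → v ∈ filterᵇ (inV (copy es)) (allFin n) → v ∈ map φ (allFin k)
    image {v} v∈ with inV⁻ (copy es) {v} (proj₂ (∈-filterᵇ⁻ (inV (copy es)) (allFin n) v∈))
    ... | w , e , ce , j with copy⁻ es e ce
    ...   | (x , y) , _ , j′ with joins-endpoints e j j′
    ...     | inj₁ (refl , _) = ∈-map⁺ φ (∈-allFin x)
    ...     | inj₂ (refl , _) = ∈-map⁺ φ (∈-allFin y)

  -- Distinct edges share at most one vertex, so one end of `e′` is new and `pendant` applies.
  f-two : ∀ {I} e e′ → T (I e) → T (I e′) → e′ ≢ e → a + suc c ≤ f I
  f-two {I} e e′@((i , j) , i<j) Ie Ie′ e′≢e = ≤-trans
    (≤-trans (+-monoʳ-≤ a (≤-reflexive (sym (single e)))) extend)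
    (monotone (insert-least {x = e′} Ie′ (insert-least {x = e} Ie (λ _ ()))))
    where
    F = insert e ∅
    end : ∀ {u} → T (inV F u) → u ≡ proj₁ (proj₁ e) ⊎ u ≡ proj₂ (proj₁ e)
    end {u} h with inV⁻ F {u} h
    ... | w , x , Fx , jn with insert⁻ e ∅ x Fx
    ...   | inj₁ refl with joins⁻ e jn
    ...     | inj₁ refl = inj₁ refl
    ...     | inj₂ refl = inj₂ refl
    extend : a + f F ≤ f (insert e′ F)
    extend with T? (inV F i) | T? (inV F j)
    ... | no i∉  | _     = pendant {F} {i} {j} e′ i∉ (joins⁺ e′)
    ... | yes _  | no j∉ = pendant {F} {j} {i} e′ j∉ (joins-sym e′ (joins⁺ e′))
    ... | yes i∈ | yes j∈ with end {i} i∈ | end {j} j∈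
    ...   | inj₁ refl | inj₁ refl = contradiction i<j (<-irrefl refl)
    ...   | inj₁ refl | inj₂ refl = contradiction (edge-≡ refl) e′≢e
    ...   | inj₂ refl | inj₁ refl = contradiction i<j (<-asym (proj₂ e))
    ...   | inj₂ refl | inj₂ refl = contradiction i<j (<-irrefl refl)

  small-independent : ∀ {I} → Nonempty I → ∣ I ∣ ≤ a → ∣ I ∣ + c ≤ f I
  small-independent {I} (e , Ie) I≤a with ⊆-or-witness I (insert e ∅)
  ... | inj₂ I⊆e = ≤-trans (+-monoˡ-≤ c (≤-trans (∣∣-mono I⊆e) (≤-trans (∣insert∣-≤ e ∅)
                     (≤-reflexive (cong suc (∣∅∣ {n}))))))
                   (≤-trans (≤-reflexive (sym (single e))) (monotone (insert-least {x = e} Ie (λ _ ()))))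
  ... | inj₁ (e′ , Ie′ , e′∉) = ≤-trans (+-mono-≤ I≤a (n≤1+n c))
          (f-two e e′ Ie Ie′ (λ { refl → e′∉ (insert-self e ∅) }))

  at-or-away : ∀ z es x → T (copy es x) → T (copy (at z es) x) ⊎ T (copy (away z es) x)
  at-or-away z es x cx with copy⁻ es x cx
  ... | p , p∈ , j with T? (incident z p)
  ...   | yes h = inj₁ (copy⁺ x (∈-filterᵇ⁺ (incident z) p∈ h) j)
  ...   | no ¬h = inj₂ (copy⁺ x (∈-filterᵇ⁺ (not ∘ incident z) p∈ (not⁺ ¬h)) j)

  away-∉V : ∀ z es → ¬ T (inV (copy (away z es)) (φ z))
  away-∉V z es h =
    let p , p∈ , inc = any-elim (incident z) (away z es) (copy-inV (away z es) z h)
    in not⁻ (proj₂ (∈-filterᵇ⁻ (not ∘ incident z) es p∈)) inc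

  at-endpoint : ∀ z es e → T (copy (at z es) e) → ∃[ u ] T (joins e (φ z) u)
  at-endpoint z es e h with copy⁻ (at z es) e h
  ... | (x , y) , p∈ , j with ∨⁻ {does (x ≟ z)} (proj₂ (∈-filterᵇ⁻ (incident z) es p∈))
  ...   | inj₁ eq = φ y , subst (λ w → T (joins e (φ w) (φ y))) (does⁻ (x ≟ z) eq) j
  ...   | inj₂ eq = φ x , subst (λ w → T (joins e (φ w) (φ x))) (does⁻ (y ≟ z) eq) (joins-sym e j)

  -- One edge at the new vertex `v` raises `f` by `a`, which pays for all of the at most `a` edges
  -- in `A`. If `I` has no edge in `B`, no lower bound on `f J` is available, and
  -- `small-independent` takes over.
  peel-bound : ∀ {I A B : EdgeSet n} {v u} e → Nonempty I → Independent B → ∣ A ∣ ≤ a →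
               I ⊆ (A ∪ B) → ¬ T (inV B v) → T (I e) → T (joins e v u) → ∣ I ∣ + c ≤ f I
  peel-bound {I} {A} {B} {v} {u} e ne ind A≤a I⊆ v∉ Ie j =
    [ main , (λ empty → small-independent ne (≤-trans ∣I∣≤
        (≤-reflexive (trans (cong (a +_) (count-none empty (allEdges n))) (+-identityʳ a))))) ]′
      (nonempty-or-empty J)
    where
    J = I ∩ B
    I⊆A∪J : I ⊆ (A ∪ J)
    I⊆A∪J x Ix = [ ∪-left A J x , (λ Bx → ∪-right A J x (∧⁺ {I x} Ix Bx)) ]′ (∨⁻ {A x} (I⊆ x Ix))
    ∣I∣≤ : ∣ I ∣ ≤ a + ∣ J ∣
    ∣I∣≤ = ≤-trans (∣∣-mono I⊆A∪J) (≤-trans (∣∪∣-≤ A J) (+-monoˡ-≤ ∣ J ∣ A≤a))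
    main : Nonempty J → ∣ I ∣ + c ≤ f I
    main neJ = begin
      ∣ I ∣ + c        ≤⟨ +-monoˡ-≤ c ∣I∣≤ ⟩
      a + ∣ J ∣ + c    ≡⟨ +-assoc a ∣ J ∣ c ⟩
      a + (∣ J ∣ + c)  ≤⟨ +-monoʳ-≤ a (ind J (∩-right I B) neJ) ⟩
      a + f J          ≤⟨ pendant {J} {v} {u} e (λ h → v∉ (inV-mono {F = J} {B} (∩-right I B) v h)) j ⟩
      f (insert e J)   ≤⟨ monotone (insert-least {x = e} Ie (∩-left I B)) ⟩
      f I              ∎
      where open ≤-Reasoning

  peel : ∀ es z → length (at z es) ≤ a → Independent (copy (away z es)) → Independent (copy es)
  peel es z deg ind I I⊆ ne = [ outside , (λ I⊆away → ind I I⊆away ne) ]′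
                                (⊆-or-witness I (copy (away z es)))
    where
    outside : ∃[ e ] (T (I e) × ¬ T (copy (away z es) e)) → ∣ I ∣ + c ≤ f I
    outside (e , Ie , e∉) =
      let at-e : T (copy (at z es) e)
          at-e  = [ id , (λ h → contradiction h e∉) ]′ (at-or-away z es e (I⊆ e Ie))
          u , j = at-endpoint z es e at-e
      in peel-bound {I} {copy (at z es)} {copy (away z es)} {φ z} {u} e ne ind
           (≤-trans (∣copy∣-≤ (at z es)) deg)
           (λ x Ix → ∨⁺ {copy (at z es) x} (at-or-away z es x (I⊆ x Ix)))
           (away-∉V z es) Ie j

  missing-edge : ∀ {I} es → I ⊆ copy es → ∀ e → T (copy es e) → ¬ T (I e) →
                 ∃[ p ] (p ∈ es × I ⊆ copy (delete p es))
  missing-edge {I} es I⊆ e ce ¬Ie with copy⁻ es e ce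
  ... | p , p∈ , j = p , p∈ , inside
    where
    inside : I ⊆ copy (delete p es)
    inside x Ix with copy⁻ es x (I⊆ x Ix)
    ... | q , q∈ , j′ with T? (samePair p q)
    ...   | no ¬s = copy⁺ x (∈-filterᵇ⁺ (not ∘ samePair p) q∈ (not⁺ ¬s)) j′
    ...   | yes s with samePair⁻ p q s
    ...     | refl with joins-unique e x j j′
    ...       | refl = contradiction Ix ¬Ie

  -- A proper subset lies in some deletion of one edge, so only the full copy needs a direct bound.
  whole : ∀ es → length es + c ≤ f (copy es) → (∀ {p} → p ∈ es → Independent (copy (delete p es))) →
          Independent (copy es)
  whole es big ind I I⊆ ne with ⊆-or-witness (copy es) I
  ... | inj₂ es⊆I = ≤-trans (+-monoˡ-≤ c (≤-trans (∣∣-mono I⊆) (∣copy∣-≤ es)))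
                      (≤-trans big (monotone es⊆I))
  ... | inj₁ (e , ce , ¬Ie) with missing-edge es I⊆ e ce ¬Ie
  ...   | p , p∈ , I⊆′ = ind p∈ I I⊆′ ne

  lowerBound-sound : ∀ base b → b ≤ f (copy base) → ∀ ps → lowerBound base b ps ≤ f (copy (ps ++ base))
  lowerBound-sound base b le [] = le
  lowerBound-sound base b le (p@(x , y) ∷ ps) with fresh p (ps ++ base) in eq
  ... | false = ≤-trans (lowerBound-sound base b le ps)
                  (monotone (∪-right ⟦ φ x , φ y ⟧ (copy (ps ++ base))))
  ... | true with ∧⁻ {distinct x y} (subst T (sym eq) tt)
  ...   | x≢y , h with joining {n} (distinct⁻ x y x≢y ∘ φ-inj)
  ...     | e , j = ≤-trans (+-monoʳ-≤ a (lowerBound-sound base b le ps)) (≤-trans grow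
            (monotone (insert-least {x = e} (∪-left ⟦ φ x , φ y ⟧ (copy (ps ++ base)) e j)
                                            (∪-right ⟦ φ x , φ y ⟧ (copy (ps ++ base))))))
    where
    grow : a + f (copy (ps ++ base)) ≤ f (insert e (copy (ps ++ base)))
    grow with ∨⁻ {not (touches x (ps ++ base))} h
    ... | inj₁ x∉ = pendant {copy (ps ++ base)} {φ x} {φ y} e (not⁻ x∉ ∘ copy-inV (ps ++ base) x) j
    ... | inj₂ y∉ = pendant {copy (ps ++ base)} {φ y} {φ x} e (not⁻ y∉ ∘ copy-inV (ps ++ base) y)
                      (joins-sym e j)

  lowerBound-within : ∀ base b es → b ≤ f (copy base) → All (_∈ es) base →
                      lowerBound base b es ≤ f (copy es)
  lowerBound-within base b es le base⊆ = ≤-trans (lowerBound-sound base b le es)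
    (monotone (copy-mono (λ p∈ → [ id , All.lookup base⊆ ]′ (∈-++⁻ es p∈))))

  edgeSpans-sound : ∀ es p → p ∈ es → T (edgeSpans es p) → length es + c ≤ f (copy es)
  edgeSpans-sound es p@(x , y) p∈ h =
    let x≢y , le = ∧⁻ {distinct x y} h
        e , j    = joining {n} (distinct⁻ x y x≢y ∘ φ-inj)
        base     = ≤-trans (≤-reflexive (sym (single e)))
                     (monotone (insert-least {x = e} {∅} {copy (p ∷ [])}
                       (∪-left ⟦ φ x , φ y ⟧ ∅ e j) (λ _ ())))
    in ≤-trans (≤ᵇ⇒≤ _ _ le) (lowerBound-within (p ∷ []) (suc c) es base (p∈ ∷ []))

  isTriangle-sound : ∀ p q r → T (isTriangle p q r) → t ≤ f (copy (p ∷ q ∷ r ∷ []))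
  isTriangle-sound p@(x , y) q@(x′ , z) r@(y′ , z′) h =
    let t₁ , h₁ = ∧⁻ {does (x ≟ x′)} h
        t₂ , h₂ = ∧⁻ {does (y ≟ y′)} h₁
        t₃ , h₃ = ∧⁻ {does (z ≟ z′)} h₂
        d₁ , h₄ = ∧⁻ {distinct x y} h₃
        d₂ , d₃ = ∧⁻ {distinct y z} h₄
    in go (does⁻ (x ≟ x′) t₁) (does⁻ (y ≟ y′) t₂) (does⁻ (z ≟ z′) t₃)
          (distinct⁻ x y d₁) (distinct⁻ y z d₂) (distinct⁻ x z d₃)
    where
    X = copy (p ∷ q ∷ r ∷ [])
    adjacent : ∀ {u v} → u ≢ v → (u , v) ∈ p ∷ q ∷ r ∷ [] → Adj X (φ u) (φ v)
    adjacent u≢v ∈X = let e , j = joining {n} (u≢v ∘ φ-inj) in e , copy⁺ e ∈X j , j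
    go : x ≡ x′ → y ≡ y′ → z ≡ z′ → x ≢ y → y ≢ z → x ≢ z → t ≤ f X
    go x≡x′ y≡y′ z≡z′ x≢y y≢z x≢z = triangle {X} {φ x} {φ y} {φ z}
      (adjacent x≢y (here refl))
      (adjacent y≢z (there (there (here (cong₂ _,_ y≡y′ z≡z′)))))
      (Adj-sym (adjacent x≢z (there (here (cong (_, z) x≡x′)))))
      (x≢y ∘ φ-inj) (y≢z ∘ φ-inj) (x≢z ∘ φ-inj)

  large-sound : ∀ es → T (large es) → length es + c ≤ f (copy es)
  large-sound es h = [ edge-case , triangle-case ]′ (∨⁻ {any (edgeSpans es) es} h)
    where
    edge-case : T (any (edgeSpans es) es) → length es + c ≤ f (copy es)
    edge-case h₁ = let p , p∈ , h₂ = any-elim (edgeSpans es) es h₁ in edgeSpans-sound es p p∈ h₂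
    triangle-case : T (any (λ p → any (λ q → any (triangleSpans es p q) es) es) es) →
                    length es + c ≤ f (copy es)
    triangle-case h₁ =
      let p , p∈ , h₂ = any-elim (λ p → any (λ q → any (triangleSpans es p q) es) es) es h₁
          q , q∈ , h₃ = any-elim (λ q → any (triangleSpans es p q) es) es h₂
          r , r∈ , h₄ = any-elim (triangleSpans es p q) es h₃
          tri , le    = ∧⁻ {isTriangle p q r} h₄
      in ≤-trans (≤ᵇ⇒≤ _ _ le) (lowerBound-within (p ∷ q ∷ r ∷ []) t es
           (isTriangle-sound p q r tri) (p∈ ∷ q∈ ∷ r∈ ∷ []))

  certified-sound : ∀ m es → T (certified m es) → Independent (copy es)
  certified-sound _ [] _ = independent-∅
  certified-sound (suc m) es@(_ ∷ _) h with removable es (allFin k)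
  ... | just (z , deg) = peel es z (≤ᵇ⇒≤ _ _ deg) (certified-sound m (away z es) h)
  ... | nothing with ∧⁻ {large es} h
  ...   | big , sub = whole es (large-sound es big)
          (λ {p} p∈ → certified-sound m (delete p es) (All.lookup (Allₚ.all⁺ _ es sub) p∈))

  minimal-sound : ∀ es → T (minimal es) → ∀ Y → Y ⊆ copy es →
                  ∃[ e ] (T (copy es e) × ¬ T (Y e)) → Independent Y
  minimal-sound es h Y Y⊆ (e , ce , ¬Ye) I I⊆Y with missing-edge es Y⊆ e ce ¬Ye
  ... | p , p∈ , Y⊆′ = certified-sound (length es) (delete p es)
          (All.lookup (Allₚ.all⁺ _ es h) p∈) I (⊆-trans I⊆Y Y⊆′)

  dependent : ∀ es → T (simple es) → Nonempty (copy es) → f (copy es) < length es + c →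
              ¬ Independent (copy es)
  dependent es s ne small ind = <⇒≱ small
    (≤-trans (+-monoˡ-≤ c (∣copy∣-≥ es s)) (ind (copy es) ⊆-refl ne))

  -- The colouring makes the label of an end of some edge live, so β is at least 1 and ρ + β = |V|
  -- becomes a strict inequality.
  bipartite-ρ : ∀ (col : Fin k → Bool) es → T (bichromatic col es) → Nonempty (copy es) →
                ρ (copy es) < ∣V copy es ∣
  bipartite-ρ col es proper (e , ce) with bipartite⇒live {F = copy es} {proj₁ (proj₁ e)} colouring
    where
    shade : Fin n → Bool
    -- Vertices outside the image of `φ` get `false`; no edge of the copy meets them.
    shade v = any (λ i → does (φ i ≟ v) ∧ col i) (allFin k)
    shade-φ : ∀ i → shade (φ i) ≡ col i
    shade-φ i with col i in eq | shade (φ i) in eq′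
    ... | true  | true  = refl
    ... | false | false = refl
    ... | true  | false = ⊥-elim (subst T eq′ (any-intro (λ j → does (φ j ≟ φ i) ∧ col j) (∈-allFin i)
                            (∧⁺ (does⁺ (φ i ≟ φ i) refl) (subst T (sym eq) tt))))
    ... | false | true with any-elim (λ j → does (φ j ≟ φ i) ∧ col j) (allFin k) (subst T (sym eq′) tt)
    ...   | j , _ , h with ∧⁻ {does (φ j ≟ φ i)} h
    ...     | p , q with φ-inj (does⁻ (φ j ≟ φ i) p)
    ...       | refl = ⊥-elim (subst T eq q)
    differ : ∀ p q → T (p xor q) → p ≢ q
    differ true  true  ()
    differ false false ()
    differ true  false _ ()
    differ false true  _ ()
    colouring : BipartiteComp (copy es) (proj₁ (proj₁ e))
    colouring = shade , alternate
      where
      alternate : ∀ u w → Connected (copy es) (proj₁ (proj₁ e)) u → Adj (copy es) u w → shade u ≢ shade w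
      alternate u w _ (x , cx , j) eq with copy⁻ es x cx
      ... | (y , z) , p∈ , j′ with joins-endpoints x j j′
      ...   | inj₁ (refl , refl) = differ (col y) (col z) (All.lookup (Allₚ.all⁺ _ es proper) p∈)
                (trans (sym (shade-φ y)) (trans eq (shade-φ z)))
      ...   | inj₂ (refl , refl) = differ (col y) (col z) (All.lookup (Allₚ.all⁺ _ es proper) p∈)
                (trans (sym (shade-φ y)) (trans (sym eq) (shade-φ z)))
  ... | l , s , eq = ≤-trans (≤-reflexive (+-comm 1 (ρ (copy es))))
    (≤-trans (+-monoʳ-≤ (ρ (copy es)) (∈⇒positive (Parts.∈-roots (copy es) {proj₁ (proj₁ e)} eq
        (inV⁺ (copy es) e ce (joins⁺ e)))))
      (≤-reflexive (ρ+β (copy es))))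

-- Differences of integers as sums of natural numbers

open import Data.Integer using (+_)

minus-intro : ∀ {x y} l → x + l ≤ y → + x ℤ.≤ + y ℤ.- + l
minus-intro {x} {y} l le = ℤₚ.≤-trans (ℤ.+≤+ (m+n≤o⇒m≤o∸n x le)) (ℤₚ.≤-reflexive
  (sym (trans (ℤₚ.m-n≡m⊖n y l) (ℤₚ.⊖-≥ (≤-trans (m≤n+m l x) le)))))

private
  cancel : ∀ x y → (x ℤ.- y) ℤ.+ y ≡ x
  cancel = ℤ-Solver.solve-∀

minus-elim : ∀ {x y} l → + x ℤ.≤ + y ℤ.- + l → x + l ≤ y
minus-elim {x} {y} l le = ℤₚ.drop‿+≤+ (ℤₚ.≤-trans (ℤₚ.≤-reflexive (ℤₚ.pos-+ x l))
  (ℤₚ.≤-trans (ℤₚ.+-monoˡ-≤ (+ l) le) (ℤₚ.≤-reflexive (cancel (+ y) (+ l)))))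

minus-≡ : ∀ {x y} l → y ≡ x + l → + y ℤ.- + l ≡ + x
minus-≡ {x} l refl = ℤₚ.≤-antisym
  (ℤₚ.≤-reflexive (trans (ℤₚ.m-n≡m⊖n (x + l) l)
    (trans (ℤₚ.⊖-≥ (m≤n+m l x)) (cong +_ (m+n∸n≡m x l)))))
  (minus-intro l ≤-refl)

-- Maximality and the rank formula

module Conclusion {n : ℕ} (W : Weight n) (H : List Pattern) (Ind′ : EdgeSet n → Set)
  (to : ∀ {F} → Ind′ F → Weight.Independent W F) (from : ∀ {F} → Weight.Independent W F → Ind′ F)
  (generates : InducedMatroid.Generates W H)
  (circuits : ∀ X → InX H X → ¬ Weight.Independent W X ×
    (∀ Y → Y ⊆ X → ∃[ e ] (T (X e) × ¬ T (Y e)) → Weight.Independent W Y))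
  where

  open Weight W
  open InducedMatroid W
  open Generated

  isMatroid-Ind′ : IsMatroid Ind′
  isMatroid-Ind′ = record
    { ind-∅   = from independent-∅
    ; ind-sub = λ I J J⊆I ind → from (ind-sub I J J⊆I (to ind))
    ; ind-aug = λ I J indI indJ lt →
        let e , Je , ¬Ie , ind = ind-aug I J (to indI) (to indJ) lt in e , Je , ¬Ie , from ind
    }
    where open IsMatroid isMatroid-Independent

  M : Matroid n
  M = record { Ind = Ind′ ; isMatroid = isMatroid-Ind′ }

  hmatroid : HMatroid H M
  hmatroid X X∈ with circuits X X∈
  ... | dep , indep = (λ ind → dep (to ind)) , (λ Y Y⊆X e → from (indep Y Y⊆X e))

  ProperFrom-∅ : ∀ {S : List (EdgeSet n)} → ProperFrom ∅ S → Proper S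
  ProperFrom-∅ {[]}    _       = tt
  ProperFrom-∅ {X ∷ S} (_ , p) = p

  seq-within : ∀ {F U : EdgeSet n} {j} → F ⊆ U → (G : Generated H U j) → ∣ F ∪ ⋃ (seq G) ∣ ≤ j + length (seq G)
  seq-within F⊆U G = ≤-trans (∣∣-mono (∪-least F⊆U (within G))) (size G)

  -- The members of the generated sequence are circuits of M′ as well, so its value, at most the
  -- size of a basis `B` of `I`, bounds the set `I`, which is independent in M′. Hence `I` is no
  -- larger than `B` and coincides with it.
  maximal : ∀ (M′ : Matroid n) → HMatroid H M′ → M′ ⪯ M
  maximal M′ hm J indJ = from check
    where
    check : Independent J
    check I I⊆J ne with basis I
    ... | B , B⊆I , indB , sp with generate-basis generates indB sp
    ...   | U , I⊆U , G with ⊆-or-witness I B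
    ...     | inj₂ I⊆B = indB I I⊆B ne
    ...     | inj₁ (e , Ie , ¬Be) = contradiction (∣∣-strict B⊆I e Ie ¬Be) (≤⇒≯
      (+-cancelʳ-≤ (length (seq G)) _ _ (≤-trans
        (independent-≤-val M′ (All.map (hm _) (inX G)) (ProperFrom-∅ (proper G)) I I ⊆-refl
          (IsMatroid.ind-sub (isMatroid M′) J I I⊆J indJ))
        (seq-within I⊆U G))))

  -- The size of a basis is attained by the generated sequence. No sequence has a smaller value,
  -- because the basis is an independent set of an `H`-matroid.
  rank-val : ∀ F → ∃[ r ] (Rank M F r × ValH H F r)
  rank-val F with basis F
  ... | B , B⊆F , indB , sp with generate-basis generates indB sp
  ...   | U , F⊆U , G = ∣ B ∣
          , ((B , B⊆F , from indB , refl)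
            , λ J J⊆F indJ → spanned-bound indB (to indJ) (λ e Je → sp e (J⊆F e Je)))
          , ((seq G , (inX G , ProperFrom-∅ (proper G)) , minus-≡ (length (seq G))
                (≤-antisym (seq-within F⊆U G) (lower (seq G) (inX G) (ProperFrom-∅ (proper G)))))
            , λ S (S∈ , p) → minus-intro (length S) (lower S S∈ p))
    where
    lower : ∀ S → All (InX H) S → Proper S → ∣ B ∣ + length S ≤ ∣ F ∪ ⋃ S ∣
    lower S S∈ p = independent-≤-val M (All.map (hmatroid _) S∈) p B F B⊆F (from indB)

  conclusion : Σ (IsMatroid Ind′) λ isM →
               IsUniqueMaximalWithRankVal H (record { Ind = Ind′ ; isMatroid = isM })
  conclusion = isMatroid-Ind′ , hmatroid , maximal , rank-val

-- The copies of the patterns are circuits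

CircuitIn : ∀ {n} → Weight n → EdgeSet n → Set
CircuitIn W X = ¬ Weight.Independent W X ×
  (∀ Y → Y ⊆ X → ∃[ e ] (T (X e) × ¬ T (Y e)) → Weight.Independent W Y)

circuit-resp : ∀ {n} (W : Weight n) {X X′} → (∀ e → X e ≡ X′ e) → CircuitIn W X′ → CircuitIn W X
circuit-resp W {X} {X′} eq (dep , indep) =
  (λ ind → dep (λ I I⊆ → ind I (⊆-trans I⊆ X′⊆X)))
  , λ Y Y⊆X (e , Xe , ¬Ye) → indep Y (⊆-trans Y⊆X X⊆X′) (e , X⊆X′ e Xe , ¬Ye)
  where
  X⊆X′ : X ⊆ X′
  X⊆X′ e = subst T (eq e)
  X′⊆X : X′ ⊆ X
  X′⊆X e = subst T (sym (eq e))

module _ {n : ℕ} where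

  nonempty-copy : ∀ G (φ : Fin (k G) → Fin n) → Injective _≡_ _≡_ φ → ∀ {x y} → (x , y) ∈ pedges G →
                  x ≢ y → Nonempty (copyEdges G φ)
  nonempty-copy G φ inj p∈ x≢y with joining {n} (x≢y ∘ inj)
  ... | e , j = e , copy-⊇ G φ p∈ e j

  -- Bipartiteness gives ρ < |V| ≤ 4 against 4 edges. Minimality is the closed Boolean `minimal`,
  -- which evaluates to `true`.
  C₄-circuit : ∀ φ → Injective _≡_ _≡_ φ → CircuitIn (evenCycleWeight n) (copyEdges C₄ φ)
  C₄-circuit φ inj = dependent (pedges C₄) tt ne
      (≤-trans (bipartite-ρ (λ { Fin.zero → true ; (Fin.suc (Fin.suc Fin.zero)) → true ; _ → false })
        (pedges C₄) tt ne) (∣V-copy∣ (pedges C₄)))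
    , minimal-sound (pedges C₄) tt
    where
    open Copies (evenCycleWeight n) φ inj
    ne = nonempty-copy C₄ φ inj (here refl) (λ ())

  -- |V| + ρ is at most 5 + 5, whereas nine independent edges would require 9 + 2.
  K₅⁻-circuit : ∀ φ → Injective _≡_ _≡_ φ → CircuitIn (g₂₁₂Weight n) (copyEdges K₅⁻ φ)
  K₅⁻-circuit φ inj = dependent (pedges K₅⁻) tt ne
      (s≤s (+-mono-≤ V≤5 (≤-trans (ρ≤V (copyEdges K₅⁻ φ)) V≤5)))
    , minimal-sound (pedges K₅⁻) tt
    where
    open Copies (g₂₁₂Weight n) φ inj
    V≤5 = ∣V-copy∣ (pedges K₅⁻)
    ne = nonempty-copy K₅⁻ φ inj (here refl) (λ ())

  -- Independence of twelve edges would require 12 + 2. The bound 7 + 7 would just allow it;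
  -- bipartiteness lowers ρ to at most 6.
  K₃₄-circuit : ∀ φ → Injective _≡_ _≡_ φ → CircuitIn (g₂₁₂Weight n) (copyEdges K₃₄ φ)
  K₃₄-circuit φ inj = dependent (pedges K₃₄) tt ne
      (≤-trans (≤-reflexive (sym (+-suc ∣V copyEdges K₃₄ φ ∣ (ρ (copyEdges K₃₄ φ)))))
        (+-mono-≤ V≤7 (≤-trans (bipartite-ρ (λ i → does (Fin.toℕ i ≤? 2)) (pedges K₃₄) tt ne) V≤7)))
    , minimal-sound (pedges K₃₄) tt
    where
    open Copies (g₂₁₂Weight n) φ inj
    V≤7 = ∣V-copy∣ (pedges K₃₄)
    ne = nonempty-copy K₃₄ φ inj (here refl) (λ ())

-- The functions `g` in terms of the weights

private
  g₁₁₀-identity : ∀ x y → + 1 ℤ.* (x ℤ.+ y) ℤ.- + 1 ℤ.* y ≡ x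
  g₁₁₀-identity = ℤ-Solver.solve-∀
  g₂₁₂-identity : ∀ x y → + 2 ℤ.* (x ℤ.+ y) ℤ.- + 1 ℤ.* y ≡ (x ℤ.+ y) ℤ.+ x
  g₂₁₂-identity = ℤ-Solver.solve-∀

module _ {n : ℕ} {I : EdgeSet n} {b : ℕ} (B : Beta I b) where

  g₁₁₀-ρ : g 1 1 (+ 0) I b ≡ + ρ I ℤ.- + 0
  g₁₁₀-ρ rewrite sym (Beta-ρ B) | ℤₚ.pos-+ (ρ I) b = cong (ℤ._- + 0) (g₁₁₀-identity (+ ρ I) (+ b))

  g₂₁₂-ρ : g 2 1 (+ 2) I b ≡ + (∣V I ∣ + ρ I) ℤ.- + 2
  g₂₁₂-ρ rewrite sym (Beta-ρ B) | ℤₚ.pos-+ (ρ I + b) (ρ I) | ℤₚ.pos-+ (ρ I) b =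
    cong (ℤ._- + 2) (g₂₁₂-identity (+ ρ I) (+ b))

module _ {n : ℕ} (a b : ℕ) (W : Weight n)
  (g≡f : ∀ {I β} → Beta I β → g a b (+ Weight.c W) I β ≡ + Weight.f W I ℤ.- + Weight.c W) where

  open Weight W using (f; c; Independent)

  -- `IndG` quantifies over all values that `Beta` admits, so this direction needs that a value
  -- exists, which `Beta-β` provides.
  IndG⇒Independent : ∀ {F} → IndG a b (+ c) F → Independent F
  IndG⇒Independent ind I I⊆F ne =
    minus-elim c (subst (_ ℤ.≤_) (g≡f Beta-β) (ind I I⊆F ne (β I) Beta-β))

  Independent⇒IndG : ∀ {F} → Independent F → IndG a b (+ c) F
  Independent⇒IndG ind I I⊆F ne _ B =
    subst (_ ℤ.≤_) (sym (g≡f B)) (minus-intro c (ind I I⊆F ne))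

theorem4p6 : (∀ (n : ℕ) → 4 ≤ n → GMatroidIsUniqueMaximal 1 1 (+ 0) n (C₄ ∷ [])) ×
    (∀ (n : ℕ) → 7 ≤ n → GMatroidIsUniqueMaximal 2 1 (+ 2) n (K₅⁻ ∷ K₃₄ ∷ []))
theorem4p6 =
  (λ n _ → Conclusion.conclusion (evenCycleWeight n) (C₄ ∷ []) (IndG 1 1 (+ 0))
    (IndG⇒Independent 1 1 (evenCycleWeight n) g₁₁₀-ρ) (Independent⇒IndG 1 1 (evenCycleWeight n) g₁₁₀-ρ)
    (evenCycle-generates n)
    λ { X (here (φ , inj , eq)) → circuit-resp (evenCycleWeight n) eq (C₄-circuit φ inj) })
  , (λ n _ → Conclusion.conclusion (g₂₁₂Weight n) (K₅⁻ ∷ K₃₄ ∷ []) (IndG 2 1 (+ 2))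
    (IndG⇒Independent 2 1 (g₂₁₂Weight n) g₂₁₂-ρ) (Independent⇒IndG 2 1 (g₂₁₂Weight n) g₂₁₂-ρ)
    (g₂₁₂-generates n)
    λ { X (here (φ , inj , eq))         → circuit-resp (g₂₁₂Weight n) eq (K₅⁻-circuit φ inj)
      ; X (there (here (φ , inj , eq))) → circuit-resp (g₂₁₂Weight n) eq (K₃₄-circuit φ inj) })
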